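{- There exists a function $g\colon \mathbb{N} \to \mathbb{N}$ such that, for every $t$-vertex tree $T$, every graph $G$, every set $S\subseteq V(G)$, and every positive integer $k$, either $G$ contains $k$ vertex-disjoint $S$-rooted models of $T$, or there is a set $X\subseteq V(G)$ with $|X|\leq g(t)\cdot k$ such that $G-X$ has no $S$-rooted model of $T$.
   Context: All graphs are finite, simple and undirected. A model of a graph $H$ in a graph $G$ is a family $(B_x \mid x\in V(H))$ of pairwise disjoint nonempty subsets of $V(G)$, called branch sets, each inducing a connected subgraph of $G$, such that for every $xy\in E(H)$ there is an edge of $G$ with one endpoint in $B_x$ and one endpoint in $B_y$. Given a set $S$ of vertices, the model is $S$-rooted if every branch set contains a vertex of $S$ ($S$ may contain vertices not in the graph under consideration; so an $S$-rooted model in $G-X$ is an $(S\setminus X)$-rooted model in $G-X$). Models are vertex-disjoint if the unions of their branch sets are pairwise disjoint. $G-X$ is the graph obtained from $G$ by deleting the vertices in $X$. -}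

module Defs where

open import Data.Fin using (Fin)
open import Data.Fin.Subset using (Subset; _∈_; _⊆_; _∩_; ∁; ∣_∣; Nonempty; Empty)
open import Data.Fin.Subset.Properties using (_∈?_; x∈p∩q⁺)
open import Data.List using (List; _∷_; _∷ʳ_; length)
open import Data.List.Relation.Unary.Linked using (Linked)
open import Data.List.Relation.Unary.Unique.Propositional using (Unique)
open import Data.Nat using (ℕ; _≤_)
open import Data.Product using (∃-syntax; Σ-syntax; _×_; _,_)
open import Level using (0ℓ)
open import Relation.Binary using (Rel; Symmetric; Decidable)
open import Relation.Binary.Construct.Closure.ReflexiveTransitive using (Star)
open import Relation.Nullary using (¬_; _×-dec_)
open import Relation.Binary.PropositionalEquality using (_≢_)

private variable
  m n : ℕ

-- The vertices form a subset V of an ambient finite set Fin n, so that induced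
-- subgraphs are again graphs over the same ambient set and subsets of vertices
-- of G can be compared directly with subsets of vertices of its subgraphs.
-- V need not be everything; every finite graph is of this form up to
-- isomorphism.  Decidability of adjacency is part of being a finite graph.
record Graph (n : ℕ) : Set₁ where
  infix 4 _~_ _~?_
  field
    V        : Subset n
    _~_      : Rel (Fin n) 0ℓ
    _~?_     : Decidable _~_
    ~-sym    : Symmetric _~_
    ~-irrefl : ∀ {u} → ¬ (u ~ u)
    ~⇒∈V     : ∀ {u v} → u ~ v → u ∈ V

open Graph public using (V)

order : Graph n → ℕ
order G = ∣ V G ∣

infixl 8 _[_] _-_

_[_] : Graph n → Subset n → Graph n
G [ W ] = record
  { V        = V G ∩ W
  ; _~_      = λ u v → u ~ v × u ∈ W × v ∈ W
  ; _~?_     = λ u v → (u ~? v) ×-dec ((u ∈? W) ×-dec (v ∈? W))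
  ; ~-sym    = λ (e , p , q) → ~-sym e , q , p
  ; ~-irrefl = λ (e , _) → ~-irrefl e
  ; ~⇒∈V     = λ (e , p , _) → x∈p∩q⁺ (~⇒∈V e , p)
  }
  where open Graph G using (_~_; _~?_; ~-sym; ~-irrefl; ~⇒∈V)

_-_ : Graph n → Subset n → Graph n
G - X = G [ ∁ X ]

Connected : Graph n → Set
Connected G = ∀ {u v} → u ∈ V G → v ∈ V G → Star _~_ u v
  where open Graph G using (_~_)

-- The list v ∷ vs enumerates the vertices of a cycle in cyclic order.
record IsCycle (G : Graph n) (v : Fin n) (vs : List (Fin n)) : Set where
  open Graph G using (_~_)
  field
    length≥3 : 3 ≤ length (v ∷ vs)
    distinct : Unique (v ∷ vs)
    closed   : Linked _~_ ((v ∷ vs) ∷ʳ v)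

Acyclic : Graph n → Set
Acyclic G = ∀ v vs → ¬ IsCycle G v vs

record IsTree (G : Graph n) : Set where
  field
    nonempty  : Nonempty (V G)
    connected : Connected G
    acyclic   : Acyclic G

-- Only the values of branch on V H matter; they are the branch sets.
record Model (H : Graph m) (G : Graph n) : Set where
  open Graph H using () renaming (_~_ to _~ᴴ_)
  open Graph G using () renaming (_~_ to _~ᴳ_)
  field
    branch    : Fin m → Subset n
    inside    : ∀ {x} → x ∈ V H → branch x ⊆ V G
    nonempty  : ∀ {x} → x ∈ V H → Nonempty (branch x)
    connected : ∀ {x} → x ∈ V H → Connected (G [ branch x ])
    disjoint  : ∀ {x y} → x ∈ V H → y ∈ V H → x ≢ y → Empty (branch x ∩ branch y)
    edges     : ∀ {x y} → x ~ᴴ y →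
                ∃[ u ] ∃[ v ] (u ∈ branch x × v ∈ branch y × u ~ᴳ v)

module _ {H : Graph m} {G : Graph n} where
  open Model

  infix 4 _∈⋃_
  _∈⋃_ : Fin n → Model H G → Set
  v ∈⋃ M = ∃[ x ] (x ∈ V H × v ∈ branch M x)

  VertexDisjoint : Model H G → Model H G → Set
  VertexDisjoint M N = ∀ v → ¬ (v ∈⋃ M × v ∈⋃ N)

  Rooted : Subset n → Model H G → Set
  Rooted S M = ∀ {x} → x ∈ V H → Nonempty (branch M x ∩ S)

RootedModel : Subset n → Graph m → Graph n → Set
RootedModel S H G = Σ[ M ∈ Model H G ] Rooted S M

DisjointRootedModels : ℕ → Subset n → Graph m → Graph n → Set
DisjointRootedModels k S H G =
  Σ[ M ∈ (Fin k → Model H G) ]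
    (∀ i → Rooted S (M i)) × (∀ {i j} → i ≢ j → VertexDisjoint (M i) (M j))

{-# OPTIONS --safe #-}

-- Fix a set F with few border vertices whose every proper superset has a larger border, and look
-- at the rest H of the graph. If H has a rooted model, grow in H an increasing family of sets
-- without rooted models, each maximal for its border size, carrying disjoint connected sets that
-- realise first one copy of T (the core) and then one further copy hanging at each core branch.
-- The growth can only fail at a pocket: a set with a rooted model that a bounded set Y kills and
-- cuts off. Otherwise the core is separated from S by fewer than t vertices, so some hanging copy
-- lies on the core's side, and Menger's theorem provides disjoint spokes from its branches to S:
-- a body of bounded border. Delete the set Y of each pocket, absorb each body into F, and take the
-- closure. Once H has no rooted model, the deleted vertices and the border of F hit every rooted
-- model.
--
-- It remains to bound the number of layers by the number of disjoint models. Pockets yield disjoint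
-- models directly. For bodies, walk back through the layers keeping disjoint rails from F to S; a
-- border vertex on no rail is dead. If some dead vertex lies outside the next smaller F, the rails
-- can be rerouted with one dead vertex less; if none does, the body's spokes can be joined to rails,
-- which gives a new disjoint model at the cost of boundedly many dead vertices.

module Submission where

open import Defs
open import Data.Empty using (⊥-elim)
open import Data.Fin using (Fin; zero; suc; inject≤)
open import Data.Fin.Properties using (any?; all?; _≟_; suc-injective; inject≤-injective)
open import Data.Fin.Subset using (Subset; inside; outside; _∈_; _∉_; _⊆_; _∩_; _∪_; _─_; ⁅_⁆; ∣_∣; ⊤; ∁)
  renaming (⊥ to ∅)
open import Data.Fin.Subset.Properties
open import Data.List using (List; []; _∷_; _∷ʳ_; length; allFin)
import Data.List.Membership.Propositional as List
open import Data.List.Membership.Propositional.Properties using (∈-allFin)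
open import Data.List.Properties using (length-tabulate)
open import Data.List.Relation.Unary.All as All using (All; []; _∷_)
open import Data.List.Relation.Unary.All.Properties using (¬Any⇒All¬)
open import Data.List.Relation.Unary.AllPairs using ([]; _∷_)
open import Data.List.Relation.Unary.Any as Any using (here; there)
open import Data.List.Relation.Unary.Linked using (Linked; [-]; _∷_)
open import Data.List.Relation.Unary.Unique.Propositional using (Unique)
open import Data.Nat using (ℕ; zero; suc; _+_; _*_; _∸_; _⊔_; _≤_; _<_; z≤n; s≤s; s≤s⁻¹; _<?_; _≤?_; NonZero)
open import Data.Nat.Properties using (≤-refl; ≤-trans; ≤-reflexive; ≤-antisym; ≤-total; <-≤-trans; ≤-<-trans;
  <-irrefl; ≮⇒≥; ≰⇒>; <⇒≤; <⇒≱; n≤1+n; m≤m+n; m≤n+m; m∸n+n≡m; m≤n+m∸n; m≤n+o⇒m∸n≤o; m≤m⊔n; m≤n⊔m; ⊔-lub;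
  +-suc; +-comm; +-assoc; +-identityʳ; +-mono-≤; +-monoʳ-≤; +-monoˡ-≤; +-cancelʳ-≤; +-cancelˡ-≤; *-monoʳ-≤; *-suc;
  module ≤-Reasoning)
open import Data.Nat.Solver using (module +-*-Solver)
open import Data.Product using (∃-syntax; Σ-syntax; _×_; _,_; proj₁; proj₂)
open import Data.Sum using (_⊎_; inj₁; inj₂; [_,_]′)
open import Data.Vec using (Vec; []; _∷_; here; there; lookup; tabulate)
open import Data.Vec.Properties using (lookup⇒[]=; []=⇒lookup; lookup∘tabulate)
open import Function using (_∘_; id)
open import Level using (0ℓ)
open import Relation.Binary using (Rel; Symmetric; Decidable)
open import Relation.Binary.Construct.Closure.ReflexiveTransitive as Star using (Star; ε; _◅_; _◅◅_)
open import Relation.Binary.PropositionalEquality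
  using (_≡_; _≢_; refl; sym; trans; cong; subst; module ≡-Reasoning)
open import Relation.Nullary using (¬_; Dec; yes; no; does; ¬?; _×-dec_; _⊎-dec_; _→-dec_; map′)
open import Relation.Nullary.Decidable using (dec-true; decidable-stable)
open import Relation.Nullary.Negation using (contradiction)
open +-*-Solver using (solve; _:+_; _:*_; con; _:=_)

-- The obstacle is that bodies of different layers need not give disjoint models: their sets `X` are
-- disjoint, but the spokes run outward through later layers and may share vertices. So spokes only
-- serve to verify Menger's condition, while the actual routes to `S` come from one system of rails
-- that is pulled inward from layer to layer. Closedness of `F` keeps this system large: a layer
-- that yields no model must at least revive a dead vertex, so the number of bodies stays linear in
-- the numbers of models and pockets. The constants count vertices. A growth never has more than `J`
-- rails. A pocket is cut off by the border of the grown set together with a separator from `S`,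
-- each of size at most `J`, whence `c₁`. A body is bordered by fewer than `t` separator vertices,
-- at most `t` border vertices of the core and at most `J` of the grown set, whence `c₂`. Separators
-- appear as borders of the sets that they cut off, which makes submodularity applicable, and rails
-- are connected sets, which can be joined by taking unions.

private variable
  m n : ℕ
  p q r : Subset n
  x y : Fin n

-- Finite subsets and counting

module _ {P : Fin n → Set} (P? : ∀ x → Dec (P x)) where

  sep : Subset n
  sep = tabulate (does ∘ P?)

  sep⁺ : P x → x ∈ sep
  sep⁺ {x} px = lookup⇒[]= x sep (trans (lookup∘tabulate (does ∘ P?) x) (dec-true (P? x) px))

  sep⁻ : x ∈ sep → P x
  sep⁻ {x} x∈ with P? x | trans (sym (lookup∘tabulate (does ∘ P?) x)) ([]=⇒lookup x∈)
  ... | yes px | _ = px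
  ... | no _   | ()

∪ˡ : x ∈ p → x ∈ p ∪ q
∪ˡ = x∈p∪q⁺ ∘ inj₁

∪ʳ : x ∈ q → x ∈ p ∪ q
∪ʳ = x∈p∪q⁺ ∘ inj₂

∪⁻ : x ∈ p ∪ q → x ∈ p ⊎ x ∈ q
∪⁻ = x∈p∪q⁻ _ _

∪-⊆ : p ⊆ r → q ⊆ r → p ∪ q ⊆ r
∪-⊆ p⊆ q⊆ = [ p⊆ , q⊆ ]′ ∘ ∪⁻

─⁺ : x ∈ p → x ∉ q → x ∈ p ─ q
─⁺ = x∈p∧x∉q⇒x∈p─q

─⁻ˡ : x ∈ p ─ q → x ∈ p
─⁻ˡ {p = p} {q = q} = p─q⊆p p q

─⁻ʳ : x ∈ p ─ q → x ∉ q
─⁻ʳ {p = _ ∷ _} {q = _ ∷ _} (there x∈) (there x∈q) = ─⁻ʳ x∈ x∈q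
─⁻ʳ {p = inside ∷ _} {q = inside ∷ _} () here
─⁻ʳ {p = outside ∷ _} {q = inside ∷ _} () here

⁅⁆⁻ : x ∈ ⁅ y ⁆ → x ≡ y
⁅⁆⁻ = x∈⁅y⁆⇒x≡y _

⁅⁆⊆ : x ∈ p → ⁅ x ⁆ ⊆ p
⁅⁆⊆ x∈p y∈ = subst (_∈ _) (sym (⁅⁆⁻ y∈)) x∈p

∣∪∣+∣∩∣ : ∀ (p q : Subset n) → ∣ p ∪ q ∣ + ∣ p ∩ q ∣ ≡ ∣ p ∣ + ∣ q ∣
∣∪∣+∣∩∣ []            []            = refl
∣∪∣+∣∩∣ (outside ∷ p) (outside ∷ q) = ∣∪∣+∣∩∣ p q
∣∪∣+∣∩∣ (outside ∷ p) (inside ∷ q)  = trans (cong suc (∣∪∣+∣∩∣ p q)) (sym (+-suc ∣ p ∣ ∣ q ∣))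
∣∪∣+∣∩∣ (inside ∷ p)  (outside ∷ q) = cong suc (∣∪∣+∣∩∣ p q)
∣∪∣+∣∩∣ (inside ∷ p)  (inside ∷ q)  =
  cong suc (trans (+-suc ∣ p ∪ q ∣ ∣ p ∩ q ∣) (trans (cong suc (∣∪∣+∣∩∣ p q)) (sym (+-suc ∣ p ∣ ∣ q ∣))))

∣∪∣≤ : ∀ (p q : Subset n) → ∣ p ∪ q ∣ ≤ ∣ p ∣ + ∣ q ∣
∣∪∣≤ p q = subst (∣ p ∪ q ∣ ≤_) (∣∪∣+∣∩∣ p q) (m≤m+n _ _)

⊆∪⇒≤ : ∀ (q r : Subset n) → p ⊆ q ∪ r → ∣ p ∣ ≤ ∣ q ∣ + ∣ r ∣
⊆∪⇒≤ q r p⊆ = ≤-trans (p⊆q⇒∣p∣≤∣q∣ p⊆) (∣∪∣≤ q r)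

⊆⇒≤ : p ⊆ q → ∣ p ∣ ≤ ∣ q ∣
⊆⇒≤ = p⊆q⇒∣p∣≤∣q∣

⊆∧∌⇒< : p ⊆ q → x ∈ q → x ∉ p → ∣ p ∣ < ∣ q ∣
⊆∧∌⇒< p⊆q x∈q x∉p = p⊂q⇒∣p∣<∣q∣ (p⊆q , _ , x∈q , x∉p)

⊆∧≥⇒⊇ : p ⊆ q → ∣ q ∣ ≤ ∣ p ∣ → q ⊆ p
⊆∧≥⇒⊇ {p = p} p⊆q q≤p {x} x∈q with x ∈? p
... | yes x∈p = x∈p
... | no  x∉p = contradiction (<-≤-trans (⊆∧∌⇒< p⊆q x∈q x∉p) q≤p) (<-irrefl refl)

∣─∣+∣∣ : ∀ (p q : Subset n) → q ⊆ p → ∣ p ─ q ∣ + ∣ q ∣ ≤ ∣ p ∣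
∣─∣+∣∣ {n} p q q⊆p = begin
  ∣ p ─ q ∣ + ∣ q ∣                       ≡⟨ ∣∪∣+∣∩∣ (p ─ q) q ⟨
  ∣ (p ─ q) ∪ q ∣ + ∣ (p ─ q) ∩ q ∣       ≤⟨ +-mono-≤ (⊆⇒≤ {p = (p ─ q) ∪ q} (∪-⊆ {p = p ─ q} ─⁻ˡ q⊆p)) (⊆⇒≤ {p = (p ─ q) ∩ q} {q = ∅} none) ⟩
  ∣ p ∣ + ∣ ∅ {n} ∣                       ≡⟨ cong (∣ p ∣ +_) (∣⊥∣≡0 n) ⟩
  ∣ p ∣ + 0                               ≡⟨ +-comm ∣ p ∣ 0 ⟩
  ∣ p ∣                                   ∎
  where
  open ≤-Reasoning
  none : (p ─ q) ∩ q ⊆ ∅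
  none x∈ = let a , b = x∈p∩q⁻ (p ─ q) q x∈ in contradiction b (─⁻ʳ a)

⊆─∪ : p ⊆ (p ─ q) ∪ q
⊆─∪ {q = q} {x} x∈p with x ∈? q
... | yes x∈q = ∪ʳ x∈q
... | no  x∉q = ∪ˡ (─⁺ x∈p x∉q)

∣∪⁅⁆∣ : ∀ (p : Subset n) → x ∉ p → ∣ p ∪ ⁅ x ⁆ ∣ ≡ suc ∣ p ∣
∣∪⁅⁆∣ {x = x} p x∉p = ≤-antisym
  (≤-trans (∣∪∣≤ p ⁅ x ⁆) (≤-reflexive (trans (cong (∣ p ∣ +_) (∣⁅x⁆∣≡1 x)) (+-comm ∣ p ∣ 1))))
  (⊆∧∌⇒< (∪ˡ {p = p}) (∪ʳ (x∈⁅x⁆ x)) x∉p)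

-- `R` is a relation because the vertex in which, say, a rail meets `C` is only known to exist;
-- disjointness of the rails then provides the injectivity.
∣∣-injection : ∀ (U : Subset m) (C : Subset n) (R : Fin m → Fin n → Set) →
               (∀ {g} → g ∈ U → ∃[ c ] (c ∈ C × R g c)) →
               (∀ {g h c} → R g c → R h c → g ≡ h) →
               ∣ U ∣ ≤ ∣ C ∣
∣∣-injection []            C R f inj = z≤n
∣∣-injection (outside ∷ U) C R f inj =
  ∣∣-injection U C (R ∘ suc) (f ∘ there) (λ a b → suc-injective (inj a b))
∣∣-injection (inside ∷ U)  C R f inj with f here
... | c , c∈C , Rc = ≤-trans
  (s≤s (∣∣-injection U (C ─ ⁅ c ⁆) (R ∘ suc) rest (λ a b → suc-injective (inj a b))))
  (⊆∧∌⇒< (─⁻ˡ {p = C}) c∈C (λ c∈ → ─⁻ʳ {p = C} c∈ (x∈⁅x⁆ c)))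
  where
  rest : ∀ {g} → g ∈ U → ∃[ d ] (d ∈ C ─ ⁅ c ⁆ × R (suc g) d)
  rest g∈U with f (there g∈U)
  ... | d , d∈C , Rd = d , ─⁺ d∈C (λ d∈ → case (inj (subst (R _) (⁅⁆⁻ d∈) Rd) Rc)) , Rd
    where case : ∀ {g : Fin m} → suc g ≡ zero → _
          case ()

module _ {P : Subset n → Set} (P? : ∀ E → Dec (P E)) (μ : Subset n → ℕ) where

  abstract

    argmin : ∀ {E} → P E → ∃[ F ] (P F × ∀ {E′} → P E′ → μ F ≤ μ E′)
    argmin {E} PE = go (μ E) PE ≤-refl
      where
      go : ∀ k {E} → P E → μ E ≤ k → ∃[ F ] (P F × ∀ {E′} → P E′ → μ F ≤ μ E′)
      go k {E} PE E≤k with anySubset? (λ E′ → P? E′ ×-dec (μ E′ <? μ E))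
      ... | no none = E , PE , λ PE′ → ≮⇒≥ (λ lt → none (_ , PE′ , lt))
      go zero    {E} PE E≤k | yes (E′ , PE′ , lt) = contradiction (<-≤-trans lt E≤k) λ ()
      go (suc k) {E} PE E≤k | yes (E′ , PE′ , lt) = go k PE′ (s≤s⁻¹ (<-≤-trans lt E≤k))

allSubset? : ∀ {P : Subset n → Set} → (∀ E → Dec (P E)) → Dec (∀ E → P E)
allSubset? P? with anySubset? (λ E → ¬? (P? E))
... | yes (E , ¬PE) = no λ all → ¬PE (all E)
... | no none       = yes λ E → decidable-stable (P? E) (λ ¬PE → none (E , ¬PE))

⊆∪⁅⁆⇒≤ : ∀ (q : Subset n) x → p ⊆ q ∪ ⁅ x ⁆ → ∣ p ∣ ≤ suc ∣ q ∣
⊆∪⁅⁆⇒≤ q x p⊆ = ≤-trans (⊆∪⇒≤ q ⁅ x ⁆ p⊆)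
  (≤-reflexive (trans (cong (∣ q ∣ +_) (∣⁅x⁆∣≡1 x)) (+-comm ∣ q ∣ 1)))

Fin-injection : ∀ {k} (C : Subset n) (R : Fin k → Fin n → Set) →
                (∀ i → ∃[ c ] (c ∈ C × R i c)) → (∀ {i j c} → R i c → R j c → i ≡ j) → k ≤ ∣ C ∣
Fin-injection {k = k} C R f inj =
  subst (_≤ ∣ C ∣) (∣⊤∣≡n k) (∣∣-injection ⊤ C R (λ {g} _ → f g) inj)

module _ {P : Subset n → Set} (P? : ∀ E → Dec (P E)) where

  abstract

    maximal : ∀ {E} → P E → ∃[ F ] (P F × E ⊆ F × ∀ {F′} → P F′ → F ⊆ F′ → F′ ⊆ F)
    maximal {E} PE = go ∣ ∁ E ∣ PE ≤-refl
      where
      go : ∀ k {E} → P E → ∣ ∁ E ∣ ≤ k → ∃[ F ] (P F × E ⊆ F × ∀ {F′} → P F′ → F ⊆ F′ → F′ ⊆ F)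
      go k {E} PE E≤k with anySubset? (λ F → P? F ×-dec (E ⊆? F) ×-dec ¬? (F ⊆? E))
      ... | no none = E , PE , id , λ {F} PF E⊆F → decidable-stable (F ⊆? E) (λ F⊈E → none (F , PF , E⊆F , F⊈E))
      ... | yes (F , PF , E⊆F , F⊈E) = step k E≤k
        where
        lt : ∣ ∁ F ∣ < ∣ ∁ E ∣
        lt with any? (λ x → (x ∈? F) ×-dec ¬? (x ∈? E))
        ... | yes (x , x∈F , x∉E) = ⊆∧∌⇒< {p = ∁ F} (λ y∈ → x∉p⇒x∈∁p (x∈∁p⇒x∉p y∈ ∘ E⊆F)) (x∉p⇒x∈∁p x∉E) (λ x∈ → x∈∁p⇒x∉p x∈ x∈F)
        ... | no  none            = contradiction (λ {x} x∈F → decidable-stable (x ∈? E) (λ x∉E → none (x , x∈F , x∉E))) F⊈E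
        step : ∀ k → ∣ ∁ E ∣ ≤ k → ∃[ G ] (P G × E ⊆ G × ∀ {F′} → P F′ → G ⊆ F′ → F′ ⊆ G)
        step zero    E≤ = contradiction (<-≤-trans lt E≤) λ ()
        step (suc k) E≤ with go k PF (s≤s⁻¹ (<-≤-trans lt E≤))
        ... | G , PG , F⊆G , max = G , PG , F⊆G ∘ E⊆F , max

⊈⇒∃ : ¬ (p ⊆ q) → ∃[ x ] (x ∈ p × x ∉ q)
⊈⇒∃ {p = p} {q} p⊈q = decidable-stable (any? λ x → (x ∈? p) ×-dec ¬? (x ∈? q))
  λ none → p⊈q λ {x} x∈p → decidable-stable (x ∈? q) λ x∉q → none (x , x∈p , x∉q)

-- Borders, connectivity and links

∣∣-exchange : ∀ {p q a b : Subset n} → p ∪ q ⊆ a ∪ b → p ∩ q ⊆ a ∩ b → ∣ p ∣ + ∣ q ∣ ≤ ∣ a ∣ + ∣ b ∣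
∣∣-exchange {p = p} {q} {a} {b} ∪⊆ ∩⊆ = begin
  ∣ p ∣ + ∣ q ∣          ≡⟨ ∣∪∣+∣∩∣ p q ⟨
  ∣ p ∪ q ∣ + ∣ p ∩ q ∣  ≤⟨ +-mono-≤ (⊆⇒≤ {p = p ∪ q} ∪⊆) (⊆⇒≤ {p = p ∩ q} ∩⊆) ⟩
  ∣ a ∪ b ∣ + ∣ a ∩ b ∣  ≡⟨ ∣∪∣+∣∩∣ a b ⟩
  ∣ a ∣ + ∣ b ∣          ∎
  where open ≤-Reasoning

module Separation {n} (_~_ : Rel (Fin n) 0ℓ) (_~?_ : Decidable _~_) (~-sym : Symmetric _~_) where

  -- Vertices of `B` count as if they had a neighbour beyond `M`. Thus every connected subset of `M`
  -- that joins `E` to `B` meets the border of `E`.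
  Leaves : (M B E : Subset n) → Fin n → Set
  Leaves M B E x = x ∈ B ⊎ ∃[ y ] (y ∈ M × y ∉ E × x ~ y)

  leaves? : ∀ M B E x → Dec (Leaves M B E x)
  leaves? M B E x = (x ∈? B) ⊎-dec any? (λ y → (y ∈? M) ×-dec ¬? (y ∈? E) ×-dec (x ~? y))

  border? : ∀ M B E x → Dec (x ∈ E × Leaves M B E x)
  border? M B E x = (x ∈? E) ×-dec leaves? M B E x

  abstract

    border : (M B E : Subset n) → Subset n
    border M B E = sep (border? M B E)

    border⁺ : ∀ {M B E x} → x ∈ E → Leaves M B E x → x ∈ border M B E
    border⁺ {M} {B} {E} x∈E l = sep⁺ (border? M B E) (x∈E , l)

    border⁻ : ∀ {M B E x} → x ∈ border M B E → x ∈ E × Leaves M B E x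
    border⁻ {M} {B} {E} = sep⁻ (border? M B E)

  border⊆ : ∀ {M B E} → border M B E ⊆ E
  border⊆ = proj₁ ∘ border⁻

  o : (M B E : Subset n) → ℕ
  o M B E = ∣ border M B E ∣

  o≤ : ∀ M B E → o M B E ≤ ∣ E ∣
  o≤ M B E = ⊆⇒≤ (border⊆ {M} {B} {E})

  -- An exit from `E ∩ E′` leaves `E` or `E′`, and an exit from `E ∪ E′` leaves both, so no vertex
  -- is counted more often on the left than on the right.
  o-submodular : ∀ M B E E′ → o M B (E ∪ E′) + o M B (E ∩ E′) ≤ o M B E + o M B E′
  o-submodular M B E E′ = ∣∣-exchange {p = border M B (E ∪ E′)} {border M B (E ∩ E′)} {border M B E} {border M B E′}
    (∪-⊆ {p = border M B (E ∪ E′)} union inter) (λ x∈ → both (x∈p∩q⁻ (border M B (E ∪ E′)) _ x∈))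
    where
    union : border M B (E ∪ E′) ⊆ border M B E ∪ border M B E′
    union x∈ with border⁻ {M} {B} {E ∪ E′} x∈
    ... | x∈∪ , inj₁ x∈B = [ (λ x∈E → ∪ˡ (border⁺ x∈E (inj₁ x∈B))) , (λ x∈E → ∪ʳ (border⁺ x∈E (inj₁ x∈B))) ]′ (∪⁻ x∈∪)
    ... | x∈∪ , inj₂ (y , y∈M , y∉ , x~y) =
      [ (λ x∈E → ∪ˡ (border⁺ x∈E (inj₂ (y , y∈M , y∉ ∘ ∪ˡ , x~y)))) , (λ x∈E → ∪ʳ (border⁺ x∈E (inj₂ (y , y∈M , y∉ ∘ ∪ʳ , x~y)))) ]′ (∪⁻ x∈∪)
    inter : border M B (E ∩ E′) ⊆ border M B E ∪ border M B E′
    inter x∈ with border⁻ {M} {B} {E ∩ E′} x∈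
    ... | x∈∩ , l with x∈p∩q⁻ E E′ x∈∩ | l
    ... | x∈E , x∈E′ | inj₁ x∈B = ∪ˡ (border⁺ x∈E (inj₁ x∈B))
    ... | x∈E , x∈E′ | inj₂ (y , y∈M , y∉ , x~y) with y ∈? E
    ... | yes y∈E = ∪ʳ (border⁺ x∈E′ (inj₂ (y , y∈M , (λ y∈E′ → y∉ (x∈p∩q⁺ (y∈E , y∈E′))) , x~y)))
    ... | no  y∉E = ∪ˡ (border⁺ x∈E (inj₂ (y , y∈M , y∉E , x~y)))
    both : ∀ {x} → x ∈ border M B (E ∪ E′) × x ∈ border M B (E ∩ E′) → x ∈ border M B E ∩ border M B E′
    both (x∈₁ , x∈₂) with border⁻ {M} {B} {E ∪ E′} x∈₁ | x∈p∩q⁻ E E′ (border⊆ {M} {B} x∈₂)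
    ... | _ , inj₁ x∈B | x∈E , x∈E′ = x∈p∩q⁺ (border⁺ x∈E (inj₁ x∈B) , border⁺ x∈E′ (inj₁ x∈B))
    ... | _ , inj₂ (y , y∈M , y∉ , x~y) | x∈E , x∈E′ =
      x∈p∩q⁺ (border⁺ x∈E (inj₂ (y , y∈M , y∉ ∘ ∪ˡ , x~y)) , border⁺ x∈E′ (inj₂ (y , y∈M , y∉ ∘ ∪ʳ , x~y)))

  border-delete : ∀ M B E D → border M B (E ∪ D) ⊆ border (M ─ D) B E ∪ D
  border-delete M B E D x∈ with border⁻ {M} {B} {E ∪ D} x∈
  ... | x∈∪ , l with ∪⁻ x∈∪ | l
  ... | inj₂ x∈D | _ = ∪ʳ x∈D
  ... | inj₁ x∈E | inj₁ x∈B = ∪ˡ (border⁺ x∈E (inj₁ x∈B))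
  ... | inj₁ x∈E | inj₂ (y , y∈M , y∉ , x~y) = ∪ˡ (border⁺ x∈E (inj₂ (y , ─⁺ y∈M (y∉ ∘ ∪ʳ) , y∉ ∘ ∪ˡ , x~y)))

  Step : Subset n → Rel (Fin n) 0ℓ
  Step P x y = x ~ y × x ∈ P × y ∈ P

  Conn : Subset n → Set
  Conn P = ∀ {u v} → u ∈ P → v ∈ P → Star (Step P) u v

  path-mono : ∀ {P Q} → P ⊆ Q → Star (Step P) x y → Star (Step Q) x y
  path-mono P⊆Q = Star.map λ (e , a , b) → e , P⊆Q a , P⊆Q b

  conn-⁅⁆ : ∀ x → Conn ⁅ x ⁆
  conn-⁅⁆ x u∈ v∈ with ⁅⁆⁻ u∈ | ⁅⁆⁻ v∈
  ... | refl | refl = ε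

  path-sym : ∀ {P} → Star (Step P) x y → Star (Step P) y x
  path-sym = Star.reverse λ (e , a , b) → ~-sym e , b , a

  conn-∪ : ∀ {P Q a b} → Conn P → Conn Q → a ∈ P → b ∈ Q → a ≡ b ⊎ a ~ b → Conn (P ∪ Q)
  conn-∪ {P} {Q} {a} {b} cP cQ a∈P b∈Q a-b {u} {v} u∈ v∈ = path-sym (from-a u∈) ◅◅ from-a v∈
    where
    a→b : a ≡ b ⊎ a ~ b → Star (Step (P ∪ Q)) a b
    a→b (inj₁ refl) = ε
    a→b (inj₂ e)    = (e , ∪ˡ a∈P , ∪ʳ b∈Q) ◅ ε
    from-a : ∀ {v} → v ∈ P ∪ Q → Star (Step (P ∪ Q)) a v
    from-a v∈ with ∪⁻ v∈
    ... | inj₁ v∈P = path-mono ∪ˡ (cP a∈P v∈P)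
    ... | inj₂ v∈Q = a→b a-b ◅◅ path-mono (∪ʳ {p = P}) (cQ b∈Q v∈Q)

  exit : ∀ {P} E → Star (Step P) x y → x ∈ E → y ∉ E → ∃[ a ] ∃[ b ] (a ~ b × a ∈ P × b ∈ P × a ∈ E × b ∉ E)
  exit E ε x∈E y∉E = contradiction x∈E y∉E
  exit E (_◅_ {x} {z} (e , x∈P , z∈P) π) x∈E y∉E with z ∈? E
  ... | yes z∈E = exit E π z∈E y∉E
  ... | no  z∉E = x , z , e , x∈P , z∈P , x∈E , z∉E

  abstract

    component : ∀ {P x} → x ∈ P →
                ∃[ C ] (x ∈ C × (∀ {y} → y ∈ C → Star (Step P) x y) × (∀ {a b} → a ~ b → a ∈ C → b ∈ P → b ∈ C))
    component {P} {x} x∈P = grow ∣ P ─ ⁅ x ⁆ ∣ ⁅ x ⁆ ≤-refl (x∈⁅x⁆ x) (⁅⁆⊆ x∈P) (λ y∈ → subst (Star (Step P) x) (sym (⁅⁆⁻ y∈)) ε)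
      where
      grow : ∀ k C → ∣ P ─ C ∣ ≤ k → x ∈ C → C ⊆ P → (∀ {y} → y ∈ C → Star (Step P) x y) →
             ∃[ C ] (x ∈ C × (∀ {y} → y ∈ C → Star (Step P) x y) × (∀ {a b} → a ~ b → a ∈ C → b ∈ P → b ∈ C))
      grow k C ≤k x∈C C⊆P reach
        with any? (λ a → any? (λ b → (a ~? b) ×-dec (a ∈? C) ×-dec (b ∈? P) ×-dec ¬? (b ∈? C)))
      ... | no none = C , x∈C , reach , λ {a} {b} a~b a∈C b∈P →
        decidable-stable (b ∈? C) (λ b∉C → none (a , b , a~b , a∈C , b∈P , b∉C))
      ... | yes (a , b , a~b , a∈C , b∈P , b∉C) = next k ≤k
        where
        lt : ∣ P ─ (C ∪ ⁅ b ⁆) ∣ < ∣ P ─ C ∣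
        lt = ⊆∧∌⇒< {p = P ─ (C ∪ ⁅ b ⁆)} (λ z∈ → ─⁺ (─⁻ˡ {p = P} z∈) (─⁻ʳ {p = P} z∈ ∘ ∪ˡ)) (─⁺ b∈P b∉C) (λ b∈ → ─⁻ʳ {p = P} b∈ (∪ʳ (x∈⁅x⁆ b)))
        reach′ : ∀ {y} → y ∈ C ∪ ⁅ b ⁆ → Star (Step P) x y
        reach′ y∈ with ∪⁻ y∈
        ... | inj₁ y∈C = reach y∈C
        ... | inj₂ y∈b = subst (Star (Step P) x) (sym (⁅⁆⁻ y∈b)) (reach a∈C ◅◅ (a~b , C⊆P a∈C , b∈P) ◅ ε)
        next : ∀ k → ∣ P ─ C ∣ ≤ k →
               ∃[ C ] (x ∈ C × (∀ {y} → y ∈ C → Star (Step P) x y) × (∀ {a b} → a ~ b → a ∈ C → b ∈ P → b ∈ C))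
        next zero    ≤k = contradiction (<-≤-trans lt ≤k) λ ()
        next (suc k) ≤k = grow k (C ∪ ⁅ b ⁆) (s≤s⁻¹ (<-≤-trans lt ≤k)) (∪ˡ x∈C) (∪-⊆ C⊆P (⁅⁆⊆ b∈P)) reach′

  abstract

    conn? : ∀ P → Dec (Conn P)
    conn? P with any? (_∈? P)
    ... | no none = yes λ u∈ → contradiction (_ , u∈) none
    ... | yes (x , x∈P) with component x∈P
    ... | C , x∈C , reach , closed with P ⊆? C
    ... | yes P⊆C = yes λ u∈ v∈ → path-sym (reach (P⊆C u∈)) ◅◅ reach (P⊆C v∈)
    ... | no  P⊈C = no λ cP → P⊈C λ {y} y∈P → decidable-stable (y ∈? C) λ y∉C →
      let a , b , a~b , _ , b∈P , a∈C , b∉C = exit C (cP x∈P y∈P) x∈C y∉C in b∉C (closed a~b a∈C b∈P)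

  record Link (k : ℕ) (M A B : Subset n) : Set where
    field
      rail   : Fin k → Subset n
      within : ∀ {i} → rail i ⊆ M
      conn   : ∀ i → Conn (rail i)
      source : ∀ i → ∃[ a ] (a ∈ rail i × a ∈ A)
      sink   : ∀ i → ∃[ b ] (b ∈ rail i × b ∈ B)
      disj   : ∀ {i j x} → x ∈ rail i → x ∈ rail j → i ≡ j

  module _ {k M A B} (L : Link k M A B) where
    open Link L

    abstract

      -- The `k` disjoint rails need `k` different sources; if `a` were on none of them, fewer than
      -- `k` would be available.
      source-cover : ∣ A ∣ ≤ k → ∀ {a} → a ∈ A → ∃[ i ] a ∈ rail i
      source-cover A≤k {a} a∈A with any? (λ i → a ∈? rail i)
      ... | yes found = found
      ... | no  none  = contradiction (≤-<-trans (Fin-injection (A ─ ⁅ a ⁆) (λ i c → c ∈ rail i) meets disj) smaller) (<-irrefl refl)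
        where
        meets : ∀ i → ∃[ c ] (c ∈ A ─ ⁅ a ⁆ × c ∈ rail i)
        meets i with source i
        ... | c , c∈P , c∈A = c , ─⁺ c∈A (λ c∈ → none (i , subst (_∈ rail i) (⁅⁆⁻ c∈) c∈P)) , c∈P
        smaller : ∣ A ─ ⁅ a ⁆ ∣ < k
        smaller = <-≤-trans (⊆∧∌⇒< {p = A ─ ⁅ a ⁆} (─⁻ˡ {p = A}) a∈A (λ a∈ → ─⁻ʳ {p = A} a∈ (x∈⁅x⁆ a))) A≤k

    abstract

      -- If a rail contained a second vertex `b` of `A`, then `b` could be dropped from `A` and
      -- every rail would still have a source.
      source-unique : ∣ A ∣ ≤ k → ∀ {i a b} → a ∈ rail i → b ∈ rail i → a ∈ A → b ∈ A → a ≡ b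
      source-unique A≤k {i} {a} {b} a∈P b∈P a∈A b∈A = decidable-stable (a ≟ b) λ a≢b →
        contradiction (≤-<-trans (Fin-injection (A ─ ⁅ b ⁆) (λ i c → c ∈ rail i) (meets a≢b) disj) smaller) (<-irrefl refl)
        where
        meets : a ≢ b → ∀ j → ∃[ c ] (c ∈ A ─ ⁅ b ⁆ × c ∈ rail j)
        meets a≢b j with j ≟ i
        ... | yes refl = a , ─⁺ a∈A (a≢b ∘ ⁅⁆⁻) , a∈P
        ... | no  j≢i with source j
        ... | c , c∈P , c∈A = c , ─⁺ c∈A (λ c∈ → j≢i (disj (subst (_∈ rail j) (⁅⁆⁻ c∈) c∈P) b∈P)) , c∈P
        smaller : ∣ A ─ ⁅ b ⁆ ∣ < k
        smaller = <-≤-trans (⊆∧∌⇒< {p = A ─ ⁅ b ⁆} (─⁻ˡ {p = A}) b∈A (λ b∈ → ─⁻ʳ {p = A} b∈ (x∈⁅x⁆ b))) A≤k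

  link-mono : ∀ {k M M′ A A′ B B′} → M ⊆ M′ → A ⊆ A′ → B ⊆ B′ → Link k M A B → Link k M′ A′ B′
  link-mono M⊆ A⊆ B⊆ L = record
    { rail = rail ; within = M⊆ ∘ within ; conn = conn
    ; source = λ i → let a , p , q = source i in a , p , A⊆ q
    ; sink = λ i → let b , p , q = sink i in b , p , B⊆ q ; disj = disj }
    where open Link L

  link-zero : ∀ {M A B} → Link 0 M A B
  link-zero = record { rail = λ () ; within = λ {} ; conn = λ () ; source = λ () ; sink = λ () ; disj = λ {} }

  link-cons : ∀ {k M A B} Q → Q ⊆ M → Conn Q → ∃[ a ] (a ∈ Q × a ∈ A) → ∃[ b ] (b ∈ Q × b ∈ B) →
              Link k (M ─ Q) A B → Link (suc k) M A B
  link-cons {k} {M} Q Q⊆M cQ src snk L = record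
    { rail = P ; within = λ {i} → P⊆ i ; conn = λ { zero → cQ ; (suc i) → conn i }
    ; source = λ { zero → src ; (suc i) → source i } ; sink = λ { zero → snk ; (suc i) → sink i } ; disj = λ {i} {j} → P-disj i j }
    where
    open Link L
    P : Fin (suc k) → Subset n
    P zero    = Q
    P (suc i) = rail i
    P⊆ : ∀ i → P i ⊆ M
    P⊆ zero    = Q⊆M
    P⊆ (suc i) = ─⁻ˡ {p = M} ∘ within
    P-disj : ∀ i j {x} → x ∈ P i → x ∈ P j → i ≡ j
    P-disj zero    zero    _ _ = refl
    P-disj zero    (suc j) x∈Q x∈P = contradiction x∈Q (─⁻ʳ {p = M} (within x∈P))
    P-disj (suc i) zero    x∈P x∈Q = contradiction x∈Q (─⁻ʳ {p = M} (within x∈P))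
    P-disj (suc i) (suc j) x∈ x∈′ = cong suc (disj x∈ x∈′)

  abstract

    -- As `C` has at most `k` vertices, the rails of `L₂` cover `C` and each contains just one
    -- vertex of it, so each rail of `L₁` has a definite continuation; rails of the two links can
    -- meet only in `C`. The extra conclusions keep the numbering of `L₁` and locate the added
    -- vertices in `N`.
    link-glue : ∀ {k M N A B C} → ∣ C ∣ ≤ k → (∀ {x} → x ∈ M → x ∈ N → x ∈ C) →
                (L₁ : Link k M A C) → Link k N C B →
                Σ[ L ∈ Link k (M ∪ N) A B ] ((∀ i → Link.rail L₁ i ⊆ Link.rail L i) ×
                                             (∀ {i z} → z ∈ Link.rail L i → z ∈ Link.rail L₁ i ⊎ z ∈ N))
    link-glue {k} {M} {N} {A} {B} {C} C≤k M∩N⊆C L₁ L₂ = record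
      { rail = P ; within = λ {i} → ∪-⊆ {p = L₁.rail i} (∪ˡ ∘ L₁.within) (∪ʳ ∘ L₂.within)
      ; conn = λ i → conn-∪ (L₁.conn i) (L₂.conn (σ i)) (c∈₁ i) (c∈₂ i) (inj₁ refl)
      ; source = λ i → let a , p , q = L₁.source i in a , ∪ˡ p , q
      ; sink = λ i → let b , p , q = L₂.sink (σ i) in b , ∪ʳ p , q
      ; disj = P-disj } , (λ i → ∪ˡ) , λ z∈ → [ inj₁ , inj₂ ∘ L₂.within ]′ (∪⁻ z∈)
      where
      module L₁ = Link L₁
      module L₂ = Link L₂
      c : Fin k → Fin n
      c i = proj₁ (L₁.sink i)
      c∈₁ : ∀ i → c i ∈ L₁.rail i
      c∈₁ i = proj₁ (proj₂ (L₁.sink i))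
      c∈C : ∀ i → c i ∈ C
      c∈C i = proj₂ (proj₂ (L₁.sink i))
      σ : Fin k → Fin k
      σ i = proj₁ (source-cover L₂ C≤k (c∈C i))
      c∈₂ : ∀ i → c i ∈ L₂.rail (σ i)
      c∈₂ i = proj₂ (source-cover L₂ C≤k (c∈C i))
      P : Fin k → Subset n
      P i = L₁.rail i ∪ L₂.rail (σ i)
      mixed : ∀ {i j x} → x ∈ L₁.rail i → x ∈ L₂.rail (σ j) → i ≡ j
      mixed {i} {j} x∈₁ x∈₂ = L₁.disj (subst (_∈ L₁.rail i)
        (source-unique L₂ C≤k x∈₂ (c∈₂ j) (M∩N⊆C (L₁.within x∈₁) (L₂.within x∈₂)) (c∈C j)) x∈₁) (c∈₁ j)
      P-disj : ∀ {i j x} → x ∈ P i → x ∈ P j → i ≡ j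
      P-disj {i} {j} x∈ x∈′ with ∪⁻ x∈ | ∪⁻ x∈′
      ... | inj₁ a | inj₁ b = L₁.disj a b
      ... | inj₁ a | inj₂ b = mixed a b
      ... | inj₂ a | inj₁ b = sym (mixed b a)
      -- The two continuations are one rail of `L₂`, so its gluing vertex `c i` takes the place of
      -- the common vertex.
      ... | inj₂ a | inj₂ b = mixed (c∈₁ i) (subst (λ l → c i ∈ L₂.rail l) (L₂.disj a b) (c∈₂ i))

  -- Menger's condition: `E` is the side of `A` in a separation of `M`, and its border is the
  -- separator from `B`.
  Linkable : ℕ → (M A B : Subset n) → Set
  Linkable k M A B = ∀ E → A ⊆ E → E ⊆ M → k ≤ o M B E

  linkable? : ∀ k M A B → Dec (Linkable k M A B)
  linkable? k M A B = allSubset? λ E → (A ⊆? E) →-dec ((E ⊆? M) →-dec (k ≤? o M B E))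

  ¬linkable : ∀ {k M A B} → ¬ Linkable k M A B → ∃[ E ] (A ⊆ E × E ⊆ M × o M B E < k)
  ¬linkable {k} {M} {A} {B} ¬l = decidable-stable (anySubset? deficient?)
    λ none → ¬l λ E A⊆E E⊆M → ≮⇒≥ λ lt → none (E , A⊆E , E⊆M , lt)
    where
    deficient? : ∀ E → Dec (A ⊆ E × E ⊆ M × o M B E < k)
    deficient? E = (A ⊆? E) ×-dec (E ⊆? M) ×-dec (o M B E <? k)

  -- Putting `D` back into a set `E` of the smaller instance adds at most `D` to the border.
  linkable-delete : ∀ {M A B} D j {k} → ∣ D ∣ ≤ j → D ⊆ M → Linkable (j + k) M A B → Linkable k (M ─ D) (A ─ D) B
  linkable-delete {M} {A} {B} D j {k} D≤j D⊆M l E A⊆E E⊆M = +-cancelˡ-≤ j k _ (begin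
    j + k                          ≤⟨ l (E ∪ D) (λ a∈ → [ ∪ˡ ∘ A⊆E , ∪ʳ ]′ (∪⁻ (⊆─∪ a∈))) (∪-⊆ (─⁻ˡ {p = M} ∘ E⊆M) D⊆M) ⟩
    o M B (E ∪ D)                  ≤⟨ ⊆∪⇒≤ (border (M ─ D) B E) D (border-delete M B E D) ⟩
    o (M ─ D) B E + ∣ D ∣          ≤⟨ +-monoʳ-≤ (o (M ─ D) B E) D≤j ⟩
    o (M ─ D) B E + j              ≡⟨ +-comm (o (M ─ D) B E) j ⟩
    j + o (M ─ D) B E              ∎)
    where
    open ≤-Reasoning

-- Menger's theorem for sets

∣─∣< : ∀ {n} {x : Fin n} (p q : Subset n) → x ∈ p → x ∈ q → ∣ p ─ q ∣ < ∣ p ∣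
∣─∣< p q x∈p x∈q = ⊆∧∌⇒< {p = p ─ q} (─⁻ˡ {p = p}) x∈p (λ x∈ → ─⁻ʳ {p = p} x∈ x∈q)

nonempty-of : ∀ {n k} (p : Subset n) → suc k ≤ ∣ p ∣ → ∃[ x ] x ∈ p
nonempty-of {n} p k<p with any? (_∈? p)
... | yes found = found
... | no  none  = contradiction (<-≤-trans k<p (≤-trans (⊆⇒≤ {p = p} {q = ∅} (λ x∈ → contradiction (_ , x∈) none)) (≤-reflexive (∣⊥∣≡0 n)))) λ ()

module Menger {n} (_~_ : Rel (Fin n) 0ℓ) (_~?_ : Decidable _~_) (~-sym : Symmetric _~_) where
  open Separation _~_ _~?_ ~-sym public

  -- A set whose border has size at most k separates the problem into two smaller ones glued along
  -- that border, unless it is all of M or all of it is border.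
  Splits : ℕ → (M A B E : Subset n) → Set
  Splits k M A B E = A ⊆ E × E ⊆ M × o M B E ≤ k × (∃[ y ] (y ∈ M × y ∉ E)) × (∃[ x ] (x ∈ E × x ∉ border M B E))

  splits? : ∀ k M A B E → Dec (Splits k M A B E)
  splits? k M A B E = (A ⊆? E) ×-dec (E ⊆? M) ×-dec (o M B E ≤? k) ×-dec
    any? (λ y → (y ∈? M) ×-dec ¬? (y ∈? E)) ×-dec any? (λ x → (x ∈? E) ×-dec ¬? (x ∈? border M B E))

  abstract

    -- Induction on the size of `M`: split along a small border if possible, otherwise delete a
    -- vertex if that does no harm. In the remaining critical instance every vertex lies in `A` or
    -- in `B`, and a single vertex or a single edge can be taken as a rail.
    menger : ∀ {M A B} k → A ⊆ M → Linkable k M A B → Link k M A B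
    menger {M} {A} {B} k = go ∣ M ∣ k ≤-refl
      where
      go : ∀ f k {M A B} → ∣ M ∣ ≤ f → A ⊆ M → Linkable k M A B → Link k M A B
      go f zero M≤f A⊆M l = link-zero
      go zero (suc k) {M} {A} {B} M≤f A⊆M l =
        contradiction (≤-trans (l A id A⊆M) (≤-trans (o≤ M B A) (≤-trans (⊆⇒≤ {p = A} A⊆M) M≤f))) λ ()
      go (suc f) (suc k) {M} {A} {B} M≤f A⊆M l with anySubset? (splits? (suc k) M A B)
      ... | yes (E , A⊆E , E⊆M , E≤k , (y , y∈M , y∉E) , (x , x∈E , x∉C)) =
        link-mono (∪-⊆ E⊆M N⊆M) id id (proj₁ (link-glue E≤k meet near far))
        where
        C N : Subset n
        C = border M B E
        N = (M ─ E) ∪ C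
        N⊆M : N ⊆ M
        N⊆M = ∪-⊆ {p = M ─ E} (─⁻ˡ {p = M}) (E⊆M ∘ border⊆ {M} {B})
        meet : ∀ {z} → z ∈ E → z ∈ N → z ∈ C
        meet z∈E z∈N = [ (λ z∈ → contradiction z∈E (─⁻ʳ {p = M} z∈)) , id ]′ (∪⁻ z∈N)
        near : Link (suc k) E A C
        near = go f (suc k) (s≤s⁻¹ (<-≤-trans (⊆∧∌⇒< {p = E} E⊆M y∈M y∉E) M≤f)) A⊆E λ E″ A⊆E″ E″⊆E →
          ≤-trans (l E″ A⊆E″ (E⊆M ∘ E″⊆E)) (⊆⇒≤ {p = border M B E″} (λ z∈ → sub E″⊆E (border⁻ {M} {B} z∈)))
          where
          sub : ∀ {E″ z} → E″ ⊆ E → z ∈ E″ × Leaves M B E″ z → z ∈ border E C E″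
          sub E″⊆E (z∈ , inj₁ z∈B) = border⁺ z∈ (inj₁ (border⁺ (E″⊆E z∈) (inj₁ z∈B)))
          sub E″⊆E (z∈ , inj₂ (w , w∈M , w∉ , z~w)) with w ∈? E
          ... | yes w∈E = border⁺ z∈ (inj₂ (w , w∈E , w∉ , z~w))
          ... | no  w∉E = border⁺ z∈ (inj₁ (border⁺ (E″⊆E z∈) (inj₂ (w , w∈M , w∉E , z~w))))
        far : Link (suc k) N C B
        far = go f (suc k) (s≤s⁻¹ (<-≤-trans (⊆∧∌⇒< {p = N} N⊆M (E⊆M x∈E) (x∉C ∘ meet x∈E)) M≤f)) ∪ʳ λ E″ C⊆E″ E″⊆N →
          ≤-trans (l (E ∪ E″) (∪ˡ ∘ A⊆E) (∪-⊆ E⊆M (N⊆M ∘ E″⊆N)))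
            (⊆⇒≤ {p = border M B (E ∪ E″)} (λ z∈ → sub C⊆E″ (border⁻ {M} {B} z∈)))
          where
          -- A vertex of `E` with an exit from `E ∪ E″` also has one from `E`, so it belongs to `C`
          -- and hence to `E″`.
          in-E″ : ∀ {E″ z} → C ⊆ E″ → z ∈ E ∪ E″ → Leaves M B (E ∪ E″) z → z ∈ E″
          in-E″ C⊆E″ z∈ l with ∪⁻ z∈ | l
          ... | inj₂ z∈E″ | _ = z∈E″
          ... | inj₁ z∈E | inj₁ z∈B = C⊆E″ (border⁺ z∈E (inj₁ z∈B))
          ... | inj₁ z∈E | inj₂ (w , w∈M , w∉ , z~w) = C⊆E″ (border⁺ z∈E (inj₂ (w , w∈M , w∉ ∘ ∪ˡ , z~w)))
          sub : ∀ {E″ z} → C ⊆ E″ → z ∈ E ∪ E″ × Leaves M B (E ∪ E″) z → z ∈ border N B E″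
          sub C⊆E″ (z∈ , inj₁ z∈B) = border⁺ (in-E″ C⊆E″ z∈ (inj₁ z∈B)) (inj₁ z∈B)
          sub C⊆E″ (z∈ , inj₂ (w , w∈M , w∉ , z~w)) =
            border⁺ (in-E″ C⊆E″ z∈ (inj₂ (w , w∈M , w∉ , z~w))) (inj₂ (w , ∪ˡ (─⁺ w∈M (w∉ ∘ ∪ˡ)) , w∉ ∘ ∪ʳ , z~w))
      ... | no unsplit with any? (λ v → (v ∈? M) ×-dec linkable? (suc k) (M ─ ⁅ v ⁆) (A ─ ⁅ v ⁆) B)
      ... | yes (v , v∈M , l′) = link-mono (─⁻ˡ {p = M}) (─⁻ˡ {p = A}) id
        (go f (suc k) (s≤s⁻¹ (<-≤-trans (∣─∣< M ⁅ v ⁆ v∈M (x∈⁅x⁆ v)) M≤f)) (λ a∈ → ─⁺ (A⊆M (─⁻ˡ {p = A} a∈)) (─⁻ʳ {p = A} a∈)) l′)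
      ... | no critical with any? (λ v → (v ∈? A) ×-dec (v ∈? B))
      ... | yes (v , v∈A , v∈B) = link-cons ⁅ v ⁆ (⁅⁆⊆ (A⊆M v∈A)) (conn-⁅⁆ v) (v , x∈⁅x⁆ v , v∈A) (v , x∈⁅x⁆ v , v∈B)
        (link-mono id (─⁻ˡ {p = A}) id (go f k (s≤s⁻¹ (<-≤-trans (∣─∣< M ⁅ v ⁆ (A⊆M v∈A) (x∈⁅x⁆ v)) M≤f))
          (λ a∈ → ─⁺ (A⊆M (─⁻ˡ {p = A} a∈)) (─⁻ʳ {p = A} a∈))
          (linkable-delete ⁅ v ⁆ 1 (≤-reflexive (∣⁅x⁆∣≡1 v)) (⁅⁆⊆ (A⊆M v∈A)) l)))
      ... | no A∩B=∅ = pair (nonempty-of A (≤-trans (l A id A⊆M) (o≤ M B A)))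
        where
        k≤A : suc k ≤ ∣ A ∣
        k≤A = ≤-trans (l A id A⊆M) (o≤ M B A)
        trivial : ∀ {E} → A ⊆ E → E ⊆ M → o M B E ≤ suc k → M ⊆ E ⊎ E ⊆ border M B E
        trivial {E} A⊆E E⊆M o≤k with M ⊆? E | E ⊆? border M B E
        ... | yes p | _     = inj₁ p
        ... | no  _ | yes q = inj₂ q
        ... | no ¬p | no ¬q = ⊥-elim (unsplit (E , A⊆E , E⊆M , o≤k , ⊈⇒∃ ¬p , ⊈⇒∃ ¬q))
        -- Deleting `v` does harm, so some `E` becomes deficient. With `v` put back its border has
        -- size at most `suc k`, so it cannot split the instance: either it is all of `M`, and `v`
        -- can be on the border only as a vertex of `B`, or it consists of border, and then it is
        -- too small to exceed `A`.
        end : ∀ {v} → v ∈ M → v ∈ B ⊎ (v ∈ A × ∣ A ∣ ≤ suc k)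
        end {v} v∈M with ¬linkable (λ l′ → critical (v , v∈M , l′))
        ... | E , A─v⊆E , E⊆ , E<k = result (trivial A⊆E+ E+⊆M E+≤)
          where
          E+ : Subset n
          E+ = E ∪ ⁅ v ⁆
          A⊆E+ : A ⊆ E+
          A⊆E+ a∈ = [ ∪ˡ ∘ A─v⊆E , ∪ʳ ]′ (∪⁻ (⊆─∪ a∈))
          E+⊆M : E+ ⊆ M
          E+⊆M = ∪-⊆ (─⁻ˡ {p = M} ∘ E⊆) (⁅⁆⊆ v∈M)
          E+≤ : o M B E+ ≤ suc k
          E+≤ = ≤-trans (⊆∪⁅⁆⇒≤ (border (M ─ ⁅ v ⁆) B E) v (border-delete M B E ⁅ v ⁆)) E<k
          v∈border : v ∈ border M B E+
          v∈border = decidable-stable (v ∈? border M B E+) λ v∉ → contradiction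
            (≤-trans (l E+ A⊆E+ E+⊆M) (⊆⇒≤ {p = border M B E+} λ {z} z∈ →
              [ id , (λ z≡v → contradiction (subst (_∈ border M B E+) (⁅⁆⁻ z≡v) z∈) v∉) ]′ (∪⁻ (border-delete M B E ⁅ v ⁆ z∈)))) (<⇒≱ E<k)
          result : M ⊆ E+ ⊎ E+ ⊆ border M B E+ → v ∈ B ⊎ (v ∈ A × ∣ A ∣ ≤ suc k)
          result (inj₁ M⊆) with border⁻ {M} {B} {E+} v∈border
          ... | _ , inj₁ v∈B = inj₁ v∈B
          ... | _ , inj₂ (w , w∈M , w∉ , _) = contradiction (M⊆ w∈M) w∉
          result (inj₂ E+⊆) = inj₂ (⊆∧≥⇒⊇ A⊆E+ (≤-trans E+≤k k≤A) (∪ʳ (x∈⁅x⁆ v)) , ≤-trans (⊆⇒≤ {p = A} A⊆E+) E+≤k)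
            where
            E+≤k : ∣ E+ ∣ ≤ suc k
            E+≤k = ≤-trans (⊆⇒≤ {p = E+} E+⊆) E+≤
        pair : ∃[ v ] v ∈ A → Link (suc k) M A B
        pair (v , v∈A) with end (A⊆M v∈A)
        ... | inj₁ v∈B = contradiction (v , v∈A , v∈B) A∩B=∅
        ... | inj₂ (_ , A≤k) with any? (λ w → (w ∈? M) ×-dec ¬? (w ∈? A) ×-dec (v ~? w))
        ... | no none = contradiction (≤-trans (l A id A⊆M) (⊆⇒≤ {p = border M B A} sub))
                          (<⇒≱ (<-≤-trans (∣─∣< A ⁅ v ⁆ v∈A (x∈⁅x⁆ v)) A≤k))
          where
          sub : border M B A ⊆ A ─ ⁅ v ⁆
          sub {z} z∈ with border⁻ {M} {B} {A} z∈
          ... | z∈A , inj₁ z∈B = contradiction (z , z∈A , z∈B) A∩B=∅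
          ... | z∈A , inj₂ (w , w∈M , w∉A , z~w) = ─⁺ z∈A λ z≡v → none (w , w∈M , w∉A , subst (_~ w) (⁅⁆⁻ z≡v) z~w)
        ... | yes (w , w∈M , w∉A , v~w) with end w∈M
        ... | inj₂ (w∈A , _) = contradiction w∈A w∉A
        ... | inj₁ w∈B = link-cons vw vw⊆M (conn-∪ (conn-⁅⁆ v) (conn-⁅⁆ w) (x∈⁅x⁆ v) (x∈⁅x⁆ w) (inj₂ v~w))
          (v , v∈vw , v∈A) (w , w∈vw , w∈B)
          (link-mono id (─⁻ˡ {p = A}) id (go f k (s≤s⁻¹ (<-≤-trans (∣─∣< M vw (A⊆M v∈A) v∈vw) M≤f))
            (λ a∈ → ─⁺ (A⊆M (─⁻ˡ {p = A} a∈)) (─⁻ʳ {p = A} a∈)) l′))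
          where
          vw : Subset n
          vw = ⁅ v ⁆ ∪ ⁅ w ⁆
          v∈vw : v ∈ vw
          v∈vw = ∪ˡ (x∈⁅x⁆ v)
          w∈vw : w ∈ vw
          w∈vw = ∪ʳ (x∈⁅x⁆ w)
          vw⊆M : vw ⊆ M
          vw⊆M = ∪-⊆ (⁅⁆⊆ (A⊆M v∈A)) (⁅⁆⊆ w∈M)
          -- Two vertices go but the demand drops only by one. A deficient `E` would make `E+`
          -- trivial. If `E+` is all of `M`, then `v`, which is not in `B`, is off its border, and
          -- one vertex is saved; if `E+` is all border, it is too small to contain `A` and also
          -- `w`.
          l′ : Linkable k (M ─ vw) (A ─ vw) B
          l′ E A─⊆E E⊆ with k ≤? o (M ─ vw) B E
          ... | yes k≤ = k≤
          ... | no  k≰ = contradiction (trivial A⊆E+ E+⊆M E+≤k) [ ¬whole , ¬allborder ]′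
            where
            E+ : Subset n
            E+ = E ∪ vw
            A⊆E+ : A ⊆ E+
            A⊆E+ a∈ = [ ∪ˡ ∘ A─⊆E , ∪ʳ ]′ (∪⁻ (⊆─∪ a∈))
            E+⊆M : E+ ⊆ M
            E+⊆M = ∪-⊆ (─⁻ˡ {p = M} ∘ E⊆) vw⊆M
            E+≤k : o M B E+ ≤ suc k
            E+≤k = begin
              o M B E+                                 ≤⟨ ⊆∪⇒≤ (border (M ─ vw) B E) vw (border-delete M B E vw) ⟩
              o (M ─ vw) B E + ∣ vw ∣                  ≤⟨ +-monoʳ-≤ (o (M ─ vw) B E) (⊆∪⁅⁆⇒≤ ⁅ v ⁆ w id) ⟩
              o (M ─ vw) B E + suc ∣ ⁅ v ⁆ ∣           ≡⟨ cong (λ j → o (M ─ vw) B E + suc j) (∣⁅x⁆∣≡1 v) ⟩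
              o (M ─ vw) B E + 2                       ≡⟨ +-comm (o (M ─ vw) B E) 2 ⟩
              suc (suc (o (M ─ vw) B E))               ≤⟨ s≤s (≰⇒> k≰) ⟩
              suc k                                    ∎
              where open ≤-Reasoning
            ¬whole : ¬ (M ⊆ E+)
            ¬whole M⊆ = contradiction (≤-trans (l E+ A⊆E+ E+⊆M) (⊆∪⁅⁆⇒≤ (border (M ─ vw) B E) w sub)) (<⇒≱ (s≤s (≰⇒> k≰)))
              where
              sub : border M B E+ ⊆ border (M ─ vw) B E ∪ ⁅ w ⁆
              sub {z} z∈ with ∪⁻ (border-delete M B E vw z∈)
              ... | inj₁ z∈b = ∪ˡ z∈b
              ... | inj₂ z∈vw with ∪⁻ z∈vw
              ... | inj₂ z≡w = ∪ʳ z≡w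
              ... | inj₁ z≡v with border⁻ {M} {B} {E+} z∈
              ... | _ , inj₁ z∈B = contradiction (v , v∈A , subst (_∈ B) (⁅⁆⁻ z≡v) z∈B) A∩B=∅
              ... | _ , inj₂ (y , y∈M , y∉ , _) = contradiction (M⊆ y∈M) y∉
            ¬allborder : ¬ (E+ ⊆ border M B E+)
            ¬allborder E+⊆ = contradiction (≤-trans (⊆⇒≤ {p = E+} E+⊆) E+≤k)
              (<⇒≱ (≤-<-trans k≤A (⊆∧∌⇒< {p = A} A⊆E+ (∪ʳ w∈vw) w∉A)))

-- Menger's theorem with prescribed starting vertices

module StrictMenger {n} (_~_ : Rel (Fin n) 0ℓ) (_~?_ : Decidable _~_) (~-sym : Symmetric _~_) where
  open Menger _~_ _~?_ ~-sym public

  module _ (M A B : Subset n) where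

    -- By Menger's theorem: `R` is the set of starting vertices of disjoint rails to `B` that avoid
    -- all other vertices of `A`.
    Good : Subset n → Set
    Good R = Linkable ∣ R ∣ (M ─ (A ─ R)) R B

    good? : ∀ R → Dec (Good R)
    good? R = linkable? ∣ R ∣ (M ─ (A ─ R)) R B

    -- If no a ∈ A ∖ R can be added to R, then the maximal tight set of R together with A ∖ R separates
    -- A from B too cheaply: every neighbour of such an a lies in a tight set, hence in the maximal one.
    abstract

      augment : ∀ {s R} → A ⊆ M → R ⊆ A → Good R → Linkable s M A B → ∣ R ∣ < s →
                ∃[ a ] (a ∈ A × a ∉ R × Good (R ∪ ⁅ a ⁆))
      augment {s} {R} A⊆M R⊆A good l R<s with any? (λ a → (a ∈? A) ×-dec ¬? (a ∈? R) ×-dec good? (R ∪ ⁅ a ⁆))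
      ... | yes found = found
      ... | no  none  = ⊥-elim (<⇒≱ R<s (≤-trans (l Ê A⊆Ê Ê⊆M) (≤-trans (⊆⇒≤ {p = border M B Ê} Ê-border) tight*)))
        where
        N : Subset n
        N = M ─ (A ─ R)
        R⊆N : R ⊆ N
        R⊆N x∈R = ─⁺ (A⊆M (R⊆A x∈R)) (λ x∈ → ─⁻ʳ {p = A} x∈ x∈R)
        Tight : Subset n → Set
        Tight E = R ⊆ E × E ⊆ N × o N B E ≤ ∣ R ∣
        tight? : ∀ E → Dec (Tight E)
        tight? E = (R ⊆? E) ×-dec (E ⊆? N) ×-dec (o N B E ≤? ∣ R ∣)
        max : ∃[ F ] (Tight F × R ⊆ F × ∀ {F′} → Tight F′ → F ⊆ F′ → F′ ⊆ F)
        max = maximal tight? {E = R} (id , R⊆N , o≤ N B R)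
        E* Ê : Subset n
        E* = proj₁ max
        Ê = E* ∪ (A ─ R)
        R⊆E* : R ⊆ E*
        R⊆E* = proj₁ (proj₁ (proj₂ max))
        E*⊆N : E* ⊆ N
        E*⊆N = proj₁ (proj₂ (proj₁ (proj₂ max)))
        tight* : o N B E* ≤ ∣ R ∣
        tight* = proj₂ (proj₂ (proj₁ (proj₂ max)))
        -- Goodness of `R` keeps the border of the intersection at `∣ R ∣` or more, so submodularity
        -- makes the union tight, and `E*` is maximal.
        absorb : ∀ {E} → Tight E → E ⊆ E*
        absorb {E} (R⊆E , E⊆N , E≤) =
          proj₂ (proj₂ (proj₂ max)) (∪ˡ ∘ R⊆E* , ∪-⊆ E*⊆N E⊆N , +-cancelʳ-≤ ∣ R ∣ _ _ (begin
            o N B (E* ∪ E) + ∣ R ∣             ≤⟨ +-monoʳ-≤ (o N B (E* ∪ E)) (good (E* ∩ E) (λ x∈ → x∈p∩q⁺ (R⊆E* x∈ , R⊆E x∈)) (E*⊆N ∘ p∩q⊆p E* E)) ⟩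
            o N B (E* ∪ E) + o N B (E* ∩ E)    ≤⟨ o-submodular N B E* E ⟩
            o N B E* + o N B E                 ≤⟨ +-mono-≤ tight* E≤ ⟩
            ∣ R ∣ + ∣ R ∣                      ∎)) ∪ˡ ∘ ∪ʳ
          where open ≤-Reasoning
        A⊆Ê : A ⊆ Ê
        A⊆Ê x∈A = [ ∪ʳ , ∪ˡ ∘ R⊆E* ]′ (∪⁻ (⊆─∪ {q = R} x∈A))
        Ê⊆M : Ê ⊆ M
        Ê⊆M = ∪-⊆ (─⁻ˡ {p = M} ∘ E*⊆N) (A⊆M ∘ ─⁻ˡ {p = A})
        enclosed : ∀ {a} → a ∈ A ─ R → a ∉ B × (∀ {y} → y ∈ M → a ~ y → y ∈ Ê)
        enclosed {a} a∈ with ¬linkable (λ g → none (a , ─⁻ˡ {p = A} a∈ , ─⁻ʳ {p = A} a∈ , g))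
        ... | E , R+⊆E , E⊆N+ , E< = (λ a∈B → uncounted (inj₁ a∈B)) , nbrs
          where
          N+ E′ : Subset n
          N+ = M ─ (A ─ (R ∪ ⁅ a ⁆))
          E′ = E ─ ⁅ a ⁆
          a∈E : a ∈ E
          a∈E = R+⊆E (∪ʳ (x∈⁅x⁆ a))
          N⊆N+ : N ⊆ N+
          N⊆N+ y∈ = ─⁺ (─⁻ˡ {p = M} y∈) λ y∈′ → ─⁻ʳ {p = M} y∈ (─⁺ (─⁻ˡ {p = A} y∈′) (─⁻ʳ {p = A} y∈′ ∘ ∪ˡ))
          E≤R : o N+ B E ≤ ∣ R ∣
          E≤R = s≤s⁻¹ (≤-trans E< (≤-reflexive (∣∪⁅⁆∣ R (─⁻ʳ {p = A} a∈))))
          R⊆E′ : R ⊆ E′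
          R⊆E′ x∈R = ─⁺ (R+⊆E (∪ˡ x∈R)) λ x≡a → ─⁻ʳ {p = A} a∈ (subst (_∈ R) (⁅⁆⁻ x≡a) x∈R)
          E′⊆N : E′ ⊆ N
          E′⊆N x∈ = ─⁺ (─⁻ˡ {p = M} (E⊆N+ (─⁻ˡ {p = E} x∈))) λ x∈A─R →
            ─⁻ʳ {p = M} (E⊆N+ (─⁻ˡ {p = E} x∈)) (─⁺ (─⁻ˡ {p = A} x∈A─R) ([ ─⁻ʳ {p = A} x∈A─R , ─⁻ʳ {p = E} x∈ ]′ ∘ ∪⁻))
          shrink : border N B E′ ⊆ border N+ B E
          shrink x∈ with border⁻ {N} {B} {E′} x∈
          ... | x∈E′ , inj₁ x∈B = border⁺ (─⁻ˡ {p = E} x∈E′) (inj₁ x∈B)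
          ... | x∈E′ , inj₂ (y , y∈N , y∉ , x~y) = border⁺ (─⁻ˡ {p = E} x∈E′) (inj₂ (y , N⊆N+ y∈N ,
            (λ y∈E → y∉ (─⁺ y∈E λ y≡a → ─⁻ʳ {p = M} y∈N (subst (_∈ A ─ R) (sym (⁅⁆⁻ y≡a)) a∈))) , x~y))
          -- If `a` were on the border of `E`, removing it would leave a border of fewer than
          -- `∣ R ∣` vertices, against goodness of `R`.
          uncounted : ¬ Leaves N+ B E a
          uncounted leaves = <⇒≱ (<-≤-trans (⊆∧∌⇒< {p = border N B E′} shrink (border⁺ a∈E leaves)
            (λ a∈′ → ─⁻ʳ {p = E} (border⊆ {N} {B} a∈′) (x∈⁅x⁆ a))) E≤R) (good E′ R⊆E′ E′⊆N)
          E′⊆E* : E′ ⊆ E*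
          E′⊆E* = absorb (R⊆E′ , E′⊆N , ≤-trans (⊆⇒≤ {p = border N B E′} shrink) E≤R)
          nbrs : ∀ {y} → y ∈ M → a ~ y → y ∈ Ê
          nbrs {y} y∈M a~y with y ∈? A ─ R
          ... | yes y∈ = ∪ʳ y∈
          ... | no  y∉ = ∪ˡ (E′⊆E* (─⁺ y∈E λ y≡a → y∉ (subst (_∈ A ─ R) (sym (⁅⁆⁻ y≡a)) a∈)))
            where
            y∈E : y ∈ E
            y∈E = decidable-stable (y ∈? E) λ y∉E → uncounted (inj₂ (y , N⊆N+ (─⁺ y∈M y∉) , y∉E , a~y))
        Ê-border : border M B Ê ⊆ border N B E*
        Ê-border x∈ with border⁻ {M} {B} {Ê} x∈
        ... | x∈Ê , leaves with ∪⁻ x∈Ê | leaves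
        ... | inj₁ x∈E* | inj₁ x∈B = border⁺ x∈E* (inj₁ x∈B)
        ... | inj₁ x∈E* | inj₂ (y , y∈M , y∉ , x~y) = border⁺ x∈E* (inj₂ (y , ─⁺ y∈M (y∉ ∘ ∪ʳ) , y∉ ∘ ∪ˡ , x~y))
        ... | inj₂ x∈ | inj₁ x∈B = ⊥-elim (proj₁ (enclosed x∈) x∈B)
        ... | inj₂ x∈ | inj₂ (y , y∈M , y∉ , x~y) = ⊥-elim (y∉ (proj₂ (enclosed x∈) y∈M x~y))

    extend : ∀ {s} d R → A ⊆ M → R ⊆ A → Good R → Linkable s M A B → d + ∣ R ∣ ≡ s →
             ∃[ R′ ] (R ⊆ R′ × R′ ⊆ A × ∣ R′ ∣ ≡ s × Good R′)
    extend zero R A⊆M R⊆A good l eq = R , id , R⊆A , eq , good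
    extend {s} (suc d) R A⊆M R⊆A good l eq with augment A⊆M R⊆A good l (≤-trans (s≤s (m≤n+m ∣ R ∣ d)) (≤-reflexive eq))
    ... | a , a∈A , a∉R , good′
      with extend d (R ∪ ⁅ a ⁆) A⊆M (∪-⊆ R⊆A (⁅⁆⊆ a∈A)) good′ l
             (trans (cong (d +_) (∣∪⁅⁆∣ R a∉R)) (trans (+-suc d ∣ R ∣) eq))
    ... | R′ , ⊆R′ , R′⊆A , eq′ , good″ = R′ , ⊆R′ ∘ ∪ˡ , R′⊆A , eq′ , good″

  -- `once` allows rails to be continued on the other side of `A` without collisions; `covers` is
  -- how the anchors of a body are forced onto rails.
  record StrictLink (s : ℕ) (M A B R : Subset n) : Set where
    field
      link   : Link s M A B
    open Link link public
    field
      once   : ∀ {i x y} → x ∈ rail i → y ∈ rail i → x ∈ A → y ∈ A → x ≡ y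
      covers : ∀ {x} → x ∈ R → ∃[ i ] x ∈ rail i

  abstract

    -- After `R` is enlarged to exactly `s` sources and the rest of `A` is deleted, there are as
    -- many sources as rails, so each rail has one and all are used.
    strictLink : ∀ {s M A B} R → A ⊆ M → R ⊆ A → ∣ R ∣ ≤ s → Good M A B R → Linkable s M A B → StrictLink s M A B R
    strictLink {s} {M} {A} {B} R A⊆M R⊆A R≤s good l
      with extend M A B (s ∸ ∣ R ∣) R A⊆M R⊆A good l (m∸n+n≡m R≤s)
    ... | R′ , R⊆R′ , R′⊆A , refl , good′ = record
      { link = link-mono (─⁻ˡ {p = M}) R′⊆A id L
      ; once = λ {i} x∈ y∈ x∈A y∈A → source-unique L ≤-refl x∈ y∈ (in-R′ {i} x∈ x∈A) (in-R′ {i} y∈ y∈A)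
      ; covers = source-cover L ≤-refl ∘ R⊆R′ }
      where
      N : Subset n
      N = M ─ (A ─ R′)
      R′⊆N : R′ ⊆ N
      R′⊆N x∈ = ─⁺ (A⊆M (R′⊆A x∈)) (λ x∈′ → ─⁻ʳ {p = A} x∈′ x∈)
      L : Link s N R′ B
      L = menger s R′⊆N good′
      in-R′ : ∀ {i x} → x ∈ Link.rail L i → x ∈ A → x ∈ R′
      in-R′ {i} {x} x∈ x∈A = decidable-stable (x ∈? R′) λ x∉ → ─⁻ʳ {p = M} (Link.within L x∈) (─⁺ x∈A x∉)

-- Building a tree leaf by leaf

module Tree {m} (T : Graph m) where
  open Graph T using (_~_; _~?_; ~-sym; ~-irrefl)
  open Separation _~_ _~?_ ~-sym

  -- The last premise of `leaf` means that adding `v` to a partial copy of the tree requires a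
  -- single new adjacency.
  data Grown : Subset m → Set where
    root : ∀ {r} → r ∈ V T → Grown ⁅ r ⁆
    leaf : ∀ {U p v} → Grown U → p ∈ U → v ∉ U → v ∈ V T → p ~ v → (∀ {u} → u ∈ U → u ~ v → u ≡ p) → Grown (U ∪ ⁅ v ⁆)

  rootOf : ∀ {U} → Grown U → Fin m
  rootOf (root {r} _)         = r
  rootOf (leaf γ _ _ _ _ _) = rootOf γ

  rootOf∈ : ∀ {U} (γ : Grown U) → rootOf γ ∈ U
  rootOf∈ (root {r} _)         = x∈⁅x⁆ r
  rootOf∈ (leaf γ _ _ _ _ _) = ∪ˡ (rootOf∈ γ)

  size : ∀ {U} → Grown U → ℕ
  size (root _)             = 1
  size (leaf γ _ _ _ _ _) = suc (size γ)

  size≡ : ∀ {U} (γ : Grown U) → size γ ≡ ∣ U ∣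
  size≡ (root {r} _)                = sym (∣⁅x⁆∣≡1 r)
  size≡ (leaf {U} γ _ v∉ _ _ _) = trans (cong suc (size≡ γ)) (sym (∣∪⁅⁆∣ U v∉))

  grown⊆ : ∀ {U} → Grown U → U ⊆ V T
  grown⊆ (root r∈)               = ⁅⁆⊆ r∈
  grown⊆ (leaf γ _ _ v∈ _ _) = ∪-⊆ (grown⊆ γ) (⁅⁆⊆ v∈)

  grown-conn : ∀ {U} → Grown U → Conn U
  grown-conn (root {r} _)                = conn-⁅⁆ r
  grown-conn (leaf {v = v} γ p∈ _ _ e _) = conn-∪ (grown-conn γ) (conn-⁅⁆ v) p∈ (x∈⁅x⁆ v) (inj₂ e)

  data Ends (u : Fin m) : List (Fin m) → Set where
    end  : Ends u (u ∷ [])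
    more : ∀ {x y xs} → Ends u (y ∷ xs) → Ends u (x ∷ y ∷ xs)

  module _ {U : Subset m} {u v : Fin m} (u~v : u ~ v) where

    -- A simple path in `U` from `p` to `u`. The edge from `u` to `v` is already included in
    -- `Linked`, so that prefixing `v` gives the closed list of a cycle.
    IsPath : Fin m → List (Fin m) → Set
    IsPath p ws = Unique (p ∷ ws) × Linked _~_ ((p ∷ ws) ∷ʳ v) × All (_∈ U) (p ∷ ws) × Ends u (p ∷ ws)

    suffix : ∀ {p q} (ws : List (Fin m)) → p List.∈ q ∷ ws → IsPath q ws → ∃[ ws′ ] IsPath p ws′
    suffix ws       (here refl) π = ws , π
    suffix (_ ∷ ws) (there p∈) (_ ∷ un , _ ∷ li , _ ∷ al , more e) = suffix ws p∈ (un , li , al , e)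

    simplePath : ∀ {p} → p ∈ U → Star (Step U) p u → ∃[ ws ] IsPath p ws
    simplePath p∈ ε = [] , [] ∷ [] , u~v ∷ [-] , p∈ ∷ [] , end
    simplePath {p} p∈ ((e , _ , z∈) ◅ π) with simplePath z∈ π
    ... | ws , un , li , al , en with Any.any? (p ≟_) (_ ∷ ws)
    ... | yes p∈ws = suffix ws p∈ws (un , li , al , en)
    ... | no  p∉ws = _ , ¬Any⇒All¬ _ p∉ws ∷ un , e ∷ li , p∈ ∷ al , more en

  module _ (tree : IsTree T) where
    open IsTree tree

    -- A second neighbour in `U` would be joined to `p` by a path in the connected set `U`, and `v`
    -- would close it to a cycle.
    unique-neighbour : ∀ {U p v} → Grown U → p ∈ U → v ∉ U → p ~ v → ∀ {u} → u ∈ U → u ~ v → u ≡ p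
    unique-neighbour {U} {p} {v} γ p∈ v∉ p~v {u} u∈ u~v with simplePath u~v p∈ (grown-conn γ p∈ u∈)
    ... | [] , _ , _ , _ , end = refl
    ... | w ∷ ws , un , li , al , _ = ⊥-elim (acyclic v (p ∷ w ∷ ws) record
      { length≥3 = s≤s (s≤s (s≤s z≤n))
      ; distinct = All.map (λ x∈ v≡x → v∉ (subst (_∈ U) (sym v≡x) x∈)) al ∷ un
      ; closed   = ~-sym p~v ∷ li })

    grow : ∀ k {U} → ∣ V T ─ U ∣ ≤ k → Grown U → Grown (V T)
    grow k {U} ≤k γ with V T ⊆? U
    ... | yes T⊆U = subst Grown (⊆-antisym (grown⊆ γ) T⊆U) γ
    ... | no  T⊈U with ⊈⇒∃ T⊈U
    ... | y , y∈T , y∉U with exit U (Star.map (λ e → e , Graph.~⇒∈V T e , Graph.~⇒∈V T (~-sym e)) (connected (grown⊆ γ (rootOf∈ γ)) y∈T)) (rootOf∈ γ) y∉U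
    ... | p , v , p~v , _ , v∈T , p∈U , v∉U = next k ≤k
      where
      next : ∀ k → ∣ V T ─ U ∣ ≤ k → Grown (V T)
      lt : ∣ V T ─ (U ∪ ⁅ v ⁆) ∣ < ∣ V T ─ U ∣
      lt = ⊆∧∌⇒< {p = V T ─ (U ∪ ⁅ v ⁆)} (λ z∈ → ─⁺ (─⁻ˡ {p = V T} z∈) (─⁻ʳ {p = V T} z∈ ∘ ∪ˡ)) (─⁺ v∈T v∉U) (λ v∈ → ─⁻ʳ {p = V T} v∈ (∪ʳ (x∈⁅x⁆ v)))
      next zero    ≤k = contradiction (<-≤-trans lt ≤k) λ ()
      next (suc k) ≤k = grow k (s≤s⁻¹ (<-≤-trans lt ≤k)) (leaf γ p∈U v∉U v∈T p~v (unique-neighbour γ p∈U v∉U p~v))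

    grown : Grown (V T)
    grown = grow _ ≤-refl (root (proj₂ nonempty))

-- Rooted models

-- Families of branch sets are searched as vectors; `isModel-≗` then transfers a model between a
-- function and its table.
anyVec? : ∀ {m n} {P : Vec (Subset n) m → Set} → (∀ v → Dec (P v)) → Dec (∃[ v ] P v)
anyVec? {zero}  P? = map′ ([] ,_) (λ { ([] , p) → p }) (P? [])
anyVec? {suc m} P? = map′ (λ (E , v , p) → E ∷ v , p) (λ { (E ∷ v , p) → E , v , p })
  (anySubset? λ E → anyVec? λ v → P? (E ∷ v))

module RootedModels {n} (_~_ : Rel (Fin n) 0ℓ) (_~?_ : Decidable _~_) (~-sym : Symmetric _~_) (S : Subset n)
                    {m} (T : Graph m) (tree : IsTree T) where
  open Separation _~_ _~?_ ~-sym
  open Graph T using () renaming (_~_ to _~ᵀ_; _~?_ to _~ᵀ?_; ~-sym to ~ᵀ-sym)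
  open Tree T

  Adj : Subset n → Subset n → Set
  Adj P Q = ∃[ u ] ∃[ v ] (u ∈ P × v ∈ Q × u ~ v)

  adj? : ∀ P Q → Dec (Adj P Q)
  adj? P Q = any? λ u → any? λ v → (u ∈? P) ×-dec (v ∈? Q) ×-dec (u ~? v)

  adj-mono : ∀ {P P′ Q Q′} → P ⊆ P′ → Q ⊆ Q′ → Adj P Q → Adj P′ Q′
  adj-mono P⊆ Q⊆ (u , v , u∈ , v∈ , e) = u , v , P⊆ u∈ , Q⊆ v∈ , e

  record IsModel (A : Subset n) (br : Fin m → Subset n) : Set where
    field
      within : ∀ {x} → x ∈ V T → br x ⊆ A
      conn   : ∀ {x} → x ∈ V T → Conn (br x)
      rooted : ∀ {x} → x ∈ V T → ∃[ s ] (s ∈ br x × s ∈ S)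
      disj   : ∀ {x y z} → x ∈ V T → y ∈ V T → z ∈ br x → z ∈ br y → x ≡ y
      adj    : ∀ {x y} → x ~ᵀ y → Adj (br x) (br y)

  isModel? : ∀ A br → Dec (IsModel A br)
  isModel? A br = map′ build (λ M → let open IsModel M in (λ x x∈ → within x∈ , conn x∈ , rooted x∈) , (λ x y → (λ x∈ y∈ z → disj x∈ y∈) , adj))
    (all? single? ×-dec all? λ x → all? (pair? x))
    where
    Single : Fin m → Set
    Single x = x ∈ V T → br x ⊆ A × Conn (br x) × ∃[ s ] (s ∈ br x × s ∈ S)
    Pair : Fin m → Fin m → Set
    Pair x y = (x ∈ V T → y ∈ V T → ∀ z → z ∈ br x → z ∈ br y → x ≡ y) × (x ~ᵀ y → Adj (br x) (br y))
    single? : ∀ x → Dec (Single x)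
    single? x = (x ∈? V T) →-dec ((br x ⊆? A) ×-dec conn? (br x) ×-dec any? λ s → (s ∈? br x) ×-dec (s ∈? S))
    pair? : ∀ x y → Dec (Pair x y)
    pair? x y =
      ((x ∈? V T) →-dec ((y ∈? V T) →-dec all? λ z → (z ∈? br x) →-dec ((z ∈? br y) →-dec (x ≟ y)))) ×-dec
      ((x ~ᵀ? y) →-dec adj? (br x) (br y))
    build : (∀ x → Single x) × (∀ x y → Pair x y) → IsModel A br
    build (f , g) = record
      { within = λ {x} x∈ → proj₁ (f x x∈)
      ; conn   = λ {x} x∈ → proj₁ (proj₂ (f x x∈))
      ; rooted = λ {x} x∈ → proj₂ (proj₂ (f x x∈))
      ; disj   = λ {x} {y} {z} x∈ y∈ → proj₁ (g x y) x∈ y∈ z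
      ; adj    = λ {x} {y} → proj₂ (g x y) }

  isModel-≗ : ∀ {A br br′} → (∀ x → br x ≡ br′ x) → IsModel A br → IsModel A br′
  isModel-≗ {br = br} {br′} eq M = record
    { within = λ {x} x∈ z∈ → within x∈ (from x z∈)
    ; conn   = λ {x} x∈ → subst (λ P → Conn P) (eq x) (conn x∈)
    ; rooted = λ {x} x∈ → let s , p , q = rooted x∈ in s , to x p , q
    ; disj   = λ {x} {y} x∈ y∈ p q → disj x∈ y∈ (from x p) (from y q)
    ; adj    = λ {x} {y} e → adj-mono (to x) (to y) (adj e) }
    where
    open IsModel M
    to : ∀ x → br x ⊆ br′ x
    to x {z} = subst (z ∈_) (eq x)
    from : ∀ x → br′ x ⊆ br x
    from x {z} = subst (z ∈_) (sym (eq x))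

  HasModel : Subset n → Set
  HasModel A = ∃[ br ] IsModel A br

  abstract

    hasModel? : ∀ A → Dec (HasModel A)
    hasModel? A = map′ (λ (v , M) → lookup v , M)
      (λ (br , M) → tabulate br , isModel-≗ (λ x → sym (lookup∘tabulate br x)) M)
      (anyVec? (λ v → isModel? A (lookup v)))

  hasModel-mono : ∀ {A B} → A ⊆ B → HasModel A → HasModel B
  hasModel-mono A⊆B (br , M) = br , record { within = λ x∈ → A⊆B ∘ within x∈ ; conn = conn ; rooted = rooted ; disj = disj ; adj = adj }
    where open IsModel M

  abstract

    -- `W` is the union of the branch sets, connected because the tree is. A model can then be
    -- handled as one connected set that meets `S` and must cross the border of any set that it
    -- enters and leaves.
    support : ∀ {A} → HasModel A → ∃[ W ] (W ⊆ A × Conn W × HasModel W × ∃[ s ] (s ∈ W × s ∈ S))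
    support {A} (br , M) with span (grown tree)
      where
      open IsModel M
      span : ∀ {U} → Grown U → ∃[ W ] (W ⊆ A × Conn W × (∀ {x} → x ∈ U → br x ⊆ W))
      span (root {r} r∈) = br r , within r∈ , conn r∈ , λ x∈ {z} → subst (λ x → z ∈ br x) (⁅⁆⁻ x∈)
      span (leaf {U} {p} {v} γ p∈ _ v∈ p~v _) with span γ | adj p~v
      ... | W , W⊆ , cW , br⊆ | a , b , a∈ , b∈ , a~b = W ∪ br v , ∪-⊆ W⊆ (within v∈) ,
        conn-∪ cW (conn v∈) (br⊆ p∈ a∈) b∈ (inj₂ a~b) , λ x∈ z∈ → cover br⊆ (∪⁻ x∈) z∈
        where
        cover : ∀ {W x z} → (∀ {x} → x ∈ U → br x ⊆ W) → x ∈ U ⊎ x ∈ ⁅ v ⁆ → z ∈ br x → z ∈ W ∪ br v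
        cover br⊆ (inj₁ x∈U) z∈ = ∪ˡ (br⊆ x∈U z∈)
        cover br⊆ (inj₂ x≡v) z∈ = ∪ʳ (subst (λ x → _ ∈ br x) (⁅⁆⁻ x≡v) z∈)
    ... | W , W⊆ , cW , br⊆ = W , W⊆ , cW ,
      (br , record { within = br⊆ ; conn = conn ; rooted = rooted ; disj = disj ; adj = adj }) ,
      (let r∈ = proj₂ (IsTree.nonempty tree) ; s , p , q = rooted r∈ in s , br⊆ r∈ p , q)
      where open IsModel M

-- Growing linked sets

module Growth {n} (_~_ : Rel (Fin n) 0ℓ) (_~?_ : Decidable _~_) (~-sym : Symmetric _~_) (S : Subset n)
              {m} (T : Graph m) (tree : IsTree T) where
  open StrictMenger _~_ _~?_ ~-sym public
  open RootedModels _~_ _~?_ ~-sym S T tree public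
  open Tree T public
  open Graph T using () renaming (_~_ to _~ᵀ_; ~-sym to ~ᵀ-sym)

  ∂ : Subset n → Subset n → Subset n
  ∂ H X = border H ∅ X

  ∂⁺ : ∀ {H X x y} → x ∈ X → y ∈ H → y ∉ X → x ~ y → x ∈ ∂ H X
  ∂⁺ x∈ y∈ y∉ e = border⁺ x∈ (inj₂ (_ , y∈ , y∉ , e))

  ∂⁻ : ∀ {H X x} → x ∈ ∂ H X → x ∈ X × ∃[ y ] (y ∈ H × y ∉ X × x ~ y)
  ∂⁻ {H} {X} x∈ with border⁻ {H} {∅} {X} x∈
  ... | x∈X , inj₁ x∈∅ = ⊥-elim (∉⊥ x∈∅)
  ... | x∈X , inj₂ out = x∈X , out

  record Pocket (b : ℕ) (H : Subset n) : Set where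
    field
      A Y    : Subset n
      A⊆H    : A ⊆ H
      Y⊆H    : Y ⊆ H
      ∂A⊆Y   : ∂ H A ⊆ Y
      ∣Y∣≤b  : ∣ Y ∣ ≤ b
      has    : HasModel A
      hasn't : ¬ HasModel (A ─ Y)

  pocket-mono : ∀ {b b′ H} → b ≤ b′ → Pocket b H → Pocket b′ H
  pocket-mono b≤ P = record { A = A ; Y = Y ; A⊆H = A⊆H ; Y⊆H = Y⊆H ; ∂A⊆Y = ∂A⊆Y ; ∣Y∣≤b = ≤-trans ∣Y∣≤b b≤ ; has = has ; hasn't = hasn't }
    where open Pocket P

  -- The rails of a state only need sinks on ∂ H X; their sources carry no information, hence ⊤.
  record State (H K : Subset n) (τ i : ℕ) : Set where
    field
      X    : Subset n
      K⊆X  : K ⊆ X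
      X⊆H  : X ⊆ H
      free : ¬ HasModel X
      ∂X≤  : ∣ ∂ H X ∣ ≤ i
      max  : ∀ {F} → X ⊆ F → F ⊆ H → ¬ HasModel F → ∣ ∂ H F ∣ ≤ i → F ⊆ X
      link : Link i X ⊤ (∂ H X)
    open Link link public
    field
      core : ∀ {l z} → z ∈ rail l → z ∈ K → z ∈ ∂ H K
      tag  : Fin i → Fin τ

  record Extends {H K τ i j} (σ : State H K τ i) (σ′ : State H K τ j) : Set where
    open State
    field
      ι     : Fin i → Fin j
      ι-inj : ∀ {a b} → ι a ≡ ι b → a ≡ b
      rail⊆ : ∀ l → rail σ l ⊆ rail σ′ (ι l)
      tag≡  : ∀ l → tag σ′ (ι l) ≡ tag σ l

  extends-refl : ∀ {H K τ i} {σ : State H K τ i} → Extends σ σ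
  extends-refl = record { ι = id ; ι-inj = id ; rail⊆ = λ _ → id ; tag≡ = λ _ → refl }

  extends-trans : ∀ {H K τ i j k} {σ : State H K τ i} {σ′ : State H K τ j} {σ″ : State H K τ k} →
                  Extends σ σ′ → Extends σ′ σ″ → Extends σ σ″
  extends-trans e e′ = record
    { ι = E′.ι ∘ E.ι ; ι-inj = E.ι-inj ∘ E′.ι-inj ; rail⊆ = λ l → E′.rail⊆ (E.ι l) ∘ E.rail⊆ l ; tag≡ = λ l → trans (E′.tag≡ (E.ι l)) (E.tag≡ l) }
    where
    module E = Extends e
    module E′ = Extends e′

  abstract

    -- If adding `v` to `X` creates a model, then `v` and the border of `X` destroy it. Otherwise
    -- `X+` is enlarged to a maximal set for border size `suc i`. Every set between the two is
    -- without models, so maximality of `X` gives it a border of at least `suc i` vertices: this is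
    -- Menger's condition for extending the rails, with `v` as a new one.
    step : ∀ {H K τ i} (σ : State H K τ i) {v} → v ∈ H → v ∉ State.X σ → (g : Fin τ) →
           Pocket (suc i) H ⊎ Σ[ σ′ ∈ State H K τ (suc i) ] Σ[ e ∈ Extends σ σ′ ] ∃[ l ] (v ∈ State.rail σ′ l × (∀ j → Extends.ι e j ≢ l) × State.tag σ′ l ≡ g)
    step {H} {K} {τ} {i} σ {v} v∈H v∉X g with hasModel? (State.X σ ∪ ⁅ v ⁆)
    ... | yes has = inj₁ record
      { A = X ∪ ⁅ v ⁆ ; Y = ∂ H X ∪ ⁅ v ⁆
      ; A⊆H = ∪-⊆ X⊆H (⁅⁆⊆ v∈H)
      ; Y⊆H = ∪-⊆ (X⊆H ∘ border⊆ {H} {∅}) (⁅⁆⊆ v∈H)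
      ; ∂A⊆Y = λ x∈ → sub (∂⁻ {H} {X ∪ ⁅ v ⁆} x∈)
      ; ∣Y∣≤b = ≤-trans (⊆∪⁅⁆⇒≤ (∂ H X) v id) (s≤s ∂X≤)
      ; has = has
      ; hasn't = free ∘ hasModel-mono λ x∈ → [ id , (λ x∈v → ⊥-elim (─⁻ʳ {p = X ∪ ⁅ v ⁆} x∈ (∪ʳ x∈v))) ]′ (∪⁻ (─⁻ˡ {p = X ∪ ⁅ v ⁆} x∈)) }
      where
      open State σ
      sub : ∀ {x} → x ∈ X ∪ ⁅ v ⁆ × ∃[ y ] (y ∈ H × y ∉ X ∪ ⁅ v ⁆ × x ~ y) → x ∈ ∂ H X ∪ ⁅ v ⁆
      sub (x∈ , y , y∈H , y∉ , e) = [ (λ x∈X → ∪ˡ (∂⁺ x∈X y∈H (y∉ ∘ ∪ˡ) e)) , ∪ʳ ]′ (∪⁻ x∈)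
    ... | no free+ = inj₂ (σ′ , ext , zero , proj₁ (proj₂ glued) zero (x∈⁅x⁆ v) , (λ _ ()) , refl)
      where
      open State σ
      X+ : Subset n
      X+ = X ∪ ⁅ v ⁆
      X+⊆H : X+ ⊆ H
      X+⊆H = ∪-⊆ X⊆H (⁅⁆⊆ v∈H)
      large : ∀ {F} → X+ ⊆ F → F ⊆ H → ¬ HasModel F → suc i ≤ ∣ ∂ H F ∣
      large {F} X+⊆F F⊆H freeF = ≰⇒> λ ≤i → v∉X (max (X+⊆F ∘ ∪ˡ) F⊆H freeF ≤i (X+⊆F (∪ʳ (x∈⁅x⁆ v))))
      ∂X+⊆ : ∂ H X+ ⊆ ∂ H X ∪ ⁅ v ⁆
      ∂X+⊆ x∈ with ∂⁻ {H} {X+} x∈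
      ... | x∈X+ , y , y∈H , y∉ , e = [ (λ x∈X → ∪ˡ (∂⁺ x∈X y∈H (y∉ ∘ ∪ˡ) e)) , ∪ʳ ]′ (∪⁻ x∈X+)
      ∂X+≤ : ∣ ∂ H X ∪ ⁅ v ⁆ ∣ ≤ suc i
      ∂X+≤ = ≤-trans (⊆∪⁅⁆⇒≤ (∂ H X) v id) (s≤s ∂X≤)
      -- The lower bound `large` turns the inclusion `∂X+⊆` into an equality, so all old sinks stay
      -- on the border and `v` joins them.
      ⊆∂X+ : ∂ H X ∪ ⁅ v ⁆ ⊆ ∂ H X+
      ⊆∂X+ = ⊆∧≥⇒⊇ {p = ∂ H X+} ∂X+⊆ (≤-trans ∂X+≤ (large id X+⊆H free+))
      Small : Subset n → Set
      Small F = F ⊆ H × ¬ HasModel F × ∣ ∂ H F ∣ ≤ suc i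
      small? : ∀ F → Dec (Small F)
      small? F = (F ⊆? H) ×-dec ¬? (hasModel? F) ×-dec (∣ ∂ H F ∣ ≤? suc i)
      grown-X : ∃[ F ] (Small F × X+ ⊆ F × ∀ {F′} → Small F′ → F ⊆ F′ → F′ ⊆ F)
      grown-X = maximal small? {E = X+} (X+⊆H , free+ , ≤-trans (⊆⇒≤ {p = ∂ H X+} ∂X+⊆) ∂X+≤)
      X′ N : Subset n
      X′ = proj₁ grown-X
      N = (X′ ─ X+) ∪ ∂ H X+
      X′⊆H : X′ ⊆ H
      X′⊆H = proj₁ (proj₁ (proj₂ grown-X))
      free′ : ¬ HasModel X′
      free′ = proj₁ (proj₂ (proj₁ (proj₂ grown-X)))
      ∂X′≤ : ∣ ∂ H X′ ∣ ≤ suc i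
      ∂X′≤ = proj₂ (proj₂ (proj₁ (proj₂ grown-X)))
      X+⊆X′ : X+ ⊆ X′
      X+⊆X′ = proj₁ (proj₂ (proj₂ grown-X))
      max′ : ∀ {F} → X′ ⊆ F → F ⊆ H → ¬ HasModel F → ∣ ∂ H F ∣ ≤ suc i → F ⊆ X′
      max′ X′⊆F F⊆H freeF F≤ = proj₂ (proj₂ (proj₂ grown-X)) (F⊆H , freeF , F≤) X′⊆F
      N⊆X′ : N ⊆ X′
      N⊆X′ = ∪-⊆ {p = X′ ─ X+} (─⁻ˡ {p = X′}) (X+⊆X′ ∘ border⊆ {H} {∅})
      linkable : Linkable (suc i) N (∂ H X+) (∂ H X′)
      linkable E ∂⊆E E⊆N = ≤-trans
        (large {X+ ∪ E} ∪ˡ (X′⊆H ∘ XE⊆X′) (free′ ∘ hasModel-mono XE⊆X′))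
        (⊆⇒≤ {p = ∂ H (X+ ∪ E)} λ x∈ → sub (∂⁻ {H} {X+ ∪ E} x∈))
        where
        XE⊆X′ : X+ ∪ E ⊆ X′
        XE⊆X′ = ∪-⊆ X+⊆X′ (N⊆X′ ∘ E⊆N)
        sub : ∀ {x} → x ∈ X+ ∪ E × ∃[ y ] (y ∈ H × y ∉ X+ ∪ E × x ~ y) → x ∈ border N (∂ H X′) E
        sub {x} (x∈ , y , y∈H , y∉ , e) = border⁺ ([ (λ x∈X+ → ∂⊆E (∂⁺ x∈X+ y∈H (y∉ ∘ ∪ˡ) e)) , id ]′ (∪⁻ x∈)) leaves
          where
          leaves : Leaves N (∂ H X′) E x
          leaves with y ∈? X′
          ... | yes y∈X′ = inj₂ (y , ∪ˡ (─⁺ y∈X′ (y∉ ∘ ∪ˡ)) , y∉ ∘ ∪ʳ , e)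
          ... | no  y∉X′ = inj₁ (∂⁺ (XE⊆X′ x∈) y∈H y∉X′ e)
      L+ : Link (suc i) X+ ⊤ (∂ H X+)
      L+ = link-cons ⁅ v ⁆ ∪ʳ (conn-⁅⁆ v) (v , x∈⁅x⁆ v , ∈⊤) (v , x∈⁅x⁆ v , ⊆∂X+ (∪ʳ (x∈⁅x⁆ v)))
        (link-mono (λ x∈ → ─⁺ (∪ˡ x∈) λ x≡v → v∉X (subst (_∈ X) (⁅⁆⁻ x≡v) x∈)) id (⊆∂X+ ∘ ∪ˡ) link)
      glued : Σ[ L ∈ Link (suc i) (X+ ∪ N) ⊤ (∂ H X′) ]
                ((∀ l → Link.rail L+ l ⊆ Link.rail L l) × (∀ {l z} → z ∈ Link.rail L l → z ∈ Link.rail L+ l ⊎ z ∈ N))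
      glued = link-glue (≤-trans (⊆⇒≤ {p = ∂ H X+} ∂X+⊆) ∂X+≤)
        (λ x∈X+ x∈N → [ (λ x∈ → ⊥-elim (─⁻ʳ {p = X′} x∈ x∈X+)) , id ]′ (∪⁻ x∈N)) L+ (menger (suc i) ∪ʳ linkable)
      core-N : ∀ {z} → z ∈ N → z ∈ K → z ∈ ∂ H K
      core-N z∈N z∈K with ∪⁻ z∈N
      ... | inj₁ z∈ = ⊥-elim (─⁻ʳ {p = X′} z∈ (∪ˡ (K⊆X z∈K)))
      ... | inj₂ z∈ with ∂⁻ {H} {X+} z∈
      ... | _ , y , y∈H , y∉ , e = ∂⁺ z∈K y∈H (y∉ ∘ ∪ˡ ∘ K⊆X) e
      core+ : ∀ l {z} → z ∈ Link.rail L+ l → z ∈ K → z ∈ ∂ H K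
      core+ zero    z∈v z∈K = ⊥-elim (v∉X (subst (_∈ X) (⁅⁆⁻ z∈v) (K⊆X z∈K)))
      core+ (suc l) z∈l z∈K = core z∈l z∈K
      σ′ : State H K τ (suc i)
      σ′ = record
        { X = X′ ; K⊆X = X+⊆X′ ∘ ∪ˡ ∘ K⊆X ; X⊆H = X′⊆H ; free = free′ ; ∂X≤ = ∂X′≤ ; max = max′
        ; link = link-mono (∪-⊆ X+⊆X′ N⊆X′) id id (proj₁ glued)
        ; core = λ {l} z∈ z∈K → [ (λ z∈+ → core+ l z∈+ z∈K) , (λ z∈N → core-N z∈N z∈K) ]′ (proj₂ (proj₂ glued) z∈)
        ; tag = λ { zero → g ; (suc l) → tag l } }
      ext : Extends σ σ′
      ext = record { ι = suc ; ι-inj = suc-injective ; rail⊆ = λ l → proj₁ (proj₂ glued) (suc l) ; tag≡ = λ l → refl }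

-- Copies of the tree among the rails

module Copies {n} (_~_ : Rel (Fin n) 0ℓ) (_~?_ : Decidable _~_) (~-sym : Symmetric _~_) (S : Subset n)
              {m} (T : Graph m) (tree : IsTree T) where
  open Growth _~_ _~?_ ~-sym S T tree public
  open Graph T using () renaming (_~_ to _~ᵀ_; ~-sym to ~ᵀ-sym; ~-irrefl to ~ᵀ-irrefl)
  open State using (rail; tag)

  adj-sym : ∀ {P Q} → Adj P Q → Adj Q P
  adj-sym (u , v , u∈ , v∈ , e) = v , u , v∈ , u∈ , ~-sym e

  record Copy {H K τ i} (σ : State H K τ i) (g : Fin τ) (U : Subset m) : Set where
    field
      emb    : Fin m → Fin i
      inj    : ∀ {x y} → x ∈ U → y ∈ U → emb x ≡ emb y → x ≡ y
      adj    : ∀ {x y} → x ∈ U → y ∈ U → x ~ᵀ y → Adj (rail σ (emb x)) (rail σ (emb y))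
      tagged : ∀ {x} → x ∈ U → tag σ (emb x) ≡ g

  copy-extend : ∀ {H K τ i j g U} {σ : State H K τ i} {σ′ : State H K τ j} → Extends σ σ′ → Copy σ g U → Copy σ′ g U
  copy-extend e C = record
    { emb = ι ∘ emb ; inj = λ x∈ y∈ → inj x∈ y∈ ∘ ι-inj ; adj = λ x∈ y∈ → adj-mono (rail⊆ _) (rail⊆ _) ∘ adj x∈ y∈
    ; tagged = λ {x} x∈ → trans (tag≡ (emb x)) (tagged x∈) }
    where
    open Extends e
    open Copy C

  outer-neighbour : ∀ {H K τ i} (σ : State H K τ i) l → ∃[ x ] ∃[ y ] (x ∈ rail σ l × y ∈ H × y ∉ State.X σ × x ~ y)
  outer-neighbour {H} σ l with State.sink σ l
  ... | x , x∈l , x∈∂ with ∂⁻ {H} {State.X σ} x∈∂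
  ... | _ , y , y∈H , y∉X , x~y = x , y , x∈l , y∈H , y∉X , x~y

  Grow : ∀ {H K τ i} → State H K τ i → Fin n → Fin τ → ∀ {U} → Grown U → Set
  Grow {H} {K} {τ} {i} σ v g {U} γ =
    Σ[ σ′ ∈ State H K τ (size γ + i) ] Extends σ σ′ × Σ[ C ∈ Copy σ′ g U ] v ∈ rail σ′ (Copy.emb C (rootOf γ))

  abstract

    -- The rail of the parent ends on the border of `X` and so has a neighbour outside; `step` at
    -- that neighbour creates an adjacent rail for the leaf. Later steps only enlarge rails, so
    -- adjacencies persist.
    growCopy : ∀ {H K τ i J} (σ : State H K τ i) {v} → v ∈ H → v ∉ State.X σ → ∀ g {U} (γ : Grown U) → size γ + i ≤ J →
               Pocket J H ⊎ Grow σ v g γ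
    growCopy σ v∈H v∉X g (root {r} _) ≤J with step σ v∈H v∉X g
    ... | inj₁ P = inj₁ (pocket-mono ≤J P)
    ... | inj₂ (σ′ , e , l , v∈l , _ , tag-l) = inj₂ (σ′ , e , record
      { emb = λ _ → l
      ; inj = λ x∈ y∈ _ → trans (⁅⁆⁻ x∈) (sym (⁅⁆⁻ y∈))
      ; adj = λ x∈ y∈ x~y → ⊥-elim (~ᵀ-irrefl (subst (_ ~ᵀ_) (trans (⁅⁆⁻ y∈) (sym (⁅⁆⁻ x∈))) x~y))
      ; tagged = λ _ → tag-l } , v∈l)
    growCopy {H} {K} {τ} {i} σ {a} a∈H a∉X g (leaf {U} {p} {v} γ p∈ v∉ v∈T p~v unique) ≤J
      with growCopy σ a∈H a∉X g γ (≤-trans (n≤1+n _) ≤J)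
    ... | inj₁ P = inj₁ P
    ... | inj₂ (σ₁ , e₁ , C , a∈) with outer-neighbour σ₁ (Copy.emb C p)
    ... | x , y , x∈p , y∈H , y∉X , x~y with step σ₁ y∈H y∉X g
    ... | inj₁ P = inj₁ (pocket-mono ≤J P)
    ... | inj₂ (σ₂ , e₂ , l , y∈l , fresh , tag-l) = inj₂ (σ₂ , extends-trans e₁ e₂ , C′ ,
            subst (λ k → a ∈ rail σ₂ k) (sym (emb-old (rootOf∈ γ))) (E.rail⊆ _ a∈))
      where
      module E = Extends e₂
      open Copy C
      emb′ : Fin m → Fin (suc (size γ + i))
      emb′ u with u ≟ v
      ... | yes _ = l
      ... | no  _ = E.ι (emb u)
      emb-new : emb′ v ≡ l
      emb-new with v ≟ v
      ... | yes _  = refl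
      ... | no v≢v = ⊥-elim (v≢v refl)
      emb-old : ∀ {u} → u ∈ U → emb′ u ≡ E.ι (emb u)
      emb-old {u} u∈ with u ≟ v
      ... | yes refl = ⊥-elim (v∉ u∈)
      ... | no  _    = refl
      Adj′ : Fin m → Fin m → Set
      Adj′ x y = Adj (rail σ₂ (emb′ x)) (rail σ₂ (emb′ y))
      adj-new : ∀ {u} → u ∈ U → u ~ᵀ v → Adj′ u v
      adj-new {u} u∈ u~v rewrite emb-old u∈ | emb-new = x , y , E.rail⊆ _ (subst (λ w → x ∈ rail σ₁ (emb w)) (sym (unique u∈ u~v)) x∈p) , y∈l , x~y
      adj-old : ∀ {u w} → u ∈ U → w ∈ U → u ~ᵀ w → Adj′ u w
      adj-old u∈ w∈ u~w rewrite emb-old u∈ | emb-old w∈ = adj-mono (E.rail⊆ _) (E.rail⊆ _) (adj u∈ w∈ u~w)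
      inj′ : ∀ {x y} → x ∈ U ⊎ x ∈ ⁅ v ⁆ → y ∈ U ⊎ y ∈ ⁅ v ⁆ → emb′ x ≡ emb′ y → x ≡ y
      inj′ (inj₁ x∈) (inj₁ y∈) eq = inj x∈ y∈ (E.ι-inj (trans (sym (emb-old x∈)) (trans eq (emb-old y∈))))
      inj′ (inj₁ x∈) (inj₂ y≡) eq with ⁅⁆⁻ y≡
      ... | refl = ⊥-elim (fresh _ (trans (sym (emb-old x∈)) (trans eq emb-new)))
      inj′ (inj₂ x≡) (inj₁ y∈) eq with ⁅⁆⁻ x≡
      ... | refl = ⊥-elim (fresh _ (trans (sym (emb-old y∈)) (trans (sym eq) emb-new)))
      inj′ (inj₂ x≡) (inj₂ y≡) eq = trans (⁅⁆⁻ x≡) (sym (⁅⁆⁻ y≡))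
      adj′ : ∀ {x y} → x ∈ U ⊎ x ∈ ⁅ v ⁆ → y ∈ U ⊎ y ∈ ⁅ v ⁆ → x ~ᵀ y → Adj′ x y
      adj′ (inj₁ x∈) (inj₁ y∈) x~y = adj-old x∈ y∈ x~y
      adj′ (inj₁ x∈) (inj₂ y≡) x~y with ⁅⁆⁻ y≡
      ... | refl = adj-new x∈ x~y
      adj′ (inj₂ x≡) (inj₁ y∈) x~y with ⁅⁆⁻ x≡
      ... | refl = adj-sym (adj-new y∈ (~ᵀ-sym x~y))
      adj′ (inj₂ x≡) (inj₂ y≡) x~y with ⁅⁆⁻ x≡ | ⁅⁆⁻ y≡
      ... | refl | refl = ⊥-elim (~ᵀ-irrefl x~y)
      tagged′ : ∀ {x} → x ∈ U ⊎ x ∈ ⁅ v ⁆ → tag σ₂ (emb′ x) ≡ g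
      tagged′ (inj₁ x∈) = trans (cong (tag σ₂) (emb-old x∈)) (trans (E.tag≡ _) (tagged x∈))
      tagged′ (inj₂ x≡) with ⁅⁆⁻ x≡
      ... | refl = trans (cong (tag σ₂) emb-new) tag-l
      C′ : Copy σ₂ g (U ∪ ⁅ v ⁆)
      C′ = record { emb = emb′ ; inj = λ x∈ y∈ → inj′ (∪⁻ x∈) (∪⁻ y∈) ; adj = λ x∈ y∈ → adj′ (∪⁻ x∈) (∪⁻ y∈) ; tagged = λ x∈ → tagged′ (∪⁻ x∈) }

  γ : Grown (V T)
  γ = grown tree

  t : ℕ
  t = size γ

  Attached : ∀ {H K τ i} → State H K τ i → Fin i → Fin τ → Set
  Attached σ c g = Σ[ C ∈ Copy σ g (V T) ] Adj (rail σ c) (rail σ (Copy.emb C (rootOf γ)))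

  attached-extend : ∀ {H K τ i j c g} {σ : State H K τ i} {σ′ : State H K τ j} (e : Extends σ σ′) →
                    Attached σ c g → Attached σ′ (Extends.ι e c) g
  attached-extend e (C , a) = copy-extend e C , adj-mono (Extends.rail⊆ e _) (Extends.rail⊆ e _) a

  abstract

    growCopies : ∀ {H K τ i J} (gs : List (Fin τ)) (σ : State H K τ i) (c : Fin τ → Fin i) → i + length gs * t ≤ J →
                 Pocket J H ⊎ ∃[ j ] (j ≤ J × Σ[ σ′ ∈ State H K τ j ] Σ[ e ∈ Extends σ σ′ ] All (λ g → Attached σ′ (Extends.ι e (c g)) g) gs)
    growCopies {i = i} [] σ c ≤J = inj₂ (i , ≤-trans (m≤m+n i 0) ≤J , σ , extends-refl , [])
    growCopies {i = i} {J} (g ∷ gs) σ c ≤J with outer-neighbour σ (c g)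
    ... | x , y , x∈c , y∈H , y∉X , x~y with growCopy σ y∈H y∉X g γ (≤-trans (m≤m+n (t + i) (length gs * t)) ≤J′)
      where
      ≤J′ : t + i + length gs * t ≤ J
      ≤J′ = subst (_≤ J) (trans (sym (+-assoc i t _)) (cong (_+ length gs * t) (+-comm i t))) ≤J
    ... | inj₁ P = inj₁ P
    ... | inj₂ (σ₁ , e₁ , C , y∈) with growCopies gs σ₁ (Extends.ι e₁ ∘ c) (subst (_≤ J) (trans (sym (+-assoc i t _)) (cong (_+ length gs * t) (+-comm i t))) ≤J)
    ... | inj₁ P = inj₁ P
    ... | inj₂ (j , j≤J , σ₂ , e₂ , all) = inj₂ (j , j≤J , σ₂ , extends-trans e₁ e₂ ,
      attached-extend e₂ (C , x , y , Extends.rail⊆ e₁ (c g) x∈c , y∈ , x~y) ∷ all)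

-- Pockets and bodies

module Dichotomy {n} (_~_ : Rel (Fin n) 0ℓ) (_~?_ : Decidable _~_) (~-sym : Symmetric _~_) (S : Subset n)
                 {m} (T : Graph m) (tree : IsTree T) where
  open Copies _~_ _~?_ ~-sym S T tree public
  open Graph T using () renaming (_~_ to _~ᵀ_; ~-sym to ~ᵀ-sym; ~-irrefl to ~ᵀ-irrefl; ~⇒∈V to ~ᵀ⇒∈V)

  -- Each branch together with its spoke would be a branch set of a rooted model in `H`. They are
  -- kept apart because the spokes are not confined to `X` and are replaced by rails later.
  record Body (c : ℕ) (H : Subset n) : Set where
    field
      X       : Subset n
      X⊆H     : X ⊆ H
      border≤ : o H S X ≤ c
      branch  : Fin m → Subset n
      b⊆X     : ∀ {x} → x ∈ V T → branch x ⊆ X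
      b-conn  : ∀ {x} → x ∈ V T → Conn (branch x)
      b-disj  : ∀ {x y z} → x ∈ V T → y ∈ V T → z ∈ branch x → z ∈ branch y → x ≡ y
      b-adj   : ∀ {x y} → x ~ᵀ y → Adj (branch x) (branch y)
      spoke   : Fin m → Subset n
      s⊆H     : ∀ x → spoke x ⊆ H
      s-conn  : ∀ x → Conn (spoke x)
      s-sink  : ∀ x → ∃[ s ] (s ∈ spoke x × s ∈ S)
      s-disj  : ∀ {x y z} → x ∈ V T → y ∈ V T → z ∈ spoke x → z ∈ spoke y → x ≡ y
      anchor  : Fin m → Fin n
      a∈b     : ∀ {x} → x ∈ V T → anchor x ∈ branch x
      a∈s     : ∀ {x} → x ∈ V T → anchor x ∈ spoke x
      a-only  : ∀ {x z} → x ∈ V T → z ∈ spoke x → z ∈ X → z ≡ anchor x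

  module _ {H K τ j} (σ : State H K τ j) where
    open State σ

    Out : Subset n
    Out = (H ─ X) ∪ ∂ H X

    Out∩X : ∀ {z} → z ∈ Out → z ∈ X → z ∈ ∂ H X
    Out∩X z∈ z∈X = [ (λ z∈′ → ⊥-elim (─⁻ʳ {p = H} z∈′ z∈X)) , id ]′ (∪⁻ z∈)

    Out⊆H : Out ⊆ H
    Out⊆H = ∪-⊆ {p = H ─ X} (─⁻ˡ {p = H}) (X⊆H ∘ border⊆ {H} {∅})

    abstract
      -- Take a deficient `E`. If `X ∪ E` had no model, maximality would put it inside `X`, and the
      -- `j` sinks on the border of `X` would all lie on the border of `E`. A model that avoids `Y`
      -- can meet `S` only in `X`, and it cannot leave `X`, which has no model.
      blocked : ¬ Linkable j Out (∂ H X) S → Pocket (j + j) H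
      blocked ¬l with ¬linkable ¬l
      ... | E , ∂X⊆E , E⊆ , E<j = record
        { A = X ∪ E ; Y = ∂ H X ∪ border Out S E
        ; A⊆H = ∪-⊆ X⊆H (Out⊆H ∘ E⊆)
        ; Y⊆H = ∪-⊆ (X⊆H ∘ border⊆ {H} {∅}) (Out⊆H ∘ E⊆ ∘ border⊆ {Out} {S})
        ; ∂A⊆Y = ∪ʳ ∘ ∂XE⊆
        ; ∣Y∣≤b = ≤-trans (∣∪∣≤ (∂ H X) _) (+-mono-≤ ∂X≤ (<⇒≤ E<j))
        ; has = decidable-stable (hasModel? (X ∪ E)) λ free′ →
            <⇒≱ E<j (≤-trans j≤∂X (⊆⇒≤ {p = ∂ H X} (collapsed (max ∪ˡ (∪-⊆ X⊆H (Out⊆H ∘ E⊆)) free′ (≤-trans (⊆⇒≤ {p = ∂ H (X ∪ E)} ∂XE⊆) (<⇒≤ E<j))))))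
        ; hasn't = none }
        where
        ∂XE⊆ : ∂ H (X ∪ E) ⊆ border Out S E
        ∂XE⊆ z∈ with ∂⁻ {H} {X ∪ E} z∈
        ... | z∈XE , y , y∈H , y∉ , e = border⁺
          ([ (λ z∈X → ∂X⊆E (∂⁺ z∈X y∈H (y∉ ∘ ∪ˡ) e)) , id ]′ (∪⁻ z∈XE))
          (inj₂ (y , ∪ˡ (─⁺ y∈H (y∉ ∘ ∪ˡ)) , y∉ ∘ ∪ʳ , e))
        j≤∂X : j ≤ ∣ ∂ H X ∣
        j≤∂X = Fin-injection (∂ H X) (λ i c → c ∈ rail i) (λ i → let b , p , q = sink i in b , q , p) disj
        collapsed : X ∪ E ⊆ X → ∂ H X ⊆ border Out S E
        collapsed XE⊆X z∈ with ∂⁻ {H} {X} z∈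
        ... | _ , y , y∈H , y∉ , e = border⁺ (∂X⊆E z∈) (inj₂ (y , ∪ˡ (─⁺ y∈H y∉) , y∉ ∘ XE⊆X ∘ ∪ʳ , e))
        none : ¬ HasModel ((X ∪ E) ─ (∂ H X ∪ border Out S E))
        none has with support has
        ... | W , W⊆ , cW , hasW , s , s∈W , s∈S with W ⊆? X
        ... | yes W⊆X = free (hasModel-mono W⊆X hasW)
        ... | no  W⊈X with ⊈⇒∃ W⊈X
        ... | w , w∈W , w∉X with exit X (cW s∈W w∈W) s∈X w∉X
          where
          s∈X : s ∈ X
          s∈X = [ id , (λ s∈E → ⊥-elim (─⁻ʳ {p = X ∪ E} (W⊆ s∈W) (∪ʳ (border⁺ s∈E (inj₁ s∈S))))) ]′ (∪⁻ (─⁻ˡ {p = X ∪ E} (W⊆ s∈W)))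
        ... | a , b , a~b , a∈W , b∈W , a∈X , b∉X = ─⁻ʳ {p = X ∪ E} (W⊆ a∈W)
          (∪ˡ (∂⁺ a∈X (∪-⊆ X⊆H (Out⊆H ∘ E⊆) (─⁻ˡ {p = X ∪ E} (W⊆ b∈W))) b∉X a~b))

  module Core {H τ j} (σ₀ : State H ∅ 1 τ) (C₀ : Copy σ₀ zero (V T)) (σ : State H (State.X σ₀) τ j) where
    open State σ
    private
      module σ₀ = State σ₀

    K In : Subset n
    K = σ₀.X
    In = (X ─ K) ∪ ∂ H K

    In⊆X : In ⊆ X
    In⊆X = ∪-⊆ {p = X ─ K} (─⁻ˡ {p = X}) (K⊆X ∘ border⊆ {H} {∅})

    abstract
      -- Rails from the border of the core to S inside X would turn the copy in the core into a rooted model in X.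
      core-deficient : ∃[ E ] (∂ H K ⊆ E × E ⊆ In × o In S E < τ)
      core-deficient = ¬linkable λ l →
        let L , L₁⊆ , _ = link-glue σ₀.∂X≤ (λ z∈K z∈In → [ (λ z∈ → ⊥-elim (─⁻ʳ {p = X} z∈ z∈K)) , id ]′ (∪⁻ z∈In)) σ₀.link (menger τ ∪ʳ l)
            open Link L using () renaming (rail to ray; within to ray⊆; conn to ray-conn; sink to ray-sink; disj to ray-disj)
            open Copy C₀
        in free ((ray ∘ emb) , record
          { within = λ _ → ∪-⊆ K⊆X In⊆X ∘ ray⊆
          ; conn   = λ {x} _ → ray-conn (emb x)
          ; rooted = λ {x} _ → ray-sink (emb x)
          ; disj   = λ x∈ y∈ z∈ z∈′ → inj x∈ y∈ (ray-disj z∈ z∈′)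
          ; adj    = λ x~y → adj-mono (L₁⊆ _) (L₁⊆ _) (Copy.adj C₀ (~ᵀ⇒∈V x~y) (~ᵀ⇒∈V (~ᵀ-sym x~y)) x~y) })

    module Harvest (c : Fin τ → Fin j) (c-tag : ∀ g → tag (c g) ≡ g)
             (c∈ : ∀ g → ∃[ x ] (x ∈ rail (c g) × x ∈ ∂ H K))
             (att : ∀ g → Attached σ (c g) g) (l : Linkable j (Out σ) (∂ H X) S) {J} (j≤J : j ≤ J) where

      E C : Subset n
      E = proj₁ core-deficient
      C = border In S E

      ∂K⊆E : ∂ H K ⊆ E
      ∂K⊆E = proj₁ (proj₂ core-deficient)

      E⊆In : E ⊆ In
      E⊆In = proj₁ (proj₂ (proj₂ core-deficient))

      C<τ : o In S E < τ
      C<τ = proj₂ (proj₂ (proj₂ core-deficient))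

      Hit : Fin τ → Set
      Hit g = ∃[ l ] (tag l ≡ g × ∃[ z ] (z ∈ C × z ∈ rail l))

      hit? : ∀ g → Dec (Hit g)
      hit? g = any? λ l → (tag l ≟ g) ×-dec any? λ z → (z ∈? C) ×-dec (z ∈? rail l)

      abstract
        -- The rails are disjoint, so a vertex of `C` accounts for at most one tag, and there are
        -- fewer such vertices than tags.
        missed : ∃[ g ] ¬ Hit g
        missed = decidable-stable (any? (λ g → ¬? (hit? g))) λ none → <⇒≱ C<τ
          (Fin-injection C (λ g z → ∃[ l ] (tag l ≡ g × z ∈ rail l))
            (λ g → let l , eq , z , z∈C , z∈l = decidable-stable (hit? g) (λ ¬hit → none (g , ¬hit)) in z , z∈C , l , eq , z∈l)
            λ { (l , refl , z∈l) (l′ , refl , z∈l′) → cong tag (disj z∈l z∈l′) })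

      g : Fin τ
      g = proj₁ missed

      rail⊆In : ∀ {l} → rail l ⊆ In
      rail⊆In z∈l with _ ∈? K
      ... | yes z∈K = ∪ʳ (core z∈l z∈K)
      ... | no  z∉K = ∪ˡ (─⁺ (within z∈l) z∉K)

      stays : ∀ {l x y} → tag l ≡ g → x ∈ rail l → x ∈ E → y ∈ In → x ~ y → y ∈ E
      stays {l} {x} {y} eq x∈l x∈E y∈In x~y = decidable-stable (y ∈? E) λ y∉E →
        proj₂ missed (l , eq , x , border⁺ x∈E (inj₂ (y , y∈In , y∉E , x~y)) , x∈l)

      fills : ∀ {l x} → tag l ≡ g → x ∈ rail l → x ∈ E → rail l ⊆ E
      fills {l} {x} eq x∈l x∈E {y} y∈l = decidable-stable (y ∈? E) λ y∉E →
        let a , b , a~b , a∈l , b∈l , a∈E , b∉E = exit E (conn l x∈l y∈l) x∈E y∉E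
        in b∉E (stays eq a∈l a∈E (rail⊆In b∈l) a~b)

      spreads : ∀ {l l′} → tag l ≡ g → tag l′ ≡ g → rail l ⊆ E → Adj (rail l) (rail l′) → rail l′ ⊆ E
      spreads eq eq′ l⊆E (x , y , x∈ , y∈ , x~y) = fills eq′ y∈ (stays eq x∈ (l⊆E x∈) (rail⊆In y∈) x~y)

      open Copy (proj₁ (att g))

      -- Rails tagged `g` avoid the border of `E`, so neither a rail nor an adjacency between two of
      -- them leads out of `E`. The rail `c g` starts inside, since it meets the border of the core.
      copy⊆E : ∀ {x} → x ∈ V T → rail (emb x) ⊆ E
      copy⊆E x∈ = walk γ (λ x∈ → x∈) (spreads (c-tag g) (tagged (grown⊆ γ (rootOf∈ γ)))
        (let x , x∈c , x∈∂ = c∈ g in fills (c-tag g) x∈c (∂K⊆E x∈∂)) (proj₂ (att g))) x∈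
        where
        walk : ∀ {U} (δ : Grown U) → U ⊆ V T → rail (emb (rootOf δ)) ⊆ E → ∀ {x} → x ∈ U → rail (emb x) ⊆ E
        walk (root _) U⊆ r⊆E x∈ with ⁅⁆⁻ x∈
        ... | refl = r⊆E
        walk (leaf δ p∈ _ v∈ p~v _) U⊆ r⊆E x∈ with ∪⁻ x∈
        ... | inj₁ x∈U = walk δ (U⊆ ∘ ∪ˡ) r⊆E x∈U
        ... | inj₂ x≡v with ⁅⁆⁻ x≡v
        ... | refl = spreads (tagged (U⊆ (∪ˡ p∈))) (tagged v∈) (walk δ (U⊆ ∘ ∪ˡ) r⊆E p∈) (adj (U⊆ (∪ˡ p∈)) v∈ p~v)

      -- Exits from `E` to the part of `X` outside the core are counted by `C`, and exits from `X`
      -- by its border. An exit into the core starts on the core's border: otherwise it would end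
      -- there, hence in `E`.
      border-E : border H S E ⊆ (C ∪ ∂ H K) ∪ ∂ H X
      border-E {z} z∈ with border⁻ {H} {S} {E} z∈
      ... | z∈E , inj₁ z∈S = ∪ˡ (∪ˡ (border⁺ z∈E (inj₁ z∈S)))
      ... | z∈E , inj₂ (y , y∈H , y∉E , e) with y ∈? X | y ∈? K
      ... | no  y∉X | _       = ∪ʳ (∂⁺ (In⊆X (E⊆In z∈E)) y∈H y∉X e)
      ... | yes y∈X | no  y∉K = ∪ˡ (∪ˡ (border⁺ z∈E (inj₂ (y , ∪ˡ (─⁺ y∈X y∉K) , y∉E , e))))
      ... | yes y∈X | yes y∈K with ∪⁻ (E⊆In z∈E)
      ... | inj₂ z∈∂ = ∪ˡ (∪ʳ z∈∂)
      ... | inj₁ z∈  = ⊥-elim (y∉E (∂K⊆E (∂⁺ y∈K (X⊆H (─⁻ˡ {p = X} z∈)) (─⁻ʳ {p = X} z∈) (~-sym e))))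

      rays : Link j (Out σ) (∂ H X) S
      rays = menger j ∪ʳ l

      open Link rays using () renaming (rail to ray; within to ray⊆; conn to ray-conn; sink to ray-sink; disj to ray-disj)

      foot : Fin j → Fin n
      foot k = proj₁ (sink k)

      reach : ∀ k → ∃[ i ] foot k ∈ ray i
      reach k = source-cover rays ∂X≤ (proj₂ (proj₂ (sink k)))

      only : ∀ k {z} → z ∈ ray (proj₁ (reach k)) → z ∈ X → z ≡ foot k
      only k z∈ z∈X = source-unique rays ∂X≤ z∈ (proj₂ (reach k)) (Out∩X σ (ray⊆ z∈) z∈X) (proj₂ (proj₂ (sink k)))

      reach-inj : ∀ {k k′} → proj₁ (reach k) ≡ proj₁ (reach k′) → k ≡ k′
      reach-inj {k} {k′} eq = disj (proj₁ (proj₂ (sink k))) (subst (_∈ rail k′)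
        (sym (only k′ (subst (λ i → foot k ∈ ray i) eq (proj₂ (reach k))) (X⊆′ k))) (proj₁ (proj₂ (sink k′))))
        where
        X⊆′ : ∀ k → foot k ∈ X
        X⊆′ k = within (proj₁ (proj₂ (sink k)))

      body : Body ((τ + τ) + J) H
      body = record
        { X = E
        ; X⊆H = X⊆H ∘ In⊆X ∘ E⊆In
        ; border≤ = ≤-trans (⊆∪⇒≤ {p = border H S E} (C ∪ ∂ H K) (∂ H X) border-E)
                      (+-mono-≤ (≤-trans (∣∪∣≤ C (∂ H K)) (+-mono-≤ (<⇒≤ C<τ) σ₀.∂X≤)) (≤-trans ∂X≤ j≤J))
        ; branch = λ x → rail (emb x)
        ; b⊆X = copy⊆E
        ; b-conn = λ {x} _ → conn (emb x)
        ; b-disj = λ x∈ y∈ z∈ z∈′ → inj x∈ y∈ (disj z∈ z∈′)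
        ; b-adj = λ x~y → adj (~ᵀ⇒∈V x~y) (~ᵀ⇒∈V (~ᵀ-sym x~y)) x~y
        ; spoke = λ x → ray (proj₁ (reach (emb x)))
        ; s⊆H = λ x → Out⊆H σ ∘ ray⊆
        ; s-conn = λ x → ray-conn _
        ; s-sink = λ x → ray-sink _
        ; s-disj = λ x∈ y∈ z∈ z∈′ → inj x∈ y∈ (reach-inj (ray-disj z∈ z∈′))
        ; anchor = λ x → foot (emb x)
        ; a∈b = λ {x} _ → proj₁ (proj₂ (sink (emb x)))
        ; a∈s = λ {x} _ → proj₂ (reach (emb x))
        ; a-only = λ {x} x∈ z∈ z∈E → only (emb x) z∈ (In⊆X (E⊆In z∈E)) }

  -- J counts the branches of the core and of its t hanging copies.
  J c₁ c₂ : ℕ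
  J = t + t * t
  c₁ = J + J
  c₂ = (t + t) + J

  -- With no border allowed, `X` is a maximal union of components of `H` that contains no model.
  initial : ∀ H → State H ∅ 1 0
  initial H = record
    { X = proj₁ start ; K⊆X = ⊥-elim ∘ ∉⊥ ; X⊆H = proj₁ (proj₁ (proj₂ start)) ; free = proj₁ (proj₂ (proj₁ (proj₂ start)))
    ; ∂X≤ = proj₂ (proj₂ (proj₁ (proj₂ start))) ; max = λ X⊆F F⊆H freeF F≤ → proj₂ (proj₂ (proj₂ start)) (F⊆H , freeF , F≤) X⊆F
    ; link = link-zero ; core = λ {} ; tag = λ () }
    where
    Closed : Subset n → Set
    Closed F = F ⊆ H × ¬ HasModel F × ∣ ∂ H F ∣ ≤ 0
    closed? : ∀ F → Dec (Closed F)
    closed? F = (F ⊆? H) ×-dec ¬? (hasModel? F) ×-dec (∣ ∂ H F ∣ ≤? 0)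
    none : ¬ HasModel ∅
    none has with support has
    ... | _ , W⊆ , _ , _ , _ , s∈W , _ = ∉⊥ (W⊆ s∈W)
    ∂∅≤ : ∣ ∂ H ∅ ∣ ≤ 0
    ∂∅≤ = ≤-trans (o≤ H ∅ ∅) (≤-reflexive (∣⊥∣≡0 n))
    start : ∃[ F ] (Closed F × ∅ ⊆ F × ∀ {F′} → Closed F′ → F ⊆ F′ → F′ ⊆ F)
    start = maximal closed? {E = ∅} (⊥-elim ∘ ∉⊥ , none , ∂∅≤)

  -- The old rails run inside the new core, which the field `core` forbids, so only their feet on
  -- its border are kept. Each foot gets its own tag, as each is to carry one hanging copy.
  restart : ∀ {H i} (σ : State H ∅ 1 i) → State H (State.X σ) i i
  restart {H} {i} σ = record
    { X = X ; K⊆X = id ; X⊆H = X⊆H ; free = free ; ∂X≤ = ∂X≤ ; max = max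
    ; link = record
      { rail = λ k → ⁅ foot k ⁆
      ; within = λ {k} z∈ → ⁅⁆⊆ (within (proj₁ (proj₂ (sink k)))) z∈
      ; conn = λ k → conn-⁅⁆ (foot k)
      ; source = λ k → foot k , x∈⁅x⁆ _ , ∈⊤
      ; sink = λ k → foot k , x∈⁅x⁆ _ , proj₂ (proj₂ (sink k))
      ; disj = λ {k} {k′} z∈ z∈′ → disj (⁅⁆⊆ (proj₁ (proj₂ (sink k))) z∈) (⁅⁆⊆ (proj₁ (proj₂ (sink k′))) z∈′) }
    ; core = λ {k} z∈ _ → ⁅⁆⊆ (proj₂ (proj₂ (sink k))) z∈
    ; tag = id }
    where
    open State σ
    foot : Fin i → Fin n
    foot k = proj₁ (sink k)

  abstract

    dichotomy : ∀ {H} → HasModel H → Pocket c₁ H ⊎ Body c₂ H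
    dichotomy {H} has with ⊈⇒∃ {p = H} {q = State.X (initial H)} (λ H⊆X → State.free (initial H) (hasModel-mono H⊆X has))
    ... | v , v∈H , v∉X with growCopy (initial H) v∈H v∉X zero γ ≤-refl
    ... | inj₁ P = inj₁ (pocket-mono (≤-trans (≤-reflexive (+-identityʳ t)) (≤-trans (m≤m+n t (t * t)) (m≤m+n J J))) P)
    ... | inj₂ (σ₀ , _ , C₀ , _) with growCopies {J = J} (allFin (t + 0)) (restart σ₀) id (≤-reflexive (begin
            t + 0 + length (allFin (t + 0)) * t ≡⟨ cong (λ k → t + 0 + k * t) (length-tabulate {n = t + 0} id) ⟩
            t + 0 + (t + 0) * t                 ≡⟨ cong (λ k → k + k * t) (+-identityʳ t) ⟩
            t + t * t                           ∎))
      where open ≡-Reasoning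
    ... | inj₁ P = inj₁ (pocket-mono (m≤m+n J J) P)
    ... | inj₂ (j , j≤J , σ , e , all) with linkable? j (Out σ) (∂ H (State.X σ)) S
    ... | no ¬l = inj₁ (pocket-mono (+-mono-≤ j≤J j≤J) (blocked σ ¬l))
    ... | yes l = inj₂ (subst (λ k → Body ((k + k) + J) H) (+-identityʳ t) (Core.Harvest.body σ₀ C₀ σ (Extends.ι e) (Extends.tag≡ e)
                    (λ g → proj₁ (State.sink σ₀ g) , Extends.rail⊆ e g (x∈⁅x⁆ _) , proj₂ (proj₂ (State.sink σ₀ g)))
                    (λ g → All.lookup all (∈-allFin g)) l j≤J))

-- Moving rails inward

enumerate : ∀ {n} (p : Subset n) → Σ[ f ∈ (Fin ∣ p ∣ → Fin n) ] (∀ i → f i ∈ p) × (∀ {i j} → f i ≡ f j → i ≡ j)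
enumerate []            = (λ ()) , (λ ()) , λ {}
enumerate (outside ∷ p) = let f , f∈ , inj = enumerate p in suc ∘ f , (λ i → there (f∈ i)) , inj ∘ suc-injective
enumerate (inside ∷ p)  = g , g∈ , g-inj
  where
  f = proj₁ (enumerate p)
  g : Fin (suc ∣ p ∣) → Fin _
  g zero    = zero
  g (suc i) = suc (f i)
  g∈ : ∀ i → g i ∈ inside ∷ p
  g∈ zero    = here
  g∈ (suc i) = there (proj₁ (proj₂ (enumerate p)) i)
  g-inj : ∀ {i j} → g i ≡ g j → i ≡ j
  g-inj {zero}  {zero}  _  = refl
  g-inj {suc i} {suc j} eq = cong suc (proj₂ (proj₂ (enumerate p)) (suc-injective eq))

module Realize {n} (_~_ : Rel (Fin n) 0ℓ) (_~?_ : Decidable _~_) (~-sym : Symmetric _~_) (S : Subset n)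
               {m} (T : Graph m) (tree : IsTree T) where
  open Dichotomy _~_ _~?_ ~-sym S T tree public
  open Graph T using () renaming (_~_ to _~ᵀ_)

  Closed : (M F : Subset n) → Set
  Closed M F = ∀ {E} → F ⊆ E → E ⊆ M → o M S E ≤ o M S F → E ⊆ F

  closed-≤ : ∀ {M F} → Closed M F → ∀ {E} → F ⊆ E → E ⊆ M → o M S F ≤ o M S E
  closed-≤ {M} {F} closed {E} F⊆E E⊆M with o M S F ≤? o M S E
  ... | yes ≤ = ≤
  ... | no  ≰ = ≤-reflexive (cong (o M S) (⊆-antisym F⊆E (closed F⊆E E⊆M (<⇒≤ (≰⇒> ≰)))))

  Closure : (M E F : Subset n) → Set
  Closure M E F = E ⊆ F × F ⊆ M × Closed M F × (∀ {E′} → E ⊆ E′ → E′ ⊆ M → o M S F ≤ o M S E′)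

  abstract
    -- A set that is inclusion-maximal among those of least border is closed.
    closure : ∀ {M E} → E ⊆ M → ∃[ F ] Closure M E F
    closure {M} {E} E⊆M = F , proj₁ (proj₁ Fp) , proj₁ (proj₂ (proj₁ Fp)) ,
      (λ F⊆E′ E′⊆M E′≤ → proj₂ (proj₂ Fp) (F⊆E′ ∘ proj₁ (proj₁ Fp) , E′⊆M , ≤-trans E′≤ F≤) F⊆E′) ,
      λ E⊆E′ E′⊆M → ≤-trans F≤ (proj₂ (proj₂ least) (E⊆E′ , E′⊆M))
      where
      Between : Subset n → Set
      Between E′ = E ⊆ E′ × E′ ⊆ M
      between? : ∀ E′ → Dec (Between E′)
      between? E′ = (E ⊆? E′) ×-dec (E′ ⊆? M)
      least : ∃[ F ] (Between F × ∀ {E′} → Between E′ → o M S F ≤ o M S E′)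
      least = argmin between? (o M S) {E} (id , E⊆M)
      Least : Subset n → Set
      Least E′ = E ⊆ E′ × E′ ⊆ M × o M S E′ ≤ o M S (proj₁ least)
      least? : ∀ E′ → Dec (Least E′)
      least? E′ = (E ⊆? E′) ×-dec (E′ ⊆? M) ×-dec (o M S E′ ≤? o M S (proj₁ least))
      greatest : ∃[ F ] (Least F × proj₁ least ⊆ F × ∀ {F′} → Least F′ → F ⊆ F′ → F′ ⊆ F)
      greatest = maximal least? {E = proj₁ least} (proj₁ (proj₁ (proj₂ least)) , proj₂ (proj₁ (proj₂ least)) , ≤-refl)
      F : Subset n
      F = proj₁ greatest
      Fp : Least F × proj₁ least ⊆ F × ∀ {F′} → Least F′ → F ⊆ F′ → F′ ⊆ F
      Fp = proj₂ greatest
      F≤ : o M S F ≤ o M S (proj₁ least)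
      F≤ = proj₂ (proj₂ (proj₁ Fp))

  record Models (a : ℕ) (U : Subset n) : Set where
    field
      set    : Fin a → Subset n
      set⊆   : ∀ {i} → set i ⊆ U
      has    : ∀ i → HasModel (set i)
      apart  : ∀ {i j x} → x ∈ set i → x ∈ set j → i ≡ j

  -- The border vertices of F that lie on no rail are dead; deficit says that there are at most d of them.
  record Realization (U M F : Subset n) (a d : ℕ) : Set where
    field
      κ       : ℕ
      rails   : Link κ M F S
    open Link rails public
    field
      once    : ∀ {i x y} → x ∈ rail i → y ∈ rail i → x ∈ F → y ∈ F → x ≡ y
      deficit : o M S F ≤ κ + d
      models  : Models a U
    open Models models public
    field
      set∉F    : ∀ {i x} → x ∈ set i → x ∉ F
      set∉rail : ∀ {i j x} → x ∈ set i → x ∉ rail j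

  plainLink : ∀ {s M A B} → A ⊆ M → Linkable s M A B → StrictLink s M A B ∅
  plainLink A⊆M l = strictLink ∅ A⊆M (⊥-elim ∘ ∉⊥) (≤-trans (≤-reflexive (∣⊥∣≡0 n)) z≤n)
    (λ E _ _ → ≤-trans (≤-reflexive (∣⊥∣≡0 n)) z≤n) l

  start : ∀ {U M F} → F ⊆ M → Closed M F → Realization U M F 0 0
  start {U} {M} {F} F⊆M closed = record
    { κ = o M S F ; rails = StrictLink.link L ; once = StrictLink.once L ; deficit = m≤m+n _ 0
    ; models = record { set = λ () ; set⊆ = λ {} ; has = λ () ; apart = λ {} }
    ; set∉F = λ {} ; set∉rail = λ {} }
    where
    L : StrictLink (o M S F) M F S ∅
    L = plainLink F⊆M λ E F⊆E E⊆M → closed-≤ closed F⊆E E⊆M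

  module Inward {U M′ F′ a d′} (F′⊆M′ : F′ ⊆ M′) (r : Realization U M′ F′ a d′) where
    open Realization r

    W Q D : Subset n
    W = border M′ S F′
    used? : ∀ x → Dec (x ∈ W × ∃[ i ] x ∈ rail i)
    used? x = (x ∈? W) ×-dec any? λ i → x ∈? rail i
    Q = sep used?
    D = W ─ Q

    split : ∀ {x} → x ∈ W → x ∈ Q ⊎ x ∈ D
    split x∈W = [ inj₂ , inj₁ ]′ (∪⁻ (⊆─∪ {q = Q} x∈W))

    record Attached′ {M N A s} (L : Link s N A Q) (L′ : Link s M A S) : Set where
      field
        ⊇rail  : ∀ {i} → Link.rail L i ⊆ Link.rail L′ i
        inner  : ∀ {i x} → x ∈ Link.rail L′ i → x ∈ F′ → x ∈ Link.rail L i
        origin : ∀ {i x} → x ∈ Link.rail L′ i → x ∈ F′ ⊎ ∃[ j ] x ∈ rail j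

    abstract
      -- Every rail has a live vertex of its own, where it leaves `F′` or where it meets `S` inside
      -- `F′`; hence at least `κ` border vertices are live.
      D≤ : ∣ D ∣ ≤ d′
      D≤ = +-cancelˡ-≤ κ _ _ (begin
        κ + ∣ D ∣      ≤⟨ +-monoˡ-≤ ∣ D ∣ (Fin-injection Q (λ i c → c ∈ rail i) gate disj) ⟩
        ∣ Q ∣ + ∣ D ∣  ≡⟨ +-comm ∣ Q ∣ ∣ D ∣ ⟩
        ∣ D ∣ + ∣ Q ∣  ≤⟨ ∣─∣+∣∣ W Q (proj₁ ∘ sep⁻ used?) ⟩
        o M′ S F′      ≤⟨ deficit ⟩
        κ + d′         ∎)
        where
        open ≤-Reasoning
        gate : ∀ i → ∃[ c ] (c ∈ Q × c ∈ rail i)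
        gate i with source i | sink i
        ... | q , q∈i , q∈F | s , s∈i , s∈S with s ∈? F′
        ... | yes s∈F = s , sep⁺ used? (border⁺ s∈F (inj₁ s∈S) , i , s∈i) , s∈i
        ... | no  s∉F with exit F′ (conn i q∈i s∈i) q∈F s∉F
        ... | u , v , u~v , u∈i , v∈i , u∈F , v∉F =
          u , sep⁺ used? (border⁺ u∈F (inj₂ (v , within v∈i , v∉F , u~v)) , i , u∈i) , u∈i

      -- By `once`, an old rail meets `F′` in its hinge alone. So the prolonged rails follow `L`
      -- inside `F′` and the old rails outside, and cannot collide.
      attach : ∀ {M N A s} → M′ ⊆ M → N ⊆ F′ → (L : Link s N A Q) →
               Σ[ L′ ∈ Link s M A S ] Attached′ L L′
      attach {M} {N} {A} {s} M′⊆M N⊆F′ L = record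
        { rail = P
        ; within = λ {i} → ∪-⊆ {p = L.rail i} (M′⊆M ∘ F′⊆M′ ∘ N⊆F′ ∘ L.within) (M′⊆M ∘ within)
        ; conn = λ i → conn-∪ (L.conn i) (conn (σ i)) (q∈L i) (q∈σ i) (inj₁ refl)
        ; source = λ i → let x , p , q = L.source i in x , ∪ˡ p , q
        ; sink = λ i → let x , p , q = sink (σ i) in x , ∪ʳ p , q
        ; disj = P-disj }
        , record
        { ⊇rail  = ∪ˡ
        ; inner  = λ {i} x∈ x∈F → [ id , (λ x∈σ → in-L i x∈σ x∈F) ]′ (∪⁻ x∈)
        ; origin = λ {i} x∈ → [ inj₁ ∘ N⊆F′ ∘ L.within , (λ x∈σ → inj₂ (σ i , x∈σ)) ]′ (∪⁻ x∈) }
        where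
        module L = Link L
        hinge : Fin s → Fin n
        hinge i = proj₁ (L.sink i)
        q∈L : ∀ i → hinge i ∈ L.rail i
        q∈L i = proj₁ (proj₂ (L.sink i))
        q∈Q : ∀ i → hinge i ∈ Q
        q∈Q i = proj₂ (proj₂ (L.sink i))
        σ : Fin s → Fin κ
        σ i = proj₁ (proj₂ (sep⁻ used? (q∈Q i)))
        q∈σ : ∀ i → hinge i ∈ rail (σ i)
        q∈σ i = proj₂ (proj₂ (sep⁻ used? (q∈Q i)))
        P : Fin s → Subset n
        P i = L.rail i ∪ rail (σ i)
        in-L : ∀ i {x} → x ∈ rail (σ i) → x ∈ F′ → x ∈ L.rail i
        in-L i x∈σ x∈F = subst (_∈ L.rail i) (once (q∈σ i) x∈σ (N⊆F′ (L.within (q∈L i))) x∈F) (q∈L i)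
        P-disj : ∀ {i j x} → x ∈ P i → x ∈ P j → i ≡ j
        P-disj {i} {j} x∈ x∈′ with ∪⁻ x∈ | ∪⁻ x∈′
        ... | inj₁ x∈L | inj₁ x∈L′ = L.disj x∈L x∈L′
        ... | inj₁ x∈L | inj₂ x∈σ  = L.disj x∈L (in-L j x∈σ (N⊆F′ (L.within x∈L)))
        ... | inj₂ x∈σ | inj₁ x∈L  = L.disj (in-L i x∈σ (N⊆F′ (L.within x∈L))) x∈L
        ... | inj₂ x∈σ | inj₂ x∈σ′ = L.disj (q∈L i)
          (in-L j (subst (λ k → hinge i ∈ rail k) (disj x∈σ x∈σ′) (q∈σ i)) (N⊆F′ (L.within (q∈L i))))

      pull : ∀ {M F s d} → M′ ⊆ M → F ⊆ F′ → Linkable s F′ F Q → o M S F ≤ s + d → Realization U M F a d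
      pull {M} {F} {s} M′⊆M F⊆F′ l ≤s = record
        { κ = s ; rails = proj₁ att
        ; once = λ x∈ y∈ x∈F y∈F → StrictLink.once L (inner x∈ (F⊆F′ x∈F)) (inner y∈ (F⊆F′ y∈F)) x∈F y∈F
        ; deficit = ≤s ; models = models
        ; set∉F = λ x∈ → set∉F x∈ ∘ F⊆F′
        ; set∉rail = λ x∈ x∈i → [ set∉F x∈ , (λ (j , x∈j) → set∉rail x∈ x∈j) ]′ (origin x∈i) }
        where
        L : StrictLink s F′ F Q ∅
        L = plainLink F⊆F′ l
        att : Σ[ L′ ∈ Link s M F S ] Attached′ (StrictLink.link L) L′
        att = attach M′⊆M id (StrictLink.link L)
        open Attached′ (proj₂ att)

    module _ {M F} (M′⊆M : M′ ⊆ M) (F⊆F′ : F ⊆ F′) where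

      abstract

        -- `F` is closed in the graph that still contains `Y`, so closedness is applied to `E ∪ Y`.
        -- Its border vertices lie in `Y`, are dead, or are counted on the way from `F` to the live
        -- vertices.
        cross : ∀ {Y c} → Closed M F → Y ⊆ M → ∣ Y ∣ ≤ c → (∀ {x} → x ∈ M → x ∉ Y → x ∈ M′) → Realization U M F a (c + d′)
        cross {Y} {c} closed Y⊆M Y≤ M─Y⊆ = pull M′⊆M F⊆F′ linkable (≤-trans (m≤n+m∸n (o M S F) (c + d′)) (≤-reflexive (+-comm (c + d′) _)))
          where
          linkable : Linkable (o M S F ∸ (c + d′)) F′ F Q
          linkable E F⊆E E⊆F′ = m≤n+o⇒m∸n≤o (o M S F) (c + d′) (begin
            o M S F                               ≤⟨ closed-≤ closed (∪ˡ ∘ F⊆E) (∪-⊆ (M′⊆M ∘ F′⊆M′ ∘ E⊆F′) Y⊆M) ⟩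
            o M S (E ∪ Y)                         ≤⟨ ⊆∪⇒≤ {p = border M S (E ∪ Y)} (Y ∪ D) (border F′ Q E) sub ⟩
            ∣ Y ∪ D ∣ + o F′ Q E                  ≤⟨ +-monoˡ-≤ _ (≤-trans (∣∪∣≤ Y D) (+-mono-≤ Y≤ D≤)) ⟩
            c + d′ + o F′ Q E                     ∎)
            where
            open ≤-Reasoning
            count : ∀ {z} → z ∈ E → z ∈ W → z ∈ (Y ∪ D) ∪ border F′ Q E
            count z∈E z∈W = [ (λ z∈Q → ∪ʳ (border⁺ z∈E (inj₁ z∈Q))) , ∪ˡ ∘ ∪ʳ ]′ (split z∈W)
            sub : border M S (E ∪ Y) ⊆ (Y ∪ D) ∪ border F′ Q E
            sub {z} z∈ with border⁻ {M} {S} {E ∪ Y} z∈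
            ... | z∈EY , leaves with ∪⁻ z∈EY | leaves
            ... | inj₂ z∈Y | _ = ∪ˡ (∪ˡ z∈Y)
            ... | inj₁ z∈E | inj₁ z∈S = count z∈E (border⁺ (E⊆F′ z∈E) (inj₁ z∈S))
            ... | inj₁ z∈E | inj₂ (y , y∈M , y∉ , e) with y ∈? F′
            ... | yes y∈F′ = ∪ʳ (border⁺ z∈E (inj₂ (y , y∈F′ , y∉ ∘ ∪ˡ , e)))
            ... | no  y∉F′ = count z∈E (border⁺ (E⊆F′ z∈E) (inj₂ (y , M─Y⊆ y∈M (y∉ ∘ ∪ʳ) , y∉F′ , e)))

    module _ {F} (F⊆F′ : F ⊆ F′) (closed : Closed M′ F) where

      -- A dead border vertex outside F is a deficit that F does not see; larger sets gain one by closedness.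
      abstract

        skip : ∀ {x} → x ∈ D → x ∉ F → ∃[ d ] (suc d ≤ d′ × Realization U M′ F a d)
        skip {x} x∈D x∉F = ∣ D ─ ⁅ x ⁆ ∣ , ≤-trans D─x<D D≤ ,
          pull id F⊆F′ linkable (≤-trans (m≤n+m∸n (o M′ S F) ∣ D ─ ⁅ x ⁆ ∣) (≤-reflexive (+-comm ∣ D ─ ⁅ x ⁆ ∣ _)))
          where
          D─x<D : suc ∣ D ─ ⁅ x ⁆ ∣ ≤ ∣ D ∣
          D─x<D = ⊆∧∌⇒< {p = D ─ ⁅ x ⁆} (─⁻ˡ {p = D}) x∈D (λ x∈ → ─⁻ʳ {p = D} x∈ (x∈⁅x⁆ x))
          linkable : Linkable (o M′ S F ∸ ∣ D ─ ⁅ x ⁆ ∣) F′ F Q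
          linkable E F⊆E E⊆F′ = m≤n+o⇒m∸n≤o (o M′ S F) ∣ D ─ ⁅ x ⁆ ∣ bound
            where
            count : ∀ {z} → z ∈ E → z ∈ W → z ∈ (D ∩ E) ∪ border F′ Q E
            count z∈E z∈W = [ (λ z∈Q → ∪ʳ (border⁺ z∈E (inj₁ z∈Q))) , (λ z∈D → ∪ˡ (x∈p∩q⁺ (z∈D , z∈E))) ]′ (split z∈W)
            sub : border M′ S E ⊆ (D ∩ E) ∪ border F′ Q E
            sub {z} z∈ with border⁻ {M′} {S} {E} z∈
            ... | z∈E , inj₁ z∈S = count z∈E (border⁺ (E⊆F′ z∈E) (inj₁ z∈S))
            ... | z∈E , inj₂ (y , y∈M , y∉E , e) with y ∈? F′
            ... | yes y∈F′ = ∪ʳ (border⁺ z∈E (inj₂ (y , y∈F′ , y∉E , e)))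
            ... | no  y∉F′ = count z∈E (border⁺ (E⊆F′ z∈E) (inj₂ (y , y∈M , y∉F′ , e)))
            DE : o M′ S E ≤ ∣ D ∩ E ∣ + o F′ Q E
            DE = ⊆∪⇒≤ {p = border M′ S E} (D ∩ E) (border F′ Q E) sub
            bound : o M′ S F ≤ ∣ D ─ ⁅ x ⁆ ∣ + o F′ Q E
            bound with E ⊆? F
            ... | yes E⊆F = ≤-trans (closed-≤ closed F⊆E (F′⊆M′ ∘ E⊆F′)) (≤-trans DE (+-monoˡ-≤ (o F′ Q E) (⊆⇒≤ {p = D ∩ E} λ z∈ →
              let z∈D , z∈E = x∈p∩q⁻ D E z∈ in ─⁺ z∈D λ z≡x → x∉F (subst (_∈ F) (⁅⁆⁻ z≡x) (E⊆F z∈E)))))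
            ... | no  E⊈F = s≤s⁻¹ (≤-trans (≰⇒> λ E≤ → E⊈F (closed F⊆E (F′⊆M′ ∘ E⊆F′) E≤)) (≤-trans DE (+-monoˡ-≤ (o F′ Q E) D∩E≤)))
              where
              D∩E≤ : ∣ D ∩ E ∣ ≤ suc ∣ D ─ ⁅ x ⁆ ∣
              D∩E≤ = ⊆∪⁅⁆⇒≤ {p = D ∩ E} (D ─ ⁅ x ⁆) x (⊆─∪ ∘ p∩q⊆p D E)

    module Absorb {F} (F⊆F′ : F ⊆ F′) (closed : Closed M′ F) (β : Body c₂ (M′ ─ F)) (X⊆F′ : Body.X β ⊆ F′)
                  (least : ∀ {E} → F ∪ Body.X β ⊆ E → E ⊆ M′ → o M′ S F′ ≤ o M′ S E) (D⊆F : D ⊆ F) (M′⊆U : M′ ⊆ U) where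
      open Body β

      anchor? : ∀ z → Dec (∃[ x ] (x ∈ V T × anchor x ≡ z))
      anchor? z = any? λ x → (x ∈? V T) ×-dec (anchor x ≟ z)

      -- Of the body's set only the anchors are left in `N`, so that no rail can run through the
      -- branches elsewhere.
      R N A : Subset n
      R = sep anchor?
      N = F′ ─ (X ─ R)
      A = F ∪ R

      anchor∈R : ∀ {x} → x ∈ V T → anchor x ∈ R
      anchor∈R {x} x∈ = sep⁺ anchor? (x , x∈ , refl)

      X∌F : ∀ {z} → z ∈ X → z ∉ F
      X∌F = ─⁻ʳ {p = M′} ∘ X⊆H

      R⊆X : R ⊆ X
      R⊆X z∈ with sep⁻ anchor? z∈
      ... | x , x∈ , refl = b⊆X x∈ (a∈b x∈)

      N⊆F′ : N ⊆ F′
      N⊆F′ = ─⁻ˡ {p = F′}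

      A⊆N : A ⊆ N
      A⊆N z∈ with ∪⁻ z∈
      ... | inj₁ z∈F = ─⁺ (F⊆F′ z∈F) λ z∈X → X∌F (─⁻ˡ {p = X} z∈X) z∈F
      ... | inj₂ z∈R = ─⁺ (X⊆F′ (R⊆X z∈R)) λ z∈X → ─⁻ʳ {p = X} z∈X z∈R

      X∩N⊆R : ∀ {z} → z ∈ X → z ∈ N → z ∈ R
      X∩N⊆R {z} z∈X z∈N = decidable-stable (z ∈? R) λ z∉R → ─⁻ʳ {p = F′} z∈N (─⁺ z∈X z∉R)

      abstract
        R≤ : ∣ R ∣ ≤ t
        R≤ = ≤-trans (∣∣-injection R (V T) (λ z x → anchor x ≡ z)
          (λ z∈ → let x , x∈ , eq = sep⁻ anchor? z∈ in x , x∈ , eq) (λ { refl refl → refl })) (≤-reflexive (sym (size≡ γ)))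

        -- The spokes leave E either inside N₀ or through a live border vertex: the dead ones lie in F, which spokes avoid.
        spokes-≤o : ∀ {N₀ E} → (∀ {z} → z ∈ F′ → z ∉ F → z ∉ X → z ∈ N₀) → R ⊆ E → E ⊆ F′ → ∣ R ∣ ≤ o N₀ Q E
        spokes-≤o {N₀} {E} ⊆N₀ R⊆E E⊆F′ = ∣∣-injection R (border N₀ Q E) (λ z c → ∃[ x ] (x ∈ V T × anchor x ≡ z × c ∈ spoke x)) meets
          λ { (x , x∈ , refl , c∈) (y , y∈ , refl , c∈′) → cong anchor (s-disj x∈ y∈ c∈ c∈′) }
          where
          live : ∀ {x z} → z ∈ spoke x → z ∈ W → z ∈ Q
          live {x} z∈x z∈W = [ id , (λ z∈D → ⊥-elim (─⁻ʳ {p = M′} (s⊆H x z∈x) (D⊆F z∈D))) ]′ (split z∈W)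
          leave : ∀ {x} → x ∈ V T → ∃[ c ] (c ∈ border N₀ Q E × c ∈ spoke x)
          leave {x} x∈ with s-sink x
          ... | s , s∈x , s∈S with s ∈? E
          ... | yes s∈E = s , border⁺ s∈E (inj₁ (live s∈x (border⁺ (E⊆F′ s∈E) (inj₁ s∈S)))) , s∈x
          ... | no  s∉E with exit E (s-conn x (a∈s x∈) s∈x) (R⊆E (anchor∈R x∈)) s∉E
          ... | u , v , u~v , u∈x , v∈x , u∈E , v∉E with v ∈? F′
          ... | yes v∈F′ = u , border⁺ u∈E (inj₂ (v , ⊆N₀ v∈F′ (─⁻ʳ {p = M′} (s⊆H x v∈x)) v∉X , v∉E , u~v)) , u∈x
            where
            v∉X : v ∉ X
            v∉X v∈X = v∉E (R⊆E (subst (_∈ R) (sym (a-only x∈ v∈x v∈X)) (anchor∈R x∈)))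
          ... | no  v∉F′ = u , border⁺ u∈E (inj₁ (live u∈x (border⁺ (E⊆F′ u∈E) (inj₂ (v , ─⁻ˡ {p = M′} (s⊆H x v∈x) , v∉F′ , u~v))))) , u∈x
          meets : ∀ {z} → z ∈ R → ∃[ c ] (c ∈ border N₀ Q E × ∃[ x ] (x ∈ V T × anchor x ≡ z × c ∈ spoke x))
          meets z∈ with sep⁻ anchor? z∈
          ... | x , x∈ , eq = let c , c∈ , c∈x = leave x∈ in c , c∈ , x , x∈ , eq , c∈x

      -- The first term bounds the loss of rails; the maximum ensures that there are enough to cover
      -- all anchors.
      s : ℕ
      s = (o M′ S F′ ∸ (c₂ + d′)) ⊔ ∣ R ∣

      abstract
        -- For the first term of `s`, put `X` back: `F ∪ X` lies in `E ∪ X`, so `least` applies, at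
        -- the cost of the body's border and the dead vertices. The second term is carried by the
        -- spokes.
        linkable : Linkable s N A Q
        linkable E A⊆E E⊆N = ⊔-lub (m≤n+o⇒m∸n≤o (o M′ S F′) (c₂ + d′) (begin
            o M′ S F′                       ≤⟨ least (∪-⊆ (∪ˡ ∘ A⊆E ∘ ∪ˡ) ∪ʳ) (F′⊆M′ ∘ EX⊆F′) ⟩
            o M′ S (E ∪ X)                  ≤⟨ ⊆∪⇒≤ {p = border M′ S (E ∪ X)} (border (M′ ─ F) S X ∪ D) (border N Q E) sub ⟩
            ∣ border (M′ ─ F) S X ∪ D ∣ + o N Q E
                                            ≤⟨ +-monoˡ-≤ _ (≤-trans (∣∪∣≤ (border (M′ ─ F) S X) D) (+-mono-≤ border≤ D≤)) ⟩
            c₂ + d′ + o N Q E               ∎))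
          (spokes-≤o (λ z∈F′ _ z∉X → ─⁺ z∈F′ (z∉X ∘ ─⁻ˡ {p = X})) (A⊆E ∘ ∪ʳ) (N⊆F′ ∘ E⊆N))
          where
          open ≤-Reasoning
          EX⊆F′ : E ∪ X ⊆ F′
          EX⊆F′ = ∪-⊆ (N⊆F′ ∘ E⊆N) X⊆F′
          count : ∀ {z} → z ∈ E → z ∈ W → z ∈ (border (M′ ─ F) S X ∪ D) ∪ border N Q E
          count z∈E z∈W = [ (λ z∈Q → ∪ʳ (border⁺ z∈E (inj₁ z∈Q))) , ∪ˡ ∘ ∪ʳ ]′ (split z∈W)
          sub : border M′ S (E ∪ X) ⊆ (border (M′ ─ F) S X ∪ D) ∪ border N Q E
          sub {z} z∈ with border⁻ {M′} {S} {E ∪ X} z∈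
          ... | z∈EX , leaves with ∪⁻ z∈EX | leaves
          ... | inj₂ z∈X | inj₁ z∈S = ∪ˡ (∪ˡ (border⁺ z∈X (inj₁ z∈S)))
          ... | inj₂ z∈X | inj₂ (y , y∈M , y∉ , e) = ∪ˡ (∪ˡ (border⁺ z∈X (inj₂ (y , ─⁺ y∈M (y∉ ∘ ∪ˡ ∘ A⊆E ∘ ∪ˡ) , y∉ ∘ ∪ʳ , e))))
          ... | inj₁ z∈E | inj₁ z∈S = count z∈E (border⁺ (N⊆F′ (E⊆N z∈E)) (inj₁ z∈S))
          ... | inj₁ z∈E | inj₂ (y , y∈M , y∉ , e) with y ∈? F′
          ... | yes y∈F′ = ∪ʳ (border⁺ z∈E (inj₂ (y , ─⁺ y∈F′ (y∉ ∘ ∪ʳ ∘ ─⁻ˡ {p = X}) , y∉ ∘ ∪ˡ , e)))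
          ... | no  y∉F′ = count z∈E (border⁺ (N⊆F′ (E⊆N z∈E)) (inj₂ (y , y∈M , y∉F′ , e)))

        strict : StrictLink s N A Q R
        strict = strictLink R A⊆N ∪ʳ (m≤n⊔m _ ∣ R ∣)
          -- Goodness of `R` concerns `N` without the rest of `A`; that rest lies in `F`, which the
          -- spokes avoid anyway.
          (λ E R⊆E E⊆ → spokes-≤o (λ z∈F′ z∉F z∉X → ─⁺ (─⁺ z∈F′ (z∉X ∘ ─⁻ˡ {p = X}))
            (λ z∈ → [ z∉F , z∉X ∘ R⊆X ]′ (∪⁻ (─⁻ˡ {p = A} z∈)))) R⊆E (N⊆F′ ∘ ─⁻ˡ {p = N} ∘ E⊆))
          linkable

        att : Σ[ L ∈ Link s M′ A S ] Attached′ (StrictLink.link strict) L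
        att = attach id N⊆F′ (StrictLink.link strict)

      open Attached′ (proj₂ att)
      open Link (proj₁ att) using () renaming (rail to ray; within to ray⊆; conn to ray-conn; source to ray-source; sink to ray-sink; disj to ray-disj)

      ray-once : ∀ {i x y} → x ∈ ray i → y ∈ ray i → x ∈ A → y ∈ A → x ≡ y
      ray-once x∈ y∈ x∈A y∈A = StrictLink.once strict (inner x∈ (N⊆F′ (A⊆N x∈A))) (inner y∈ (N⊆F′ (A⊆N y∈A))) x∈A y∈A

      ray∩X : ∀ {i z} → z ∈ ray i → z ∈ X → z ∈ R
      ray∩X z∈ z∈X = X∩N⊆R z∈X (StrictLink.within strict (inner z∈ (X⊆F′ z∈X)))

      -- The rail through the anchor of `x`, described without choosing its index, so that `arm` is
      -- defined for all `x`.
      arm? : ∀ x z → Dec (∃[ i ] (anchor x ∈ ray i × z ∈ ray i))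
      arm? x z = any? λ i → (anchor x ∈? ray i) ×-dec (z ∈? ray i)

      arm limb : Fin m → Subset n
      arm x = sep (arm? x)
      limb x = branch x ∪ arm x

      anchor∈arm : ∀ {x} → x ∈ V T → anchor x ∈ arm x
      anchor∈arm {x} x∈ = let i , a∈ = StrictLink.covers strict (anchor∈R x∈) in sep⁺ (arm? x) (i , ⊇rail a∈ , ⊇rail a∈)

      arm-conn : ∀ x → Conn (arm x)
      arm-conn x u∈ v∈ with sep⁻ (arm? x) u∈ | sep⁻ (arm? x) v∈
      ... | i , a∈ , u∈i | j , a∈′ , v∈j with ray-disj a∈ a∈′
      ... | refl = path-mono (λ z∈ → sep⁺ (arm? x) (i , a∈ , z∈)) (ray-conn i u∈i v∈j)

      arm-only : ∀ {x z} → x ∈ V T → z ∈ arm x → z ∈ A → z ≡ anchor x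
      arm-only {x} x∈ z∈ z∈A with sep⁻ (arm? x) z∈
      ... | i , a∈ , z∈i = ray-once z∈i a∈ z∈A (∪ʳ (anchor∈R x∈))

      arm∩branch : ∀ {x y z} → x ∈ V T → y ∈ V T → z ∈ branch x → z ∈ arm y → x ≡ y
      arm∩branch {y = y} x∈ y∈ z∈b z∈a with sep⁻ (arm? y) z∈a
      ... | i , a∈ , z∈i with arm-only y∈ z∈a (∪ʳ (ray∩X z∈i (b⊆X x∈ z∈b)))
      ... | refl = b-disj x∈ y∈ z∈b (a∈b y∈)

      limb-disj : ∀ {x y z} → x ∈ V T → y ∈ V T → z ∈ limb x → z ∈ limb y → x ≡ y
      limb-disj {x} {y} x∈ y∈ z∈x z∈y with ∪⁻ z∈x | ∪⁻ z∈y
      ... | inj₁ p | inj₁ q = b-disj x∈ y∈ p q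
      ... | inj₁ p | inj₂ q = arm∩branch x∈ y∈ p q
      ... | inj₂ p | inj₁ q = sym (arm∩branch y∈ x∈ q p)
      ... | inj₂ p | inj₂ q with sep⁻ (arm? x) p | sep⁻ (arm? y) q
      -- Arms with a common vertex are the same rail, which meets `A` once, so the two anchors
      -- coincide.
      ... | i , a∈ , z∈i | j , a∈′ , z∈j = b-disj x∈ y∈ (a∈b x∈) (subst (_∈ branch y)
        (ray-once a∈′ (subst (λ k → anchor x ∈ ray k) (ray-disj z∈i z∈j) a∈) (∪ʳ (anchor∈R y∈)) (∪ʳ (anchor∈R x∈))) (a∈b y∈))

      limb? : ∀ z → Dec (∃[ x ] (x ∈ V T × z ∈ limb x))
      limb? z = any? λ x → (x ∈? V T) ×-dec (z ∈? limb x)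

      new : Subset n
      new = sep limb?

      new-model : HasModel new
      new-model = limb , record
        { within = λ x∈ z∈ → sep⁺ limb? (_ , x∈ , z∈)
        ; conn   = λ {x} x∈ → conn-∪ (b-conn x∈) (arm-conn x) (a∈b x∈) (anchor∈arm x∈) (inj₁ refl)
        ; rooted = λ {x} x∈ → let i , a∈ , _ = sep⁻ (arm? x) (anchor∈arm x∈) ; s , s∈ , s∈S = ray-sink i in s , ∪ʳ (sep⁺ (arm? x) (i , a∈ , s∈)) , s∈S
        ; disj   = limb-disj
        ; adj    = λ e → adj-mono ∪ˡ ∪ˡ (b-adj e) }

      new-cases : ∀ {z} → z ∈ new → z ∈ X ⊎ ∃[ x ] (x ∈ V T × z ∈ arm x)
      new-cases z∈ with sep⁻ limb? z∈
      ... | x , x∈ , z∈x = [ inj₁ ∘ b⊆X x∈ , (λ z∈a → inj₂ (x , x∈ , z∈a)) ]′ (∪⁻ z∈x)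

      new∌F : ∀ {z} → z ∈ new → z ∉ F
      new∌F z∈ z∈F with new-cases z∈
      ... | inj₁ z∈X = X∌F z∈X z∈F
      ... | inj₂ (x , x∈ , z∈a) = X∌F (b⊆X x∈ (a∈b x∈)) (subst (_∈ F) (arm-only x∈ z∈a (∪ˡ z∈F)) z∈F)

      keep? : ∀ i → Dec (∃[ y ] (y ∈ ray i × y ∈ F))
      keep? i = any? λ y → (y ∈? ray i) ×-dec (y ∈? F)

      keep : Subset s
      keep = sep keep?

      new∌keep : ∀ {z i} → z ∈ new → i ∈ keep → z ∉ ray i
      new∌keep {z} {i} z∈ i∈ z∈i with sep⁻ keep? i∈
      ... | y , y∈i , y∈F with new-cases z∈
      ... | inj₁ z∈X = X∌F z∈X (subst (_∈ F) (ray-once y∈i z∈i (∪ˡ y∈F) (∪ʳ (ray∩X z∈i z∈X))) y∈F)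
      ... | inj₂ (x , x∈ , z∈a) with sep⁻ (arm? x) z∈a
      ... | j , a∈ , z∈j = X∌F (b⊆X x∈ (a∈b x∈)) (subst (_∈ F)
        (ray-once y∈i (subst (λ k → anchor x ∈ ray k) (ray-disj z∈j z∈i) a∈) (∪ˡ y∈F) (∪ʳ (anchor∈R x∈))) y∈F)

      old∌ray : ∀ {i j z} → z ∈ set i → z ∉ ray j
      old∌ray z∈ z∈j = [ set∉F z∈ , (λ (k , z∈k) → set∉rail z∈ z∈k) ]′ (origin z∈j)

      old∌new : ∀ {i z} → z ∈ set i → z ∉ new
      old∌new z∈ z∈new with new-cases z∈new
      ... | inj₁ z∈X = set∉F z∈ (X⊆F′ z∈X)
      ... | inj₂ (x , x∈ , z∈a) = let i , _ , z∈i = sep⁻ (arm? x) z∈a in old∌ray z∈ z∈i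

      new⊆U : new ⊆ U
      new⊆U z∈ with new-cases z∈
      ... | inj₁ z∈X = M′⊆U (F′⊆M′ (X⊆F′ z∈X))
      ... | inj₂ (x , x∈ , z∈a) = let i , _ , z∈i = sep⁻ (arm? x) z∈a in M′⊆U (ray⊆ z∈i)

      -- A rail that misses `F` starts at an anchor, and there are at most `t` anchors.
      s≤ : s ≤ ∣ keep ∣ + t
      s≤ = ≤-trans (m≤n+m∸n s ∣ keep ∣) (+-monoʳ-≤ ∣ keep ∣ (begin
        s ∸ ∣ keep ∣  ≡⟨ ∣∁p∣≡n∸∣p∣ keep ⟨
        ∣ ∁ keep ∣    ≤⟨ ∣∣-injection (∁ keep) R (λ i z → z ∈ ray i) rest ray-disj ⟩
        ∣ R ∣         ≤⟨ R≤ ⟩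
        t             ∎))
        where
        open ≤-Reasoning
        rest : ∀ {i} → i ∈ ∁ keep → ∃[ z ] (z ∈ R × z ∈ ray i)
        rest {i} i∈ with ray-source i
        ... | z , z∈i , z∈A = z , [ (λ z∈F → ⊥-elim (x∈∁p⇒x∉p i∈ (sep⁺ keep? (z , z∈i , z∈F)))) , id ]′ (∪⁻ z∈A) , z∈i

      -- Rails that meet `F` contain no anchor and survive; those through anchors become arms of the
      -- new model. The loss is `t` for the arms, `c₂` for the border of the body and `d′` for the
      -- vertices already dead.
      absorb : Realization U M′ F (suc a) (t + (c₂ + d′))
      absorb = record
        { κ = ∣ keep ∣
        ; rails = record
          { rail = ray ∘ f ; within = ray⊆ ; conn = ray-conn ∘ f
          ; source = λ i → let y , y∈i , y∈F = sep⁻ keep? (f∈ i) in y , y∈i , y∈F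
          ; sink = ray-sink ∘ f ; disj = λ x∈ y∈ → f-inj (ray-disj x∈ y∈) }
        ; once = λ x∈ y∈ x∈F y∈F → ray-once x∈ y∈ (∪ˡ x∈F) (∪ˡ y∈F)
        ; deficit = begin
            o M′ S F                       ≤⟨ closed-≤ closed F⊆F′ F′⊆M′ ⟩
            o M′ S F′                      ≤⟨ m≤n+m∸n (o M′ S F′) (c₂ + d′) ⟩
            c₂ + d′ + (o M′ S F′ ∸ (c₂ + d′)) ≤⟨ +-monoʳ-≤ (c₂ + d′) (≤-trans (m≤m⊔n _ ∣ R ∣) s≤) ⟩
            c₂ + d′ + (∣ keep ∣ + t)       ≡⟨ +-comm (c₂ + d′) _ ⟩
            ∣ keep ∣ + t + (c₂ + d′)       ≡⟨ +-assoc ∣ keep ∣ t _ ⟩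
            ∣ keep ∣ + (t + (c₂ + d′))     ∎
        ; models = record
          { set = set′
          ; set⊆ = λ { {zero} → new⊆U ; {suc i} → set⊆ }
          ; has = λ { zero → new-model ; (suc i) → has i }
          ; apart = λ { {zero} {zero} _ _ → refl ; {zero} {suc j} x∈ y∈ → ⊥-elim (old∌new y∈ x∈)
                      ; {suc i} {zero} x∈ y∈ → ⊥-elim (old∌new x∈ y∈) ; {suc i} {suc j} x∈ y∈ → cong suc (apart x∈ y∈) } }
        ; set∉F = λ { {zero} → new∌F ; {suc i} x∈ → set∉F x∈ ∘ F⊆F′ }
        ; set∉rail = λ { {zero} {j} x∈ → new∌keep x∈ (f∈ j) ; {suc i} → old∌ray } }
        where
        open ≤-Reasoning
        f = proj₁ (enumerate keep)
        f∈ = proj₁ (proj₂ (enumerate keep))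
        f-inj = proj₂ (proj₂ (enumerate keep))
        set′ : Fin (suc a) → Subset n
        set′ zero    = new
        set′ (suc i) = set i

-- The chain of layers and its length

module Layers {n} (_~_ : Rel (Fin n) 0ℓ) (_~?_ : Decidable _~_) (~-sym : Symmetric _~_) (S : Subset n)
              {m} (T : Graph m) (tree : IsTree T) (U : Subset n) where
  open Realize _~_ _~?_ ~-sym S T tree public

  -- A new model costs t + c₂ dead vertices and the layer it comes from.
  c₃ : ℕ
  c₃ = suc (t + c₂)

  data Chain : (Z F : Subset n) (b ρ : ℕ) → Set where
    base   : ∀ {F} → Closure (U ─ ∅) ∅ F → Chain ∅ F 0 0
    body   : ∀ {Z F F′ b ρ} → Chain Z F b ρ → (β : Body c₂ ((U ─ Z) ─ F)) →
             Closure (U ─ Z) (F ∪ Body.X β) F′ → Chain Z F′ (suc b) ρ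
    pocket : ∀ {Z F F′ b ρ} → Chain Z F b ρ → (π : Pocket c₁ ((U ─ Z) ─ F)) →
             Closure (U ─ (Z ∪ Pocket.Y π)) F F′ → Chain (Z ∪ Pocket.Y π) F′ b (suc ρ)

  chain-⊆ : ∀ {Z F b ρ} → Chain Z F b ρ → F ⊆ U ─ Z
  chain-⊆ (base (_ , F⊆ , _))       = F⊆
  chain-⊆ (body _ _ (_ , F⊆ , _))   = F⊆
  chain-⊆ (pocket _ _ (_ , F⊆ , _)) = F⊆

  chain-closed : ∀ {Z F b ρ} → Chain Z F b ρ → Closed (U ─ Z) F
  chain-closed (base (_ , _ , closed , _))       = closed
  chain-closed (body _ _ (_ , _ , closed , _))   = closed
  chain-closed (pocket _ _ (_ , _ , closed , _)) = closed

  shrink : ∀ {Z Y x} → x ∈ U ─ (Z ∪ Y) → x ∈ U ─ Z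
  shrink x∈ = ─⁺ (─⁻ˡ {p = U} x∈) (─⁻ʳ {p = U} x∈ ∘ ∪ˡ)

  outside-Y : ∀ {Z Y x} → x ∈ U ─ Z → x ∉ Y → x ∈ U ─ (Z ∪ Y)
  outside-Y x∈ x∉Y = ─⁺ (─⁻ˡ {p = U} x∈) ([ ─⁻ʳ {p = U} x∈ , x∉Y ]′ ∘ ∪⁻)

  pocket-F⊆ : ∀ {Z F} (π : Pocket c₁ ((U ─ Z) ─ F)) → F ⊆ U ─ Z → F ⊆ U ─ (Z ∪ Pocket.Y π)
  pocket-F⊆ {Z} π F⊆ x∈F = outside-Y {Z} (F⊆ x∈F) λ x∈Y → ─⁻ʳ {p = U ─ Z} (Pocket.Y⊆H π x∈Y) x∈F

  -- Closing does not increase the border. The border of a body may be taken in the graph without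
  -- `F`, because an edge into `F` is no exit from `F ∪ X`.
  chain-o : ∀ {Z F b ρ} → Chain Z F b ρ → o (U ─ Z) S F ≤ c₂ * b
  chain-o (base (_ , _ , _ , least)) = ≤-trans (least id (⊥-elim ∘ ∉⊥)) (≤-trans (o≤ (U ─ ∅) S ∅) (≤-trans (≤-reflexive (∣⊥∣≡0 n)) z≤n))
  chain-o (body {Z} {F} {F′} {b} χ β (FX⊆F′ , F′⊆ , _ , least)) = begin
    o (U ─ Z) S F′                            ≤⟨ least id (F′⊆ ∘ FX⊆F′) ⟩
    o (U ─ Z) S (F ∪ X)                       ≤⟨ ⊆∪⇒≤ {p = border (U ─ Z) S (F ∪ X)} (border (U ─ Z) S F) (border ((U ─ Z) ─ F) S X) sub ⟩
    o (U ─ Z) S F + o ((U ─ Z) ─ F) S X       ≤⟨ +-mono-≤ (chain-o χ) border≤ ⟩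
    c₂ * b + c₂                               ≡⟨ +-comm (c₂ * b) c₂ ⟩
    c₂ + c₂ * b                               ≡⟨ *-suc c₂ b ⟨
    c₂ * suc b                                ∎
    where
    open ≤-Reasoning
    open Body β
    sub : border (U ─ Z) S (F ∪ X) ⊆ border (U ─ Z) S F ∪ border ((U ─ Z) ─ F) S X
    sub z∈ with border⁻ {U ─ Z} {S} {F ∪ X} z∈
    ... | z∈FX , leaves with ∪⁻ z∈FX | leaves
    ... | inj₁ z∈F | inj₁ z∈S = ∪ˡ (border⁺ z∈F (inj₁ z∈S))
    ... | inj₁ z∈F | inj₂ (y , y∈ , y∉ , e) = ∪ˡ (border⁺ z∈F (inj₂ (y , y∈ , y∉ ∘ ∪ˡ , e)))
    ... | inj₂ z∈X | inj₁ z∈S = ∪ʳ (border⁺ z∈X (inj₁ z∈S))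
    ... | inj₂ z∈X | inj₂ (y , y∈ , y∉ , e) = ∪ʳ (border⁺ z∈X (inj₂ (y , ─⁺ y∈ (y∉ ∘ ∪ˡ) , y∉ ∘ ∪ʳ , e)))
  chain-o (pocket {Z} {F} {F′} χ π (_ , _ , _ , least)) =
    ≤-trans (least id (pocket-F⊆ π (chain-⊆ χ))) (≤-trans (⊆⇒≤ {p = border (U ─ (Z ∪ Pocket.Y π)) S F} sub) (chain-o χ))
    where
    sub : border (U ─ (Z ∪ Pocket.Y π)) S F ⊆ border (U ─ Z) S F
    sub z∈ with border⁻ {U ─ (Z ∪ Pocket.Y π)} {S} {F} z∈
    ... | z∈F , inj₁ z∈S = border⁺ z∈F (inj₁ z∈S)
    ... | z∈F , inj₂ (y , y∈ , y∉ , e) = border⁺ z∈F (inj₂ (y , shrink {Z} y∈ , y∉ , e))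

  chain-Z : ∀ {Z F b ρ} → Chain Z F b ρ → Z ⊆ U × ∣ Z ∣ ≤ c₁ * ρ
  chain-Z (base _)     = ⊥-elim ∘ ∉⊥ , ≤-trans (≤-reflexive (∣⊥∣≡0 n)) z≤n
  chain-Z (body χ _ _) = chain-Z χ
  chain-Z (pocket {Z} {F} {ρ = ρ} χ π _) =
    ∪-⊆ (proj₁ (chain-Z χ)) (─⁻ˡ {p = U} ∘ ─⁻ˡ {p = U ─ Z} ∘ Y⊆H) , (begin
      ∣ Z ∪ Y ∣       ≤⟨ ∣∪∣≤ Z Y ⟩
      ∣ Z ∣ + ∣ Y ∣   ≤⟨ +-mono-≤ (proj₂ (chain-Z χ)) ∣Y∣≤b ⟩
      c₁ * ρ + c₁     ≡⟨ +-comm (c₁ * ρ) c₁ ⟩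
      c₁ + c₁ * ρ     ≡⟨ *-suc c₁ ρ ⟨
      c₁ * suc ρ      ∎)
    where
    open ≤-Reasoning
    open Pocket π

  -- A connected set with a model that lies beyond a pocket (A , Y) cannot meet A: it would lie in A ∖ Y
  -- or leave A through Y.
  chain-models : ∀ {Z F b ρ} → Chain Z F b ρ →
    Σ[ 𝓜 ∈ Models ρ U ] (∀ {W} → W ⊆ (U ─ Z) ─ F → Conn W → HasModel W → ∀ {i x} → x ∈ Models.set 𝓜 i → x ∉ W)
  chain-models (base _) = record { set = λ () ; set⊆ = λ {} ; has = λ () ; apart = λ {} } , λ _ _ _ {}
  chain-models (body {Z} {F} χ _ (FX⊆F′ , _)) =
    let 𝓜 , sep = chain-models χ in 𝓜 , λ W⊆ → sep λ x∈ → ─⁺ (─⁻ˡ {p = U ─ Z} (W⊆ x∈)) (─⁻ʳ {p = U ─ Z} (W⊆ x∈) ∘ FX⊆F′ ∘ ∪ˡ)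
  chain-models (pocket {Z} {F} {F′} {b} {ρ} χ π (F⊆F′ , _)) with chain-models χ | support (Pocket.has π)
  ... | 𝓜 , away | W₀ , W₀⊆A , cW₀ , hasW₀ , _ = record { set = set′ ; set⊆ = λ {i} → set′⊆ i ; has = λ { zero → hasW₀ ; (suc i) → has i }
      ; apart = λ {i} {j} → apart′ i j } , λ {W} W⊆ cW hasW {i} → away′ W⊆ cW hasW i
    where
    open Models 𝓜
    open Pocket π using (A; Y; A⊆H; Y⊆H; ∂A⊆Y; hasn't)
    set′ : Fin (suc ρ) → Subset n
    set′ zero    = W₀
    set′ (suc i) = set i
    set′⊆ : ∀ i → set′ i ⊆ U
    set′⊆ zero    = ─⁻ˡ {p = U} ∘ ─⁻ˡ {p = U ─ Z} ∘ A⊆H ∘ W₀⊆A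
    set′⊆ (suc i) = set⊆
    W₀-away : ∀ {i x} → x ∈ set i → x ∉ W₀
    W₀-away = away (A⊆H ∘ W₀⊆A) cW₀ hasW₀
    apart′ : ∀ i j {x} → x ∈ set′ i → x ∈ set′ j → i ≡ j
    apart′ zero    zero    _  _  = refl
    apart′ zero    (suc j) x∈ y∈ = ⊥-elim (W₀-away y∈ x∈)
    apart′ (suc i) zero    x∈ y∈ = ⊥-elim (W₀-away x∈ y∈)
    apart′ (suc i) (suc j) x∈ y∈ = cong suc (apart x∈ y∈)
    away′ : ∀ {W} → W ⊆ (U ─ (Z ∪ Y)) ─ F′ → Conn W → HasModel W → ∀ i {x} → x ∈ set′ i → x ∉ W
    away′ {W} W⊆ cW hasW = λ { zero x∈ x∈W → beyond (W₀⊆A x∈) x∈W ; (suc i) → away W⊆H cW hasW }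
      where
      W⊆H : W ⊆ (U ─ Z) ─ F
      W⊆H x∈ = ─⁺ (shrink {Z} (─⁻ˡ {p = U ─ (Z ∪ Y)} (W⊆ x∈))) (─⁻ʳ {p = U ─ (Z ∪ Y)} (W⊆ x∈) ∘ F⊆F′)
      W∌Y : ∀ {x} → x ∈ W → x ∉ Y
      W∌Y x∈ = ─⁻ʳ {p = U} (─⁻ˡ {p = U ─ (Z ∪ Y)} (W⊆ x∈)) ∘ ∪ʳ
      beyond : ∀ {x} → x ∈ A → x ∉ W
      beyond {x} x∈A x∈W with W ⊆? A
      ... | yes W⊆A = hasn't (hasModel-mono (λ z∈ → ─⁺ (W⊆A z∈) (W∌Y z∈)) hasW)
      ... | no  W⊈A with ⊈⇒∃ W⊈A
      ... | y , y∈W , y∉A with exit A (cW x∈W y∈W) x∈A y∉A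
      ... | a , b , a~b , a∈W , b∈W , a∈A , b∉A = W∌Y a∈W (∂A⊆Y (∂⁺ a∈A (W⊆H b∈W) b∉A a~b))

  -- `p` and `r` count the bodies and pockets already passed. Rerouting at a body raises `p` by one
  -- and lowers `d` by at least one. Absorbing a body raises `p + d` by at most `c₃`, paid for by
  -- the new model; a pocket raises `d` by `c₁`, paid for by `r`. At the base all bodies have been
  -- counted in `p`.
  unwind : ∀ {Z F b ρ a d} p r → Chain Z F b ρ → Realization U (U ─ Z) F a d → p + d ≤ c₃ * a + c₁ * r →
           ∃[ a′ ] (Models a′ U × b + p ≤ c₃ * a′ + c₁ * (ρ + r))
  unwind {a = a} p r (base _) R ≤p = a , Realization.models R , ≤-trans (m≤m+n p _) ≤p
  unwind {a = a} {d} p r (body {Z} {F} {F′} {b} χ β (FX⊆F′ , F′⊆ , _ , least)) R ≤p with Inward.D F′⊆ R ⊆? F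
  ... | no D⊈F = let x , x∈D , x∉F = ⊈⇒∃ D⊈F
                     d′ , d′<d , R′ = Inward.skip F′⊆ R (FX⊆F′ ∘ ∪ˡ) (chain-closed χ) x∈D x∉F
                     a′ , 𝓜 , ≤b = unwind (suc p) r χ R′ (≤-trans (≤-reflexive (sym (+-suc p d′))) (≤-trans (+-monoʳ-≤ p d′<d) ≤p))
                 in a′ , 𝓜 , ≤-trans (≤-reflexive (sym (+-suc b p))) ≤b
  ... | yes D⊆F = let R′ = Inward.Absorb.absorb F′⊆ R (FX⊆F′ ∘ ∪ˡ) (chain-closed χ) β (FX⊆F′ ∘ ∪ʳ) least D⊆F (─⁻ˡ {p = U})
                      a′ , 𝓜 , ≤b = unwind (suc p) r χ R′ budget
                  in a′ , 𝓜 , ≤-trans (≤-reflexive (sym (+-suc b p))) ≤b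
    where
    open ≤-Reasoning
    budget : suc p + (t + (c₂ + d)) ≤ c₃ * suc a + c₁ * r
    budget = begin
      suc p + (t + (c₂ + d))         ≡⟨ solve 4 (λ p t c d → con 1 :+ p :+ (t :+ (c :+ d)) := con 1 :+ (t :+ c) :+ (p :+ d)) refl p t c₂ d ⟩
      c₃ + (p + d)                   ≤⟨ +-monoʳ-≤ c₃ ≤p ⟩
      c₃ + (c₃ * a + c₁ * r)         ≡⟨ +-assoc c₃ (c₃ * a) (c₁ * r) ⟨
      c₃ + c₃ * a + c₁ * r           ≡⟨ cong (_+ c₁ * r) (*-suc c₃ a) ⟨
      c₃ * suc a + c₁ * r            ∎
  unwind {a = a} {d} p r (pocket {Z} {F} {F′} {b} {ρ} χ π (F⊆F′ , F′⊆ , _)) R ≤p =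
    let a′ , 𝓜 , ≤b = unwind p (suc r) χ R′ budget in a′ , 𝓜 , ≤-trans ≤b (≤-reflexive (cong (λ k → c₃ * a′ + c₁ * k) (+-suc ρ r)))
    where
    open ≤-Reasoning
    open Pocket π
    R′ : Realization U (U ─ Z) F a (c₁ + d)
    R′ = Inward.cross F′⊆ R (shrink {Z}) F⊆F′ (chain-closed χ) (─⁻ˡ {p = U ─ Z} ∘ Y⊆H) ∣Y∣≤b (outside-Y {Z})
    budget : p + (c₁ + d) ≤ c₃ * a + c₁ * suc r
    budget = begin
      p + (c₁ + d)                   ≡⟨ solve 3 (λ p c d → p :+ (c :+ d) := c :+ (p :+ d)) refl p c₁ d ⟩
      c₁ + (p + d)                   ≤⟨ +-monoʳ-≤ c₁ ≤p ⟩
      c₁ + (c₃ * a + c₁ * r)         ≡⟨ solve 3 (λ c x y → c :+ (x :+ y) := x :+ (c :+ y)) refl c₁ (c₃ * a) (c₁ * r) ⟩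
      c₃ * a + (c₁ + c₁ * r)         ≡⟨ cong (c₃ * a +_) (*-suc c₁ r) ⟨
      c₃ * a + c₁ * suc r            ∎

  Final : Set
  Final = ∃[ Z ] ∃[ F ] ∃[ b ] ∃[ ρ ] (Chain Z F b ρ × ¬ HasModel ((U ─ Z) ─ F))

  -- Each layer shrinks the rest of the graph: the `Y` of a pocket is nonempty, since it destroys a
  -- model, and the `X` of a body contains anchors.
  run : ∀ f {Z F b ρ} → ∣ (U ─ Z) ─ F ∣ ≤ f → Chain Z F b ρ → Final
  run f {Z} {F} ≤f χ with hasModel? ((U ─ Z) ─ F)
  ... | no  none = _ , _ , _ , _ , χ , none
  ... | yes has with dichotomy has
  ... | inj₁ π = next f ≤f
    where
    open Pocket π using (Y; Y⊆H; A; hasn't)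
    cl : ∃[ F′ ] Closure (U ─ (Z ∪ Y)) F F′
    cl = closure (pocket-F⊆ π (chain-⊆ χ))
    Y≠∅ : ∃[ y ] y ∈ Y
    Y≠∅ = decidable-stable (any? (_∈? Y)) λ none → hasn't (hasModel-mono (λ x∈A → ─⁺ x∈A λ x∈Y → none (_ , x∈Y)) (Pocket.has π))
    smaller : ∣ (U ─ (Z ∪ Y)) ─ proj₁ cl ∣ < ∣ (U ─ Z) ─ F ∣
    smaller = let y , y∈Y = Y≠∅ in ⊆∧∌⇒< {p = (U ─ (Z ∪ Y)) ─ proj₁ cl}
      (λ x∈ → ─⁺ (shrink {Z} (─⁻ˡ {p = U ─ (Z ∪ Y)} x∈)) (─⁻ʳ {p = U ─ (Z ∪ Y)} x∈ ∘ proj₁ (proj₂ cl)))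
      (Y⊆H y∈Y) (λ y∈ → ─⁻ʳ {p = U} (─⁻ˡ {p = U ─ (Z ∪ Y)} y∈) (∪ʳ y∈Y))
    next : ∀ f → ∣ (U ─ Z) ─ F ∣ ≤ f → Final
    next zero    ≤f = contradiction (<-≤-trans smaller ≤f) λ ()
    next (suc f) ≤f = run f (s≤s⁻¹ (<-≤-trans smaller ≤f)) (pocket χ π (proj₂ cl))
  ... | inj₂ β = next f ≤f
    where
    open Body β
    cl : ∃[ F′ ] Closure (U ─ Z) (F ∪ X) F′
    cl = closure (∪-⊆ (chain-⊆ χ) (─⁻ˡ {p = U ─ Z} ∘ X⊆H))
    X≠∅ : ∃[ x ] x ∈ X
    X≠∅ = let r , r∈ = IsTree.nonempty tree in anchor r , b⊆X r∈ (a∈b r∈)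
    smaller : ∣ (U ─ Z) ─ proj₁ cl ∣ < ∣ (U ─ Z) ─ F ∣
    smaller = let x , x∈X = X≠∅ in ⊆∧∌⇒< {p = (U ─ Z) ─ proj₁ cl}
      (λ x∈ → ─⁺ (─⁻ˡ {p = U ─ Z} x∈) (─⁻ʳ {p = U ─ Z} x∈ ∘ proj₁ (proj₂ cl) ∘ ∪ˡ))
      (X⊆H x∈X) (λ x∈ → ─⁻ʳ {p = U ─ Z} x∈ (proj₁ (proj₂ cl) (∪ʳ x∈X)))
    next : ∀ f → ∣ (U ─ Z) ─ F ∣ ≤ f → Final
    next zero    ≤f = contradiction (<-≤-trans smaller ≤f) λ ()
    next (suc f) ≤f = run f (s≤s⁻¹ (<-≤-trans smaller ≤f)) (body χ β (proj₂ cl))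

  final : Final
  final = let F , cl = closure {U ─ ∅} {∅} (⊥-elim ∘ ∉⊥) in run _ ≤-refl (base cl)

  -- A connected set that meets both `F` and `S` contains a border vertex of `F`, so the support of
  -- a surviving model would lie beyond `F`.
  hit : ∀ {Z F b ρ} → Chain Z F b ρ → ¬ HasModel ((U ─ Z) ─ F) → ¬ HasModel (U ─ (Z ∪ border (U ─ Z) S F))
  hit {Z} {F} χ none has with support has
  ... | W , W⊆ , cW , hasW , s , s∈W , s∈S = none (hasModel-mono W⊆H hasW)
    where
    W⊆M : W ⊆ U ─ Z
    W⊆M = shrink {Z} ∘ W⊆
    W∌ : ∀ {x} → x ∈ W → x ∉ border (U ─ Z) S F
    W∌ x∈ = ─⁻ʳ {p = U} (W⊆ x∈) ∘ ∪ʳ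
    W⊆H : W ⊆ (U ─ Z) ─ F
    W⊆H {x} x∈W = ─⁺ (W⊆M x∈W) λ x∈F →
      let a , b , a~b , a∈W , b∈W , a∈F , b∉F = exit F (cW x∈W s∈W) x∈F (λ s∈F → W∌ s∈W (border⁺ s∈F (inj₁ s∈S)))
      in W∌ a∈W (border⁺ a∈F (inj₂ (b , W⊆M b∈W , b∉F , a~b)))

  take : ∀ {k a} → k ≤ a → Models a U → Models k U
  take k≤a 𝓜 = record { set = λ i → set (inject≤ i k≤a) ; set⊆ = set⊆ ; has = λ i → has (inject≤ i k≤a)
                      ; apart = λ x∈ y∈ → inject≤-injective k≤a k≤a _ _ (apart x∈ y∈) }
    where open Models 𝓜

  -- Models from pockets and models from bodies may intersect and are not combined. If neither
  -- family alone has `k` members, then `ρ` and `a` are at most `k`, and `unwind` bounds the number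
  -- of bodies.
  pack-or-hit : ∀ k → Models k U ⊎ ∃[ X ] (X ⊆ U × ∣ X ∣ ≤ (c₁ + c₂ * (c₃ + c₁)) * k × ¬ HasModel (U ─ X))
  pack-or-hit k with final
  ... | Z , F , b , ρ , χ , none with ≤-total k ρ
  ... | inj₁ k≤ρ = inj₁ (take k≤ρ (proj₁ (chain-models χ)))
  ... | inj₂ ρ≤k with unwind 0 0 χ (start (chain-⊆ χ) (chain-closed χ)) z≤n
  ... | a , 𝓜 , ≤b with ≤-total k a
  ... | inj₁ k≤a = inj₁ (take k≤a 𝓜)
  ... | inj₂ a≤k = inj₂ (Z ∪ W , ∪-⊆ (proj₁ (chain-Z χ)) (─⁻ˡ {p = U} ∘ chain-⊆ χ ∘ border⊆ {U ─ Z} {S}) , (begin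
      ∣ Z ∪ W ∣                            ≤⟨ ∣∪∣≤ Z W ⟩
      ∣ Z ∣ + ∣ W ∣                        ≤⟨ +-mono-≤ (proj₂ (chain-Z χ)) (chain-o χ) ⟩
      c₁ * ρ + c₂ * b                      ≤⟨ +-mono-≤ (*-monoʳ-≤ c₁ ρ≤k) (*-monoʳ-≤ c₂ b≤) ⟩
      c₁ * k + c₂ * (c₃ * k + c₁ * k)      ≡⟨ solve 4 (λ c d e k → c :* k :+ d :* (e :* k :+ c :* k) := (c :+ d :* (e :+ c)) :* k) refl c₁ c₂ c₃ k ⟩
      (c₁ + c₂ * (c₃ + c₁)) * k            ∎) , hit χ none)
    where
    open ≤-Reasoning
    W : Subset n
    W = border (U ─ Z) S F
    b≤ : b ≤ c₃ * k + c₁ * k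
    b≤ = begin
      b                       ≡⟨ +-identityʳ b ⟨
      b + 0                   ≤⟨ ≤b ⟩
      c₃ * a + c₁ * (ρ + 0)   ≡⟨ cong (λ j → c₃ * a + c₁ * j) (+-identityʳ ρ) ⟩
      c₃ * a + c₁ * ρ         ≤⟨ +-mono-≤ (*-monoʳ-≤ c₃ a≤k) (*-monoʳ-≤ c₁ ρ≤k) ⟩
      c₃ * k + c₁ * k         ∎

-- The bound and the translation to graphs

bound : ℕ → ℕ
bound t = c₁ + c₂ * (suc (t + c₂) + c₁)
  where
  J c₁ c₂ : ℕ
  J = t + t * t
  c₁ = J + J
  c₂ = (t + t) + J

module Transfer {n m} (G : Graph n) (S : Subset n) (T : Graph m) (tree : IsTree T) where
  open Graph G using (_~_; _~?_; ~-sym)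
  open Layers _~_ _~?_ ~-sym S T tree (V G) public

  toModel : ∀ {W} → W ⊆ V G → (h : HasModel W) → Model T G
  toModel W⊆ (br , M) = record
    { branch    = br
    ; inside    = λ x∈ → W⊆ ∘ within x∈
    ; nonempty  = λ x∈ → let s , s∈ , _ = rooted x∈ in s , s∈
    ; connected = λ {x} x∈ u∈ v∈ → conn x∈ (p∩q⊆q (V G) (br x) u∈) (p∩q⊆q (V G) (br x) v∈)
    ; disjoint  = λ {x} {y} x∈ y∈ x≢y (z , z∈) → let z∈x , z∈y = x∈p∩q⁻ (br x) (br y) z∈ in x≢y (disj x∈ y∈ z∈x z∈y)
    ; edges     = adj }
    where open IsModel M

  toModels : ∀ {k} → Models k (V G) → DisjointRootedModels k S T G
  toModels 𝓜 = (λ i → toModel set⊆ (has i))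
    , (λ i x∈ → let s , s∈ , s∈S = IsModel.rooted (proj₂ (has i)) x∈ in s , x∈p∩q⁺ (s∈ , s∈S))
    , λ {i} {j} i≢j v ((x , x∈ , v∈x) , (y , y∈ , v∈y)) →
        i≢j (apart (IsModel.within (proj₂ (has i)) x∈ v∈x) (IsModel.within (proj₂ (has j)) y∈ v∈y))
    where open Models 𝓜

  fromModel : ∀ {X} → RootedModel S T (G - X) → HasModel (V G ─ X)
  fromModel {X} (M , rt) = branch , record
    { within = λ x∈ z∈ → let z∈V , z∈∁X = x∈p∩q⁻ (V G) (∁ X) (inside′ x∈ z∈) in ─⁺ z∈V (x∈∁p⇒x∉p z∈∁X)
    ; conn   = λ x∈ u∈ v∈ → Star.map (λ ((e , _) , u∈ , v∈) → e , u∈ , v∈) (connected x∈ (x∈p∩q⁺ (inside′ x∈ u∈ , u∈)) (x∈p∩q⁺ (inside′ x∈ v∈ , v∈)))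
    ; rooted = λ {x} x∈ → let s , s∈ = rt x∈ in s , x∈p∩q⁻ (branch x) S s∈
    ; disj   = λ {x} {y} x∈ y∈ z∈x z∈y → decidable-stable (x ≟ y) λ x≢y → disjoint x∈ y∈ x≢y (_ , x∈p∩q⁺ (z∈x , z∈y))
    ; adj    = λ e → let u , v , u∈ , v∈ , (a , _) = edges e in u , v , u∈ , v∈ , a }
    where open Model M renaming (inside to inside′)

theorem1 : Σ[ g ∈ (ℕ → ℕ) ] (∀ (t : ℕ) {m : ℕ} (T : Graph m) → IsTree T → order T ≡ t →
    ∀ {n : ℕ} (G : Graph n) (S : Subset n) → S ⊆ V G →
    ∀ (k : ℕ) .{{_ : NonZero k}} →
    DisjointRootedModels k S T G ⊎
    (∃[ X ] (X ⊆ V G × ∣ X ∣ ≤ g t * k × ¬ RootedModel S T (G - X))))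
theorem1 = bound , λ t T tree |T|≡t G S S⊆ k → solution G S T tree k (trans (size≡ T (grown T tree)) |T|≡t)
  where
  open Tree using (size≡; grown; size)
  -- With `t` a variable, matching on `refl` replaces it by the size of the grown tree, where
  -- `bound` unfolds to the constants of `pack-or-hit`.
  solution : ∀ {n m} (G : Graph n) (S : Subset n) (T : Graph m) (tree : IsTree T) k {t} → size T (grown T tree) ≡ t →
             DisjointRootedModels k S T G ⊎ ∃[ X ] (X ⊆ V G × ∣ X ∣ ≤ bound t * k × ¬ RootedModel S T (G - X))
  solution G S T tree k refl with Transfer.pack-or-hit G S T tree k
  ... | inj₁ 𝓜 = inj₁ (Transfer.toModels G S T tree 𝓜)
  ... | inj₂ (X , X⊆ , ∣X∣≤ , none) = inj₂ (X , X⊆ , ∣X∣≤ , none ∘ Transfer.fromModel G S T tree)
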